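{- Let $q$ be odd and let $\mathcal U$ be a conic-BM unital with respect to $\ell_\infty$ in $\mathrm{PG}(2,q^2)$. Then for every point $Q\notin\mathcal U\cup\ell_\infty$, $\mathrm{pedal}(Q)$ is an arc.
   Context: Points of $\mathrm{PG}(2,q^2)$ have homogeneous coordinates $(x,y,z)$; $\ell_\infty$ is the line $z=0$. For $\alpha,\beta\in\mathbb{F}_{q^2}$ with $(\beta^q-\beta)^2+4\alpha^{q+1}$ a nonsquare in $\mathbb{F}_q$, the set $\mathcal U_{\alpha\beta}=\{(x,\alpha x^2+\beta x^{q+1}+r,1): x\in\mathbb{F}_{q^2}, r\in\mathbb{F}_q\}\cup\{(0,1,0)\}$ is an orthogonal Buekenhout–Metz unital with respect to $\ell_\infty$ (a set of $q^3+1$ points meeting every line in $1$ or $q+1$ points). A conic-BM unital with respect to $\ell_\infty$ is such a unital which contains a non-degenerate conic, equivalently one which is the union of $q$ non-degenerate conics pairwise meeting in the point $(0,1,0)$; up to a collineation fixing $\ell_\infty$ these are exactly the sets $\mathcal U_{\alpha\beta}$ with $\beta\in\mathbb{F}_q$. For a point $Q$ not on the unital, $\mathrm{pedal}(Q)$ is the set of points of contact of the $q+1$ tangent lines (lines meeting the unital in exactly one point) through $Q$. An arc is a set meeting every line in at most $2$ points. -}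

module Defs where

open import Level using (Level; _⊔_)
open import Algebra.Apartness.Bundles using (HeytingField; HeytingCommutativeRing)
open import Algebra.Bundles using (CommutativeRing)
open import Data.Fin.Base using (Fin)
open import Data.Nat.Base as ℕ using (ℕ; suc)
open import Data.Nat.Primality using (Prime)
open import Data.Product.Base using (∃; ∃-syntax; _×_; _,_)
open import Data.Sum.Base using (_⊎_; inj₁; inj₂)
open import Function.Bundles using (Inverse; _⇔_)
open import Relation.Binary.Bundles using (Setoid)
open import Relation.Binary.PropositionalEquality as ≡ using (_≡_)
open import Relation.Nullary.Negation using (¬_)
open import Relation.Unary using (Pred; _∈_; _⊆_)

IsPrimePower : ℕ → Set
IsPrimePower q = ∃[ p ] ∃[ h ] (Prime p × q ≡ p ℕ.^ suc h)

-- On a finite field both _≈_ and _#_ are decidable, so _#_ is just the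
-- negation of _≈_ and a finite Heyting field is a finite field in the
-- classical sense.
HasOrder : ∀ {c ℓ₁ ℓ₂} → HeytingField c ℓ₁ ℓ₂ → ℕ → Set (c ⊔ ℓ₁)
HasOrder K n = Inverse setoid (≡.setoid (Fin n))
  where
  open HeytingField K using (heytingCommutativeRing)
  open CommutativeRing (HeytingCommutativeRing.commutativeRing heytingCommutativeRing)
    using (setoid)

-- PG(2,K) and its unitals; K is meant to be the field of order q², q odd.
module Plane {c ℓ₁ ℓ₂ : Level} (K : HeytingField c ℓ₁ ℓ₂) (q : ℕ) where

  open HeytingField K using (heytingCommutativeRing; _#_; #⇒invertible; invertible⇒#)
  open CommutativeRing (HeytingCommutativeRing.commutativeRing heytingCommutativeRing)
  open import Algebra.Properties.Semiring.Exp semiring using (_^_)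
  open import Algebra.Properties.Ring ring using (-0#≈0#)
  open import Relation.Binary.Reasoning.Setoid setoid

  private
    x-0≈x : ∀ x → x - 0# ≈ x
    x-0≈x x = trans (+-congˡ -0#≈0#) (+-identityʳ x)

    unit⇒# : ∀ {x y} → x * y ≈ 1# → x # 0#
    unit⇒# {x} {y} xy≈1 = invertible⇒# (y , trans (*-comm y _) r , r)
      where
      r : (x - 0#) * y ≈ 1#
      r = trans (*-congʳ (x-0≈x x)) xy≈1

    #⇒unit : ∀ {x} → x # 0# → ∃[ y ] (x * y ≈ 1#)
    #⇒unit {x} x#0 with #⇒invertible x#0
    ... | y , _ , r = y , trans (*-congʳ (sym (x-0≈x x))) r

  1#0 : 1# # 0#
  1#0 = unit⇒# (*-identityˡ 1#)

  -- Homogeneous coordinates, used for points (x,y,z) and, dually, for the lines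
  -- with equation xX + yY + zZ = 0.
  record Coords : Set (c ⊔ ℓ₂) where
    constructor ⟨_,_,_⟩[_]
    field
      x y z   : Carrier
      nonzero : x # 0# ⊎ y # 0# ⊎ z # 0#

  Point Line : Set (c ⊔ ℓ₂)
  Point = Coords
  Line  = Coords

  open Coords

  infix 4 _∼_ _I_

  _∼_ : Coords → Coords → Set (c ⊔ ℓ₁ ⊔ ℓ₂)
  P ∼ R = ∃[ k ] (k # 0# × x P ≈ k * x R × y P ≈ k * y R × z P ≈ k * z R)

  coordsSetoid : Setoid (c ⊔ ℓ₂) (c ⊔ ℓ₁ ⊔ ℓ₂)
  coordsSetoid = record
    { Carrier       = Coords
    ; _≈_           = _∼_
    ; isEquivalence = record
      { refl  = λ {P} → ∼-refl {P}
      ; sym   = λ {P} {R} → ∼-sym {P} {R}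
      ; trans = λ {P} {R} {S} → ∼-trans {P} {R} {S}
      }
    }
    where
    ∼-refl : ∀ {P} → P ∼ P
    ∼-refl = 1# , 1#0 , one , one , one
      where
      one : ∀ {a} → a ≈ 1# * a
      one = sym (*-identityˡ _)

    ∼-sym : ∀ {P R} → P ∼ R → R ∼ P
    ∼-sym {P} {R} (k , k#0 , ex , ey , ez) with #⇒unit k#0
    ... | k′ , kk′≈1 = k′ , unit⇒# k′k≈1 , flip ex , flip ey , flip ez
      where
      k′k≈1 : k′ * k ≈ 1#
      k′k≈1 = trans (*-comm k′ k) kk′≈1
      flip : ∀ {a b} → a ≈ k * b → b ≈ k′ * a
      flip {a} {b} e = begin
        b             ≈⟨ *-identityˡ b ⟨
        1# * b        ≈⟨ *-congʳ k′k≈1 ⟨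
        (k′ * k) * b  ≈⟨ *-assoc k′ k b ⟩
        k′ * (k * b)  ≈⟨ *-congˡ e ⟨
        k′ * a        ∎

    ∼-trans : ∀ {P R S} → P ∼ R → R ∼ S → P ∼ S
    ∼-trans {P} {R} {S} (k , k#0 , ex , ey , ez) (m , m#0 , fx , fy , fz)
      with #⇒unit k#0 | #⇒unit m#0
    ... | k′ , kk′≈1 | m′ , mm′≈1 =
      k * m , unit⇒# km-unit , comp ex fx , comp ey fy , comp ez fz
      where
      km-unit : (k * m) * (m′ * k′) ≈ 1#
      km-unit = begin
        (k * m) * (m′ * k′)  ≈⟨ *-assoc k m _ ⟩
        k * (m * (m′ * k′))  ≈⟨ *-congˡ (*-assoc m m′ k′) ⟨
        k * ((m * m′) * k′)  ≈⟨ *-congˡ (*-congʳ mm′≈1) ⟩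
        k * (1# * k′)        ≈⟨ *-congˡ (*-identityˡ k′) ⟩
        k * k′               ≈⟨ kk′≈1 ⟩
        1#                   ∎
      comp : ∀ {a b d} → a ≈ k * b → b ≈ m * d → a ≈ (k * m) * d
      comp e f = trans e (trans (*-congˡ f) (sym (*-assoc k m _)))

  _I_ : Point → Line → Set ℓ₁
  P I l = x l * x P + y l * y P + z l * z P ≈ 0#

  ℓ∞ : Line
  ℓ∞ = ⟨ 0# , 0# , 1# ⟩[ inj₂ (inj₂ 1#0) ]

  P∞ : Point
  P∞ = ⟨ 0# , 1# , 0# ⟩[ inj₂ (inj₁ 1#0) ]

  affine : Carrier → Carrier → Point
  affine a b = ⟨ a , b , 1# ⟩[ inj₂ (inj₂ 1#0) ]

  record Collineation : Set (c ⊔ ℓ₁ ⊔ ℓ₂) where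
    field
      onPoints  : Inverse coordsSetoid coordsSetoid
      onLines   : Inverse coordsSetoid coordsSetoid
      incidence : ∀ P l → (P I l) ⇔ (Inverse.to onPoints P I Inverse.to onLines l)

    point : Point → Point
    point = Inverse.to onPoints

    line : Line → Line
    line = Inverse.to onLines

  -- The subfield 𝔽_q of 𝔽_{q²}, as the fixed field of the map x ↦ x^q.
  𝔽q : Pred Carrier ℓ₁
  𝔽q a = a ^ q ≈ a

  NonsquareInFq : Pred Carrier (c ⊔ ℓ₁)
  NonsquareInFq d = d ∈ 𝔽q × ¬ (∃[ s ] (s ∈ 𝔽q × s * s ≈ d))

  four : Carrier
  four = 1# + 1# + 1# + 1#

  Admissible : Carrier → Carrier → Set (c ⊔ ℓ₁)
  Admissible α β =
    NonsquareInFq ((β ^ q - β) * (β ^ q - β) + four * α ^ suc q)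

  𝒰 : Carrier → Carrier → Pred Point (c ⊔ ℓ₁ ⊔ ℓ₂)
  𝒰 α β P =
      (∃[ t ] ∃[ r ] (r ∈ 𝔽q × P ∼ affine t (α * (t * t) + β * t ^ suc q + r)))
    ⊎ P ∼ P∞

  -- The sets 𝒰 α β represent the orthogonal Buekenhout–Metz unitals with respect
  -- to ℓ∞ up to collineations fixing ℓ∞; the general one is an image of some 𝒰 α β.
  IsOrthogonalBM : ∀ {u} → Pred Point u → Set (c ⊔ ℓ₁ ⊔ ℓ₂ ⊔ u)
  IsOrthogonalBM U =
    ∃[ α ] ∃[ β ] (Admissible α β × (∃[ φ ] (
      Collineation.line φ ℓ∞ ∼ ℓ∞ ×
      (∀ P → P ∈ U ⇔ (∃[ R ] (R ∈ 𝒰 α β × Collineation.point φ R ∼ P))))))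

  -- The zero set of the ternary quadratic form with symmetric matrix
  --   a h g
  --   h b f
  --   g f d
  -- (every quadratic form has one, the characteristic being odd); it is
  -- non-degenerate when the determinant is nonzero.
  record NondegenerateConic : Set (c ⊔ ℓ₂) where
    field
      a b d f g h : Carrier

    det : Carrier
    det = a * (b * d - f * f) - h * (h * d - f * g) + g * (h * f - b * g)

    field
      nondegenerate : det # 0#

    points : Pred Point ℓ₁
    points P =
        x P * (a * x P + h * y P + g * z P)
      + y P * (h * x P + b * y P + f * z P)
      + z P * (g * x P + f * y P + d * z P) ≈ 0#

  IsConicBM : ∀ {u} → Pred Point u → Set (c ⊔ ℓ₁ ⊔ ℓ₂ ⊔ u)
  IsConicBM U =
    IsOrthogonalBM U × (∃[ C ] (NondegenerateConic.points C ⊆ U))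

  MeetsOnlyAt : ∀ {u} → Pred Point u → Line → Point → Set (c ⊔ ℓ₁ ⊔ ℓ₂ ⊔ u)
  MeetsOnlyAt U l P = P ∈ U × P I l × (∀ R → R ∈ U → R I l → R ∼ P)

  pedal : ∀ {u} → Pred Point u → Point → Pred Point (c ⊔ ℓ₁ ⊔ ℓ₂ ⊔ u)
  pedal U Q P = ∃[ l ] (Q I l × MeetsOnlyAt U l P)

  IsArc : ∀ {s} → Pred Point s → Set (c ⊔ ℓ₁ ⊔ ℓ₂ ⊔ s)
  IsArc S =
    ∀ l P₁ P₂ P₃ → P₁ ∈ S → P₂ ∈ S → P₃ ∈ S → P₁ I l → P₂ I l → P₃ I l →
    P₁ ∼ P₂ ⊎ P₁ ∼ P₃ ⊎ P₂ ∼ P₃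

{-# OPTIONS --safe #-}

-- Write conj x = x^q and Im x = x - conj x, and call x real if Im x = 0, that is x ∈ 𝔽_q.
-- For real β the tangent to 𝒰 α β at the affine point (t , s) has slope 2αt, because
-- Im(α u²) vanishes only for u = 0. The tangents through (a , b) therefore touch at points
-- of the parabola y = 2αx² - 2αax + b, which no line meets three times.
-- A conic-BM unital is the image of some 𝒰 α β under a collineation. This collineation is
-- semilinear, so the conic pulls back to a conic inside 𝒰 α β. If the latter is a parabola
-- with vertical axis, comparing its second differences in the directions 1 and ε, where
-- conj ε = - ε, shows that β is real. If it is a hyperbola with a vertical asymptote
-- x = x₀, then y is a Laurent polynomial in x - x₀, and the vanishing of the odd part of
-- Im(y - αx² - βx conj x) excludes the pole. Otherwise a vertical line meets it in points whose
-- ordinates have a real difference, which contradicts a rational parametrisation.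
module Submission where

open import Defs
open import Algebra.Apartness.Bundles using (HeytingField; HeytingCommutativeRing)
open import Algebra.Bundles using (CommutativeRing)
open import Data.Empty using (⊥)
open import Data.Fin.Base as Fin using (Fin; zero; suc; punchIn; punchOut; inject₁; fromℕ)
open import Data.Fin.Permutation using (Permutation′; permutation; _⟨$⟩ʳ_)
import Data.Fin.Properties as Fin
open import Data.Nat.Base as ℕ using (ℕ; zero; suc)
open import Data.Nat.Combinatorics using (nCk+nC[k+1]≡[n+1]C[k+1]; k>n⇒nCk≡0; nCn≡1)
  renaming (_C_ to _choose_)
open import Data.Nat.Divisibility using (_∣_; divides; m∣m*n; ∣⇒≤)
open import Data.Nat.DivMod using (_%_; _/_; m≡m%n+[m/n]*n; m%n<n)
open import Data.Nat.Primality using (Prime; euclidsLemma; ¬prime[0])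
import Data.Nat.Properties as ℕ
open import Data.Product.Base using (∃; ∃-syntax; _×_; _,_; proj₁; proj₂; swap)
open import Data.Sum.Base as Sum using (_⊎_; inj₁; inj₂)
open import Function.Base using (_∘_)
open import Function.Bundles using (Inverse; _⇔_; Equivalence; mk⇔)
import Function.Construct.Symmetry as Symmetry
open import Level using (Level; _⊔_)
open import Relation.Binary.Bundles using (Setoid)
open import Relation.Binary.Definitions using (tri<; tri≈; tri>)
open import Relation.Binary.PropositionalEquality as ≡ using (_≡_; _≢_)
open import Relation.Nullary.Decidable as Dec using (Dec; yes; no)
open import Relation.Nullary.Negation using (¬_; contradiction)
open import Relation.Unary using (Pred; _∈_; _⊆_)

-- `IsConicBM` does not say that β is real; this has to be extracted from the conic, and two
-- obstacles shape the argument. A `Collineation` is a bare incidence-preserving bijection, so the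
-- fundamental theorem of affine geometry must be established before a conic can be carried back.
-- And the wrong conics must be excluded for every odd q, small ones included, where a function does
-- not determine the coefficients of a polynomial; hence every reality condition is tested at a few
-- points built from 1 and a nonzero skew ε. Such an ε is β - conj β, if β is not real. Apart from
-- vertical parabolas, nearly everything rests on one fact: if A t + c / t is real for all t ≠ 0,
-- then c = 0. A conic with a y² term leads to s² = D x² + 2 M x + L with κ = M² - D L ≠ 0. If D is
-- a square, s is such a Laurent polynomial; if κ is a square and D is not, 1 / s is one. If κ is D
-- times a square, neither is available: there -1 is a square, which gives a point from which the
-- solutions of r² - D u² = 1 produce further ones.

module IntegerSolver {c ℓ} (R : CommutativeRing c ℓ) where

  open import Algebra.Solver.Ring.AlmostCommutativeRing
    using (fromCommutativeRing; _-Raw-AlmostCommutative⟶_)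
  import Algebra.Solver.Ring as RingSolver
  open import Data.Integer.Base as ℤ using (ℤ; +_; -[1+_]; _⊖_)
  open import Data.Integer.Properties as ℤ using (+-*-commutativeRing)
  open import Data.Maybe.Base using (Maybe; just; nothing)

  open CommutativeRing R hiding (zero)
  open import Algebra.Properties.Ring ring
  open import Algebra.Properties.AbelianGroup +-abelianGroup using (⁻¹-∙-comm)
  open import Algebra.Properties.Semiring.Mult.TCOptimised semiring
    using (×-homo-+; ×1-homo-*; 1+×) renaming (_×_ to _·_)
  open import Relation.Binary.Reasoning.Setoid setoid

  -- The canonical homomorphism from the integers. Integer coefficients have an equality that is
  -- decided by computation, which lets the solver cancel opposite terms in any commutative ring.
  fromℤ : ℤ → Carrier
  fromℤ (+ n)      = n · 1#
  fromℤ (-[1+ n ]) = - (suc n · 1#)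

  private
    cancel : ∀ a b d → (a + b) - (a + d) ≈ b - d
    cancel a b d = begin
      (a + b) - (a + d)       ≈⟨ +-congˡ (⁻¹-∙-comm a d) ⟨
      (a + b) + (- a - d)     ≈⟨ +-congʳ (+-comm a b) ⟩
      (b + a) + (- a - d)     ≈⟨ +-assoc b a _ ⟩
      b + (a + (- a - d))     ≈⟨ +-congˡ (+-assoc a (- a) (- d)) ⟨
      b + ((a - a) - d)       ≈⟨ +-congˡ (+-congʳ (-‿inverseʳ a)) ⟩
      b + (0# - d)            ≈⟨ +-congˡ (+-identityˡ _) ⟩
      b - d                   ∎

    fromℤ-⊖ : ∀ m n → fromℤ (m ⊖ n) ≈ m · 1# - n · 1#
    fromℤ-⊖ m       zero    = begin
      m · 1#        ≈⟨ +-identityʳ _ ⟨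
      m · 1# + 0#   ≈⟨ +-congˡ -0#≈0# ⟨
      m · 1# - 0#   ∎
    fromℤ-⊖ zero    (suc n) = sym (+-identityˡ _)
    fromℤ-⊖ (suc m) (suc n) = begin
      fromℤ (suc m ⊖ suc n)            ≡⟨ ≡.cong fromℤ (ℤ.[1+m]⊖[1+n]≡m⊖n m n) ⟩
      fromℤ (m ⊖ n)                    ≈⟨ fromℤ-⊖ m n ⟩
      m · 1# - n · 1#                  ≈⟨ cancel 1# _ _ ⟨
      (1# + m · 1#) - (1# + n · 1#)    ≈⟨ +-cong (1+× m 1#) (-‿cong (1+× n 1#)) ⟨
      suc m · 1# - suc n · 1#          ∎

    fromℤ-neg : ∀ i → fromℤ (ℤ.- i) ≈ - fromℤ i
    fromℤ-neg (+ zero)   = sym -0#≈0#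
    fromℤ-neg (+ suc n)  = refl
    fromℤ-neg (-[1+ n ]) = sym (-‿involutive _)

    fromℤ-+ : ∀ i j → fromℤ (i ℤ.+ j) ≈ fromℤ i + fromℤ j
    fromℤ-+ (+ m)      (+ n)      = ×-homo-+ 1# m n
    fromℤ-+ (+ m)      (-[1+ n ]) = fromℤ-⊖ m (suc n)
    fromℤ-+ (-[1+ m ]) (+ n)      = trans (fromℤ-⊖ n (suc m)) (+-comm _ _)
    fromℤ-+ (-[1+ m ]) (-[1+ n ]) = begin
      - (suc (suc (m ℕ.+ n)) · 1#)          ≡⟨ ≡.cong (λ k → - (suc k · 1#)) (ℕ.+-suc m n) ⟨
      - ((suc m ℕ.+ suc n) · 1#)            ≈⟨ -‿cong (×-homo-+ 1# (suc m) (suc n)) ⟩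
      - (suc m · 1# + suc n · 1#)           ≈⟨ ⁻¹-∙-comm _ _ ⟨
      - (suc m · 1#) - suc n · 1#           ∎

    fromℤ-*-pos : ∀ m j → fromℤ (+ m ℤ.* j) ≈ m · 1# * fromℤ j
    fromℤ-*-pos m (+ n) = begin
      fromℤ (+ m ℤ.* + n)      ≡⟨ ≡.cong fromℤ (ℤ.pos-* m n) ⟨
      (m ℕ.* n) · 1#           ≈⟨ ×1-homo-* m n ⟩
      m · 1# * n · 1#          ∎
    fromℤ-*-pos m (-[1+ n ]) = begin
      fromℤ (+ m ℤ.* -[1+ n ])         ≡⟨ ≡.cong fromℤ (ℤ.neg-distribʳ-* (+ m) (+ suc n)) ⟨
      fromℤ (ℤ.- (+ m ℤ.* + suc n))    ≈⟨ fromℤ-neg (+ m ℤ.* + suc n) ⟩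
      - fromℤ (+ m ℤ.* + suc n)        ≈⟨ -‿cong (fromℤ-*-pos m (+ suc n)) ⟩
      - (m · 1# * suc n · 1#)          ≈⟨ -‿distribʳ-* _ _ ⟩
      m · 1# * - (suc n · 1#)          ∎

    fromℤ-* : ∀ i j → fromℤ (i ℤ.* j) ≈ fromℤ i * fromℤ j
    fromℤ-* (+ m)      j = fromℤ-*-pos m j
    fromℤ-* (-[1+ m ]) j = begin
      fromℤ (-[1+ m ] ℤ.* j)        ≡⟨ ≡.cong fromℤ (ℤ.neg-distribˡ-* (+ suc m) j) ⟨
      fromℤ (ℤ.- (+ suc m ℤ.* j))   ≈⟨ fromℤ-neg (+ suc m ℤ.* j) ⟩
      - fromℤ (+ suc m ℤ.* j)       ≈⟨ -‿cong (fromℤ-*-pos (suc m) j) ⟩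
      - (suc m · 1# * fromℤ j)      ≈⟨ -‿distribˡ-* _ _ ⟩
      - (suc m · 1#) * fromℤ j      ∎

    fromℤ-morphism : CommutativeRing.rawRing +-*-commutativeRing
                       -Raw-AlmostCommutative⟶ fromCommutativeRing R
    fromℤ-morphism = record
      { ⟦_⟧    = fromℤ
      ; +-homo = fromℤ-+
      ; *-homo = fromℤ-*
      ; -‿homo = fromℤ-neg
      ; 0-homo = refl
      ; 1-homo = refl
      }

    coeff≟ : ∀ i j → Maybe (fromℤ i ≈ fromℤ j)
    coeff≟ i j with i ℤ.≟ j
    ... | yes i≡j = just (reflexive (≡.cong fromℤ i≡j))
    ... | no  _   = nothing

  open RingSolver (CommutativeRing.rawRing +-*-commutativeRing)
    (fromCommutativeRing R) fromℤ-morphism coeff≟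
    public using (solve; _:=_; con; _:+_; _:*_; _:-_; :-_; Polynomial)

  :0 :1 :2 : ∀ {n} → Polynomial n
  :0 = con (+ 0)
  :1 = con (+ 1)
  :2 = :1 :+ :1

  2# : Carrier
  2# = 1# + 1#

  -- An equation a ≈ b follows from u ≈ v once a + v ≈ b + u is an identity of
  -- commutative rings, which leaves the verification to the solver.
  by : ∀ {u v a b} → u ≈ v → a + v ≈ b + u → a ≈ b
  by {u} {v} {a} {b} u≈v eq = +-cancelʳ u a b (trans (+-congˡ u≈v) eq)

  infixr 7 _⊛_
  infixl 6 _⊞_

  -- Used under `by`, these two operations present a goal as a linear combination of hypotheses with
  -- polynomial coefficients. The coefficients are the certificate; what remains is a ring identity.
  _⊛_ : ∀ k {u v} → u ≈ v → k * u ≈ k * v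
  k ⊛ u≈v = *-congˡ u≈v

  _⊞_ : ∀ {u v x y} → u ≈ v → x ≈ y → u + x ≈ v + y
  _⊞_ = +-cong

-- Binomial coefficients modulo a prime.

[k+1]*[n+1]C[k+1]≡[n+1]*nCk : ∀ n k → suc k ℕ.* (suc n choose suc k) ≡ suc n ℕ.* (n choose k)
[k+1]*[n+1]C[k+1]≡[n+1]*nCk zero    zero    = ≡.refl
[k+1]*[n+1]C[k+1]≡[n+1]*nCk zero    (suc k) = ≡.trans
  (≡.cong (suc (suc k) ℕ.*_) (k>n⇒nCk≡0 {1} {suc (suc k)} (ℕ.s≤s (ℕ.s≤s ℕ.z≤n))))
  (≡.trans (ℕ.*-zeroʳ (suc (suc k))) (≡.sym (≡.cong (1 ℕ.*_) (k>n⇒nCk≡0 {0} {suc k} (ℕ.s≤s ℕ.z≤n)))))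
[k+1]*[n+1]C[k+1]≡[n+1]*nCk (suc m) k = begin
  suc k ℕ.* (suc (suc m) choose suc k)
    ≡⟨ ≡.cong (suc k ℕ.*_) (nCk+nC[k+1]≡[n+1]C[k+1] (suc m) k) ⟨
  suc k ℕ.* (suc m choose k ℕ.+ suc m choose suc k)
    ≡⟨ ℕ.*-distribˡ-+ (suc k) (suc m choose k) _ ⟩
  suc k ℕ.* (suc m choose k) ℕ.+ suc k ℕ.* (suc m choose suc k)
    ≡⟨ ≡.cong₂ ℕ._+_ (first k) ([k+1]*[n+1]C[k+1]≡[n+1]*nCk m k) ⟩
  (suc m choose k ℕ.+ d k) ℕ.+ suc m ℕ.* (m choose k)
    ≡⟨ ℕ.+-assoc (suc m choose k) (d k) _ ⟩
  suc m choose k ℕ.+ (d k ℕ.+ suc m ℕ.* (m choose k))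
    ≡⟨ ≡.cong (suc m choose k ℕ.+_) (last k) ⟩
  suc (suc m) ℕ.* (suc m choose k)
    ∎
  where
  open ≡.≡-Reasoning
  -- `d k` is `k ℕ.* (suc m choose k)`, already rewritten by the induction hypothesis when `k` is
  -- positive.
  d : ℕ → ℕ
  d zero    = 0
  d (suc j) = suc m ℕ.* (m choose j)
  first : ∀ j → suc j ℕ.* (suc m choose j) ≡ suc m choose j ℕ.+ d j
  first zero    = ≡.refl
  first (suc j) = ≡.cong (suc m choose suc j ℕ.+_) ([k+1]*[n+1]C[k+1]≡[n+1]*nCk m j)
  last : ∀ j → d j ℕ.+ suc m ℕ.* (m choose j) ≡ suc m ℕ.* (suc m choose j)
  last zero    = ≡.refl
  last (suc j) = ≡.trans (≡.sym (ℕ.*-distribˡ-+ (suc m) (m choose j) _))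
    (≡.cong (suc m ℕ.*_) (nCk+nC[k+1]≡[n+1]C[k+1] m j))

-- By absorption the prime divides the product of `suc k` and the binomial coefficient, and the
-- factor `suc k` is too small to be a multiple of it.
prime∣pCk : ∀ {p} → Prime (suc p) → ∀ {k} → k ℕ.< p → suc p ∣ suc p choose suc k
prime∣pCk {p} p-prime {k} k<p
  with euclidsLemma (suc k) (suc p choose suc k) p-prime
         (divides (p choose k) (≡.trans ([k+1]*[n+1]C[k+1]≡[n+1]*nCk p k) (ℕ.*-comm (suc p) (p choose k))))
... | inj₁ p∣k+1 = contradiction (∣⇒≤ p∣k+1) (ℕ.<⇒≱ (ℕ.s≤s k<p))
... | inj₂ p∣C   = p∣C

-- Finite fields: decidability, the Frobenius map, squares.

module FiniteField {c ℓ₁ ℓ₂} (K : HeytingField c ℓ₁ ℓ₂) (n : ℕ) (order : HasOrder K n) where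

  open HeytingField K using (heytingCommutativeRing; _#_; #⇒invertible; invertible⇒#; tight)

  commutativeRing : CommutativeRing c ℓ₁
  commutativeRing = HeytingCommutativeRing.commutativeRing heytingCommutativeRing

  open CommutativeRing commutativeRing hiding (zero)
  open IntegerSolver commutativeRing
  open import Algebra.Properties.CommutativeSemiring.Exp commutativeSemiring
  open import Algebra.Properties.Ring ring using (+-cancelˡ; x∙y⁻¹≈ε⇒x≈y; -0#≈0#; -‿involutive)
  open import Algebra.Properties.Semiring.Mult semiring
    using (×1-homo-*; ×-congʳ; ×-assoc-*; ×-homo-1) renaming (_×_ to _·_)
  import Algebra.Properties.CommutativeMonoid.Sum as Sums
  import Algebra.Properties.CommutativeSemiring.Binomial commutativeSemiring as Binomial
  open import Relation.Binary.Reasoning.Setoid setoid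
  open Inverse order using (to; from; to-cong; strictlyInverseˡ; strictlyInverseʳ)

  infix 4 _≟_

  to-injective : ∀ {x y} → to x ≡ to y → x ≈ y
  to-injective {x} {y} eq = begin
    x              ≈⟨ strictlyInverseʳ x ⟨
    from (to x)    ≡⟨ ≡.cong from eq ⟩
    from (to y)    ≈⟨ strictlyInverseʳ y ⟩
    y              ∎

  _≟_ : ∀ x y → Dec (x ≈ y)
  x ≟ y = Dec.map′ to-injective to-cong (to x Fin.≟ to y)

  any? : ∀ {p} {P : Carrier → Set p} → (∀ {x y} → x ≈ y → P x → P y) →
         (∀ x → Dec (P x)) → Dec (∃ P)
  any? resp P? = Dec.map′
    (λ (i , Pi) → from i , Pi)
    (λ (x , Px) → to x , resp (sym (strictlyInverseʳ x)) Px)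
    (Fin.any? (P? ∘ from))

  x-y≈0⇒x≈y : ∀ {x y} → x - y ≈ 0# → x ≈ y
  x-y≈0⇒x≈y {x} {y} = x∙y⁻¹≈ε⇒x≈y x y

  x-0≈x : ∀ x → x - 0# ≈ x
  x-0≈x x = trans (+-congˡ -0#≈0#) (+-identityʳ x)

  -- Proofs that occur in a with-scrutinee are abstract, here and below: with-abstraction
  -- normalises the scrutinee, and with it every call of the ring solver.
  abstract
    inverse : ∀ {x} → x ≉ 0# → ∃[ y ] x * y ≈ 1#
    inverse {x} x≉0
      with any? {P = λ y → x * y ≈ 1#} (λ y≈z → trans (*-congˡ (sym y≈z))) (λ y → x * y ≟ 1#)
    ... | yes y = y
    -- Tightness turns failure of apartness into equality but does not turn `x ≉ 0#` into apartness.
    -- The inverse is therefore found by exhaustive search, and only its failure is refuted by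
    -- tightness.
    ... | no ¬y = contradiction (proj₁ (tight x 0#) ¬x#0) x≉0
      where
      ¬x#0 : ¬ (x # 0#)
      ¬x#0 x#0 with #⇒invertible x#0
      ... | y , _ , xy≈1 = ¬y (y , trans (*-congʳ (sym (x-0≈x x))) xy≈1)

  ≉⇒# : ∀ {x} → x ≉ 0# → x # 0#
  ≉⇒# {x} x≉0 with inverse x≉0
  ... | y , xy≈1 = invertible⇒# (y , trans (*-comm _ _) r , r)
    where
    r : (x - 0#) * y ≈ 1#
    r = trans (*-congʳ (x-0≈x x)) xy≈1

  #⇒≉ : ∀ {x} → x # 0# → x ≉ 0#
  #⇒≉ {x} x#0 x≈0 = proj₂ (tight x 0#) x≈0 x#0

  1≉0 : 1# ≉ 0#
  1≉0 = #⇒≉ (invertible⇒# (1# , trans (*-identityˡ _) (x-0≈x 1#) , trans (*-identityʳ _) (x-0≈x 1#)))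

  *-cancelˡ-≉ : ∀ {x y z} → x ≉ 0# → x * y ≈ x * z → y ≈ z
  *-cancelˡ-≉ {x} {y} {z} x≉0 xy≈xz with inverse x≉0
  ... | x⁻¹ , xx⁻¹≈1 = begin
    y                ≈⟨ undo y ⟨
    x⁻¹ * (x * y)    ≈⟨ *-congˡ xy≈xz ⟩
    x⁻¹ * (x * z)    ≈⟨ undo z ⟩
    z                ∎
    where
    undo : ∀ w → x⁻¹ * (x * w) ≈ w
    undo w = begin
      x⁻¹ * (x * w)    ≈⟨ *-assoc x⁻¹ x w ⟨
      x⁻¹ * x * w      ≈⟨ *-congʳ (trans (*-comm x⁻¹ x) xx⁻¹≈1) ⟩
      1# * w           ≈⟨ *-identityˡ w ⟩
      w                ∎

  x*y≈0⇒y≈0 : ∀ {x y} → x ≉ 0# → x * y ≈ 0# → y ≈ 0#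
  x*y≈0⇒y≈0 x≉0 xy≈0 = *-cancelˡ-≉ x≉0 (trans xy≈0 (sym (zeroʳ _)))

  x*y≉0 : ∀ {x y} → x ≉ 0# → y ≉ 0# → x * y ≉ 0#
  x*y≉0 x≉0 y≉0 xy≈0 = y≉0 (x*y≈0⇒y≈0 x≉0 xy≈0)

  x*y≈0⇒x≈0⊎y≈0 : ∀ {x y} → x * y ≈ 0# → x ≈ 0# ⊎ y ≈ 0#
  x*y≈0⇒x≈0⊎y≈0 {x} xy≈0 with x ≟ 0#
  ... | yes x≈0 = inj₁ x≈0
  ... | no  x≉0 = inj₂ (x*y≈0⇒y≈0 x≉0 xy≈0)

  x*y≈1⇒x≉0 : ∀ {x y} → x * y ≈ 1# → x ≉ 0#
  x*y≈1⇒x≉0 xy≈1 x≈0 = 1≉0 (trans (sym xy≈1) (trans (*-congʳ x≈0) (zeroˡ _)))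

  x*y≈1⇒y≉0 : ∀ {x y} → x * y ≈ 1# → y ≉ 0#
  x*y≈1⇒y≉0 xy≈1 = x*y≈1⇒x≉0 (trans (*-comm _ _) xy≈1)

  ^≉0 : ∀ {x} → x ≉ 0# → ∀ m → x ^ m ≉ 0#
  ^≉0 x≉0 zero    = 1≉0
  ^≉0 x≉0 (suc m) = x*y≉0 x≉0 (^≉0 x≉0 m)

  abstract
    injective⇒surjective : ∀ (f : Carrier → Carrier) → (∀ {x y} → x ≈ y → f x ≈ f y) →
      (∀ {x y} → f x ≈ f y → x ≈ y) → ∀ y → ∃[ x ] f x ≈ y
    injective⇒surjective f f-cong f-inj y
      with any? {P = λ x → f x ≈ y} (λ x≈z → trans (f-cong (sym x≈z))) (λ x → f x ≟ y)
    ... | yes x = x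
    ... | no ¬x = contradiction order (¬order n)
      where
      -- As f misses y, the enumeration of f embeds Fin (suc m) into Fin m.
      ¬order : ∀ m → ¬ HasOrder K m
      ¬order zero    o = Fin.¬Fin0 (Inverse.to o y)
      ¬order (suc m) o = ℕ.1+n≰n (Fin.injective⇒≤ {f = λ i → punchOut (missed i)} λ {i} {j} eq →
        ≡.trans (≡.sym (O.strictlyInverseˡ i))
          (≡.trans (O.to-cong (f-inj (to-inj (Fin.punchOut-injective (missed i) (missed j) eq))))
            (O.strictlyInverseˡ j)))
        where
        module O = Inverse o
        to-inj : ∀ {x z} → O.to x ≡ O.to z → x ≈ z
        to-inj eq = trans (sym (O.strictlyInverseʳ _))
              (trans (reflexive (≡.cong O.from eq)) (O.strictlyInverseʳ _))
        missed : ∀ i → O.to y ≢ O.to (f (O.from i))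
        missed i eq = ¬x (O.from i , sym (to-inj eq))

  permute : (f g : Carrier → Carrier) → (∀ {x y} → x ≈ y → f x ≈ f y) → (∀ {x y} → x ≈ y → g x ≈ g y) →
            (∀ x → f (g x) ≈ x) → (∀ x → g (f x) ≈ x) → Permutation′ n
  permute f g f-cong g-cong fg gf = permutation (to ∘ f ∘ from) (to ∘ g ∘ from)
    (λ i → ≡.trans (to-cong (trans (f-cong (strictlyInverseʳ _)) (fg _))) (strictlyInverseˡ i))
    (λ i → ≡.trans (to-cong (trans (g-cong (strictlyInverseʳ _)) (gf _))) (strictlyInverseˡ i))

  -- Translating by x permutes K, so that Σ y = Σ (y + x) = Σ y + n · x.
  n·x≈0 : ∀ x → n · x ≈ 0#
  n·x≈0 x = +-cancelˡ (sum from) _ _ (begin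
    sum from + n · x                       ≈⟨ +-congˡ (sum-replicate n) ⟨
    sum from + sum (λ (_ : Fin n) → x)     ≈⟨ ∑-distrib-+ from (λ _ → x) ⟨
    sum (λ i → from i + x)                 ≈⟨ sum-cong-≋ (λ i → strictlyInverseʳ (from i + x)) ⟨
    sum (from ∘ (π ⟨$⟩ʳ_))                 ≈⟨ sum-permute from π ⟨
    sum from                               ≈⟨ +-identityʳ _ ⟨
    sum from + 0#                          ∎)
    where
    open Sums +-commutativeMonoid
    π : Permutation′ n
    π = permute (_+ x) (_- x) +-congʳ +-congʳ
          (λ y → solve 2 (λ y x → y :- x :+ x := y) refl y x)
          (λ y → solve 2 (λ y x → y :+ x :- x := y) refl y x)

  module _ where
    open Sums *-commutativeMonoid renaming (sum to ∏; sum-cong-≋ to ∏-cong; sum-permute to ∏-permute)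

    private
      ∏≉0 : ∀ {m} (t : Fin m → Carrier) → (∀ i → t i ≉ 0#) → ∏ t ≉ 0#
      ∏≉0 {zero}  t t≉0 = 1≉0
      ∏≉0 {suc m} t t≉0 = x*y≉0 (t≉0 zero) (∏≉0 (t ∘ suc) (t≉0 ∘ suc))

      -- The extra factor `x` fills the place of the one entry equal to 1, so that the exponent is
      -- `m` and no predecessor appears in `x^n≈x`.
      ∏-constant-but-one : ∀ {m} (i : Fin m) (t : Fin m → Carrier) {x} → t i ≈ 1# →
                           (∀ j → j ≢ i → t j ≈ x) → x * ∏ t ≈ x ^ m
      ∏-constant-but-one {suc m} i t {x} tᵢ≈1 tⱼ≈x = *-congˡ (begin
        ∏ t                             ≈⟨ sum-remove {i = i} t ⟩
        t i * ∏ (t ∘ punchIn i)         ≈⟨ *-cong tᵢ≈1 (∏-cong λ j → tⱼ≈x (punchIn i j) (Fin.punchInᵢ≢i i j)) ⟩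
        1# * ∏ (λ (_ : Fin m) → x)      ≈⟨ *-identityˡ _ ⟩
        ∏ (λ (_ : Fin m) → x)           ≈⟨ sum-replicate m ⟩
        x ^ m                           ∎)

      -- Turning 0 into 1 makes the product over the whole enumeration the product of the nonzero
      -- elements. `scale a x` is the factor by which `nonzero x` changes when `x` is multiplied by
      -- `a`.
      nonzero : Carrier → Carrier
      nonzero x with x ≟ 0#
      ... | yes _ = 1#
      ... | no  _ = x

      scale : Carrier → Carrier → Carrier
      scale a x with x ≟ 0#
      ... | yes _ = 1#
      ... | no  _ = a

      nonzero≉0 : ∀ x → nonzero x ≉ 0#
      nonzero≉0 x with x ≟ 0#
      ... | yes _   = 1≉0
      ... | no  x≉0 = x≉0

      nonzero-cong : ∀ {x y} → x ≈ y → nonzero x ≈ nonzero y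
      nonzero-cong {x} {y} x≈y with x ≟ 0# | y ≟ 0#
      ... | yes _   | yes _   = refl
      ... | no  _   | no  _   = x≈y
      ... | yes x≈0 | no  y≉0 = contradiction (trans (sym x≈y) x≈0) y≉0
      ... | no  x≉0 | yes y≈0 = contradiction (trans x≈y y≈0) x≉0

      nonzero-* : ∀ {a} → a ≉ 0# → ∀ x → nonzero (a * x) ≈ scale a x * nonzero x
      nonzero-* {a} a≉0 x with x ≟ 0# | (a * x) ≟ 0#
      ... | yes _   | yes _    = sym (*-identityˡ 1#)
      ... | no  _   | no  _    = refl
      ... | yes x≈0 | no  ax≉0 = contradiction (trans (*-congˡ x≈0) (zeroʳ a)) ax≉0
      ... | no  x≉0 | yes ax≈0 = contradiction ax≈0 (x*y≉0 a≉0 x≉0)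

      scale-zero : ∀ a {x} → x ≈ 0# → scale a x ≈ 1#
      scale-zero a {x} x≈0 with x ≟ 0#
      ... | yes _   = refl
      ... | no  x≉0 = contradiction x≈0 x≉0

      scale-nonzero : ∀ a {x} → x ≉ 0# → scale a x ≈ a
      scale-nonzero a {x} x≉0 with x ≟ 0#
      ... | yes x≈0 = contradiction x≈0 x≉0
      ... | no  _   = refl

    -- Multiplication by x permutes the nonzero elements and hence preserves their product.
    x^n≈x : ∀ x → .{{ℕ.NonZero n}} → x ^ n ≈ x
    x^n≈x x with x ≟ 0#
    ... | yes x≈0 = trans (^-congˡ n x≈0) (trans (0^m≈0 n) (sym x≈0))
      where
      0^m≈0 : ∀ m → .{{ℕ.NonZero m}} → 0# ^ m ≈ 0#
      0^m≈0 (suc m) = zeroˡ _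
    ... | no x≉0 with inverse x≉0
    ...   | x⁻¹ , xx⁻¹≈1 = begin
      x ^ n       ≈⟨ ∏-constant-but-one (to 0#) (scale x ∘ from) (scale-zero x (strictlyInverseʳ 0#))
                       (λ j j≢ → scale-nonzero x λ eq → j≢ (≡.trans (≡.sym (strictlyInverseˡ j)) (to-cong eq))) ⟨
      x * ∏ (scale x ∘ from)
                  ≈⟨ *-congˡ scales≈1 ⟩
      x * 1#      ≈⟨ *-identityʳ x ⟩
      x           ∎
      where
      π : Permutation′ n
      π = permute (x *_) (x⁻¹ *_) *-congˡ *-congˡ
        (λ y → trans (sym (*-assoc _ _ _)) (trans (*-congʳ xx⁻¹≈1) (*-identityˡ y)))
        (λ y → trans (sym (*-assoc _ _ _)) (trans (*-congʳ (trans (*-comm _ _) xx⁻¹≈1)) (*-identityˡ y)))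
      scales≈1 : ∏ (scale x ∘ from) ≈ 1#
      scales≈1 = *-cancelˡ-≉ (∏≉0 (nonzero ∘ from) (nonzero≉0 ∘ from)) (begin
        ∏ (nonzero ∘ from) * ∏ (scale x ∘ from)     ≈⟨ *-comm _ _ ⟩
        ∏ (scale x ∘ from) * ∏ (nonzero ∘ from)     ≈⟨ ∑-distrib-+ (scale x ∘ from) (nonzero ∘ from) ⟨
        ∏ (λ i → scale x (from i) * nonzero (from i))
          ≈⟨ ∏-cong (λ i → trans (nonzero-cong (strictlyInverseʳ _)) (nonzero-* x≉0 (from i))) ⟨
        ∏ (nonzero ∘ from ∘ (π ⟨$⟩ʳ_))              ≈⟨ ∏-permute (nonzero ∘ from) π ⟨
        ∏ (nonzero ∘ from)                          ≈⟨ *-identityʳ _ ⟨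
        ∏ (nonzero ∘ from) * 1#                     ∎)

  p^k·1≈[p·1]^k : ∀ p k → (p ℕ.^ k) · 1# ≈ (p · 1#) ^ k
  p^k·1≈[p·1]^k p zero    = ×-homo-1 1#
  p^k·1≈[p·1]^k p (suc k) = trans (×1-homo-* p (p ℕ.^ k)) (*-congˡ (p^k·1≈[p·1]^k p k))

  module Characteristic (p k : ℕ) (n≡p^k : n ≡ p ℕ.^ k) where

    -- Its `k`-th power is `n · 1#`, which vanishes, and a field has no nonzero nilpotents.
    p·1≈0 : p · 1# ≈ 0#
    p·1≈0 with (p · 1#) ≟ 0#
    ... | yes p≈0 = p≈0
    ... | no  p≉0 = contradiction
      (trans (sym (p^k·1≈[p·1]^k p k)) (trans (reflexive (≡.cong (_· 1#) (≡.sym n≡p^k))) (n·x≈0 1#)))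
      (^≉0 p≉0 k)

    p∣m⇒m·x≈0 : ∀ {m} x → p ∣ m → m · x ≈ 0#
    p∣m⇒m·x≈0 x (divides d ≡.refl) = begin
      (d ℕ.* p) · x          ≈⟨ ×-congʳ (d ℕ.* p) (*-identityˡ x) ⟨
      (d ℕ.* p) · (1# * x)   ≈⟨ ×-assoc-* (d ℕ.* p) 1# x ⟨
      (d ℕ.* p) · 1# * x     ≈⟨ *-congʳ (×1-homo-* d p) ⟩
      d · 1# * p · 1# * x    ≈⟨ *-congʳ (*-congˡ p·1≈0) ⟩
      d · 1# * 0# * x        ≈⟨ *-congʳ (zeroʳ _) ⟩
      0# * x                 ≈⟨ zeroˡ x ⟩
      0#                     ∎

  module Frobenius {p : ℕ} (p-prime : Prime (suc p)) (k : ℕ) (n≡p^k : n ≡ suc p ℕ.^ k) where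
    open Characteristic (suc p) k n≡p^k
    open Sums +-commutativeMonoid using (sum; sum-cong-≋; sum-init-last; sum-replicate-zero)

    -- In the binomial theorem all coefficients but the two outer ones are divisible by the
    -- characteristic.
    [x+y]^p≈x^p+y^p : ∀ x y → (x + y) ^ suc p ≈ x ^ suc p + y ^ suc p
    [x+y]^p≈x^p+y^p x y = begin
      (x + y) ^ suc p                         ≈⟨ Binomial.theorem (suc p) x y ⟩
      term zero + sum (term ∘ suc)            ≈⟨ +-congˡ (sum-init-last (term ∘ suc)) ⟩
      term zero + (sum (λ j → term (suc (inject₁ j))) + term (suc (fromℕ p)))
        ≈⟨ +-cong first (+-cong (trans (sum-cong-≋ middle) (sum-replicate-zero p)) last) ⟩
      y ^ suc p + (0# + x ^ suc p)            ≈⟨ +-congˡ (+-identityˡ _) ⟩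
      y ^ suc p + x ^ suc p                   ≈⟨ +-comm _ _ ⟩
      x ^ suc p + y ^ suc p                   ∎
      where
      term = Binomial.binomialTerm x y (suc p)
      first : term zero ≈ y ^ suc p
      first = trans (×-homo-1 _) (*-identityˡ _)
      last : term (suc (fromℕ p)) ≈ x ^ suc p
      last rewrite Fin.toℕ-fromℕ p | nCn≡1 (suc p) | ℕ.n∸n≡0 p = trans (×-homo-1 _) (*-identityʳ _)
      middle : ∀ j → term (suc (inject₁ j)) ≈ 0#
      middle j rewrite Fin.toℕ-inject₁ j = p∣m⇒m·x≈0 _ (prime∣pCk p-prime (Fin.toℕ<n j))

    [x+y]^q≈x^q+y^q : ∀ h x y → (x + y) ^ (suc p ℕ.^ h) ≈ x ^ (suc p ℕ.^ h) + y ^ (suc p ℕ.^ h)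
    [x+y]^q≈x^q+y^q zero    x y = trans (*-identityʳ _) (sym (+-cong (*-identityʳ x) (*-identityʳ y)))
    [x+y]^q≈x^q+y^q (suc h) x y = begin
      (x + y) ^ (suc p ℕ.* r)                ≈⟨ ^-assocʳ (x + y) (suc p) r ⟨
      ((x + y) ^ suc p) ^ r                  ≈⟨ ^-congˡ r ([x+y]^p≈x^p+y^p x y) ⟩
      (x ^ suc p + y ^ suc p) ^ r            ≈⟨ [x+y]^q≈x^q+y^q h _ _ ⟩
      (x ^ suc p) ^ r + (y ^ suc p) ^ r      ≈⟨ +-cong (^-assocʳ x (suc p) r) (^-assocʳ y (suc p) r) ⟩
      x ^ (suc p ℕ.* r) + y ^ (suc p ℕ.* r)  ∎
      where r = suc p ℕ.^ h

  IsSquare : Carrier → Set _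
  IsSquare y = ∃[ x ] x * x ≈ y

  square? : ∀ y → Dec (IsSquare y)
  square? y = any? (λ x≈z → trans (*-cong (sym x≈z) (sym x≈z))) (λ x → (x * x) ≟ y)

  abstract
    x²≈y²⇒x≈±y : ∀ {x y} → x * x ≈ y * y → x ≈ y ⊎ x ≈ - y
    x²≈y²⇒x≈±y {x} {y} x²≈y²
      with x*y≈0⇒x≈0⊎y≈0 {x - y} {x + y} (by x²≈y²
             (solve 2 (λ x y → (x :- y) :* (x :+ y) :+ y :* y := :0 :+ x :* x) refl x y))
    ... | inj₁ x-y≈0 = inj₁ (x-y≈0⇒x≈y x-y≈0)
    ... | inj₂ x+y≈0 = inj₂ (by x+y≈0 (solve 2 (λ x y → x :+ :0 := :- y :+ (x :+ y)) refl x y))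

  -- Send one element of each pair ±x to x² and the other one to ν x²; as ν is not
  -- a square this is injective, hence surjective.
  abstract
    square-or-ν*square : ∀ {ν} → ¬ IsSquare ν → ∀ y → ∃[ x ] (x * x ≈ y ⊎ ν * (x * x) ≈ y)
    square-or-ν*square {ν} ν-nonsquare y =
      let x , fx≈y = injective⇒surjective f f-cong f-injective y in x , f-values x fx≈y
      where
      -- The position in the enumeration singles out one element of each pair ±x; 0 does not precede
      -- itself and is sent to its square.
      _≺_ : Carrier → Carrier → Set
      x ≺ y = to x Fin.< to y
      _≺?_ : ∀ x y → Dec (x ≺ y)
      x ≺? y = to x Fin.<? to y
      ≺-resp : ∀ {x y u v} → x ≈ u → y ≈ v → x ≺ y → u ≺ v
      ≺-resp x≈u y≈v = ≡.subst₂ Fin._<_ (to-cong x≈u) (to-cong y≈v)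
      x≈-y⇒-x≈y : ∀ {x y} → x ≈ - y → - x ≈ y
      x≈-y⇒-x≈y x≈-y = trans (-‿cong x≈-y) (-‿involutive _)

      f : Carrier → Carrier
      f x with x ≺? (- x)
      ... | yes _ = ν * (x * x)
      ... | no  _ = x * x

      ν≉0 : ν ≉ 0#
      ν≉0 ν≈0 = ν-nonsquare (0# , trans (zeroˡ 0#) (sym ν≈0))

      νx²≉z² : ∀ {x z} → x ≺ (- x) → ν * (x * x) ≉ z * z
      νx²≉z² {x} {z} x≺-x νx²≈z² with x ≟ 0#
      ... | yes x≈0 = Fin.<-irrefl (to-cong (trans x≈0 (sym (trans (-‿cong x≈0) -0#≈0#)))) x≺-x
      ... | no x≉0 with inverse x≉0
      ...   | x⁻¹ , xx⁻¹≈1 = ν-nonsquare (z * x⁻¹ ,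
        by (+-cong (*-congˡ { - (x⁻¹ * x⁻¹)} νx²≈z²) (*-congˡ {ν * (x * x⁻¹ + 1#)} xx⁻¹≈1))
          (solve 4 (λ z w x ν → (z :* w) :* (z :* w) :+ ((:- (w :* w)) :* (z :* z) :+ ν :* (x :* w :+ :1) :* :1)
                             := ν :+ ((:- (w :* w)) :* (ν :* (x :* x)) :+ ν :* (x :* w :+ :1) :* (x :* w)))
            refl z x⁻¹ x ν))

      f-cong : ∀ {x z} → x ≈ z → f x ≈ f z
      f-cong {x} {z} x≈z with x ≺? (- x) | z ≺? (- z)
      ... | yes _ | yes _ = *-congˡ (*-cong x≈z x≈z)
      ... | no  _ | no  _ = *-cong x≈z x≈z
      ... | yes p | no ¬p = contradiction (≺-resp x≈z (-‿cong x≈z) p) ¬p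
      ... | no ¬p | yes p = contradiction (≺-resp (sym x≈z) (-‿cong (sym x≈z)) p) ¬p

      f-injective : ∀ {x z} → f x ≈ f z → x ≈ z
      f-injective {x} {z} fx≈fz with x ≺? (- x) | z ≺? (- z)
      ... | yes p | no  _ = contradiction fx≈fz (νx²≉z² p)
      ... | no  _ | yes p = contradiction (sym fx≈fz) (νx²≉z² p)
      ... | yes p | yes r with x²≈y²⇒x≈±y (*-cancelˡ-≉ ν≉0 fx≈fz)
      ...   | inj₁ x≈z  = x≈z
      ...   | inj₂ x≈-z = contradiction (≺-resp x≈-z (x≈-y⇒-x≈y x≈-z) p) (Fin.<-asym r)
      f-injective {x} {z} fx≈fz | no ¬p | no ¬r with x²≈y²⇒x≈±y fx≈fz
      ...   | inj₁ x≈z  = x≈z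
      ...   | inj₂ x≈-z with Fin.<-cmp (to x) (to (- x))
      ...     | tri< p _ _ = contradiction p ¬p
      ...     | tri≈ _ e _ = trans (to-injective e) (x≈-y⇒-x≈y x≈-z)
      ...     | tri> _ _ p = contradiction (≺-resp (x≈-y⇒-x≈y x≈-z) x≈-z p) ¬r
      f-values : ∀ x → f x ≈ y → x * x ≈ y ⊎ ν * (x * x) ≈ y
      f-values x fx≈y with x ≺? (- x)
      ... | yes _ = inj₂ fx≈y
      ... | no  _ = inj₁ fx≈y

  -- Real and skew elements under an involution of the field.

  module Conjugation
    (conj : Carrier → Carrier)
    (conj-cong : ∀ {x y} → x ≈ y → conj x ≈ conj y)
    (conj-+ : ∀ x y → conj (x + y) ≈ conj x + conj y)
    (conj-* : ∀ x y → conj (x * y) ≈ conj x * conj y)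
    (conj-involutive : ∀ x → conj (conj x) ≈ x)
    (2≉0 : 2# ≉ 0#)
    where

    Real Skew : Carrier → Set ℓ₁
    Real x = conj x ≈ x
    Skew x = conj x ≈ - x

    conj-0 : Real 0#
    conj-0 = by ((- 1#) ⊛ (trans (conj-cong (sym (+-identityˡ 0#))) (conj-+ 0# 0#)))
      (solve 1 (λ conj0# →
             conj0# :+ (:- :1) :* (conj0# :+ conj0#)
          := :0 :+ (:- :1) :* conj0#)
          refl (conj 0#))

    conj-neg : ∀ x → conj (- x) ≈ - conj x
    conj-neg x = by (trans (sym (conj-+ x (- x))) (trans (conj-cong (-‿inverseʳ x)) conj-0))
      (solve 2 (λ conj-x conjx →
             conj-x :+ :0
          := (:- conjx) :+ (conjx :+ conj-x))
          refl (conj (- x)) (conj x))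

    conj-1 : Real 1#
    conj-1 = begin
      conj 1#                     ≈⟨ *-identityʳ _ ⟨
      conj 1# * 1#                ≈⟨ *-congˡ (conj-involutive 1#) ⟨
      conj 1# * conj (conj 1#)    ≈⟨ conj-* 1# (conj 1#) ⟨
      conj (1# * conj 1#)         ≈⟨ conj-cong (*-identityˡ _) ⟩
      conj (conj 1#)              ≈⟨ conj-involutive 1# ⟩
      1#                          ∎

    infixl 6 _c+_ _c-_
    infixl 7 _c*_

    -- These combinators compute the conjugate of an expression: the proof repeats the shape of the
    -- expression, with a known conjugate at each atom and `refl` where `conj` is to stay.
    _c+_ : ∀ {x y x′ y′} → conj x ≈ x′ → conj y ≈ y′ → conj (x + y) ≈ x′ + y′
    p c+ q = trans (conj-+ _ _) (+-cong p q)

    _c*_ : ∀ {x y x′ y′} → conj x ≈ x′ → conj y ≈ y′ → conj (x * y) ≈ x′ * y′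
    p c* q = trans (conj-* _ _) (*-cong p q)

    cneg : ∀ {x x′} → conj x ≈ x′ → conj (- x) ≈ - x′
    cneg p = trans (conj-neg _) (-‿cong p)

    _c-_ : ∀ {x y x′ y′} → conj x ≈ x′ → conj y ≈ y′ → conj (x - y) ≈ x′ - y′
    p c- q = p c+ cneg q

    x-conj[x]-skew : ∀ x → Skew (x - conj x)
    x-conj[x]-skew x = trans (refl c- conj-involutive x)
      (solve 2 (λ conjx x → conjx :- x := :- (x :- conjx)) refl (conj x) x)

    cancel-2 : ∀ {x y} → 2# * x ≈ 2# * y → x ≈ y
    cancel-2 = *-cancelˡ-≉ 2≉0

    inverse-unique : ∀ {x y z} → x * y ≈ 1# → x * z ≈ 1# → y ≈ z
    inverse-unique {x} {y} {z} xy≈1 xz≈1 = by (z ⊛ xy≈1 ⊞ (- y) ⊛ xz≈1)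
      (solve 3 (λ y z x →
             y :+ (z :* :1 :+ (:- y) :* :1)
          := z :+ (z :* (x :* y) :+ (:- y) :* (x :* z)))
          refl y z x)

    real-inverse : ∀ {x y} → x * y ≈ 1# → Real x → Real y
    real-inverse {x} {y} xy≈1 x-real = inverse-unique {x}
      (trans (sym (x-real c* refl)) (trans (conj-cong xy≈1) conj-1)) xy≈1

    skew-inverse : ∀ {x y} → x * y ≈ 1# → Skew x → Skew y
    skew-inverse {x} {y} xy≈1 x-skew = inverse-unique { - x}
      (trans (sym (x-skew c* refl)) (trans (conj-cong xy≈1) conj-1))
      (by xy≈1 (solve 2 (λ x y → (:- x) :* (:- y) :+ :1 := :1 :+ x :* y) refl x y))

    module _ {ε} (ε≉0 : ε ≉ 0#) (ε-skew : Skew ε) where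

      real∧skew⇒0 : ∀ {x} → Real x → Skew x → x ≈ 0#
      real∧skew⇒0 {x} x-real x-skew = x*y≈0⇒y≈0 2≉0
        (by ((- 1#) ⊛ x-real ⊞ x-skew)
          (solve 2 (λ x conjx →
                 :2 :* x :+ ((:- :1) :* x :+ (:- x))
              := :0 :+ ((:- :1) :* conjx :+ conjx))
              refl x (conj x)))

      abstract
        1+ε≉0 : 1# + ε ≉ 0#
        1+ε≉0 1+ε≈0 = 2≉0 (by (1+ε≈0 ⊞ (trans (sym (conj-1 c+ ε-skew)) (trans (conj-cong 1+ε≈0) conj-0)))
          (solve 1 (λ ε → :1 :+ :1 :+ (:0 :+ :0) := :0 :+ (:1 :+ ε :+ (:1 :- ε))) refl ε))

        1-ε≉0 : 1# - ε ≉ 0#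
        1-ε≉0 1-ε≈0 = 2≉0 (by (1-ε≈0 ⊞ (trans (sym (conj-1 c- ε-skew)) (trans (conj-cong 1-ε≈0) conj-0)))
          (solve 1 (λ ε → :1 :+ :1 :+ (:0 :+ :0) := :0 :+ (:1 :- ε :+ (:1 :- (:- ε)))) refl ε))

      -- The second differences at 0 with steps 1 and ε are 2 (P + β) and 2 ε² (P - β), both real.
      -- As ε² is real, ε² times the former minus the latter shows that 4 ε² β is real.
      quadratic-real : ∀ P B C β → (∀ x → Real (P * (x * x) + B * x + C + β * (x * conj x))) → Real β
      quadratic-real P B C β H = x-y≈0⇒x≈y (x*y≈0⇒y≈0 (x*y≉0 (x*y≉0 2≉0 2≉0) (x*y≉0 ε≉0 ε≉0))
        (by ((ε * ε) ⊛ (at conj-1)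
            ⊞ (ε * ε) ⊛ (at (cneg conj-1))
            ⊞ ((- (2# * (ε * ε))) + 2#) ⊛ (at conj-0)
            ⊞ (- 1#) ⊛ (at ε-skew)
            ⊞ (- 1#) ⊛ (at (cneg ε-skew)))
          (solve 9 (λ ε conjβ β P B C conjP conjB conjC →
                 :2 :* :2 :* (ε :* ε) :* (conjβ :- β) :+ (ε :* ε :* (P :* (:1
                   :* :1) :+ B :* :1 :+ C :+ β :* (:1 :* :1)) :+ ε :* ε :* (P :* ((:- :1)
                   :* (:- :1)) :+ B :* (:- :1) :+ C :+ β :* ((:- :1) :* (:- :1)))
                   :+ ((:- (:2 :* (ε :* ε))) :+ :2) :* (P :* (:0 :* :0) :+ B :* :0
                   :+ C :+ β :* (:0 :* :0)) :+ (:- :1) :* (P :* (ε :* ε) :+ B :* ε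
                   :+ C :+ β :* (ε :* (:- ε))) :+ (:- :1) :* (P :* ((:- ε) :* (:- ε))
                   :+ B :* (:- ε) :+ C :+ β :* ((:- ε) :* (:- (:- ε)))))
              := :0 :+ (ε :* ε :* (conjP :* (:1 :* :1) :+ conjB :* :1 :+ conjC
                   :+ conjβ :* (:1 :* :1)) :+ ε :* ε :* (conjP :* ((:- :1) :* (:- :1))
                   :+ conjB :* (:- :1) :+ conjC :+ conjβ :* ((:- :1) :* (:- :1)))
                   :+ ((:- (:2 :* (ε :* ε))) :+ :2) :* (conjP :* (:0 :* :0) :+ conjB
                   :* :0 :+ conjC :+ conjβ :* (:0 :* :0)) :+ (:- :1) :* (conjP
                   :* ((:- ε) :* (:- ε)) :+ conjB :* (:- ε) :+ conjC :+ conjβ :* ((:- ε)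
                   :* ε)) :+ (:- :1) :* (conjP :* ((:- (:- ε)) :* (:- (:- ε)))
                   :+ conjB :* (:- (:- ε)) :+ conjC :+ conjβ :* ((:- (:- ε)) :* (:- ε)))))
              refl ε (conj β) β P B C (conj P) (conj B) (conj C))))
        where
        -- The hypothesis at `x` with both sides expanded and the known conjugate `s` of `x`
        -- inserted.
        at : ∀ {x s} → conj x ≈ s →
             conj P * (s * s) + conj B * s + conj C + conj β * (s * x) ≈ P * (x * x) + B * x + C + β * (x * s)
        at {x} {s} p = begin
          conj P * (s * s) + conj B * s + conj C + conj β * (s * x)
            ≈⟨ (refl c* (p c* p)) c+ (refl c* p) c+ refl c+ (refl c* (p c* conj-involutive x)) ⟨
          conj (P * (x * x) + B * x + C + β * (x * conj x))   ≈⟨ H x ⟩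
          P * (x * x) + B * x + C + β * (x * conj x)          ≈⟨ +-congˡ (*-congˡ (*-congˡ p)) ⟩
          P * (x * x) + B * x + C + β * (x * s)               ∎

      -- The instances t = 1, ε, 1 + ε, 1 - ε determine A and c.
      linear-laurent-real : ∀ A c → (∀ t t′ → t * t′ ≈ 1# → Real (A * t + c * t′)) → c ≈ 0#
      linear-laurent-real A c H with inverse ε≉0 | inverse (x*y≉0 1+ε≉0 1-ε≉0)
      ... | ε′ , εε′≈1 | m , nm≈1 = x*y≈0⇒y≈0 2≉0
        (by (T≈0 ⊞ (- 1#) ⊛ e₁ ⊞ (- 1#) ⊛ U≈0)
          (solve 4 (λ c A conjc conjA →
                 :2 :* c :+ (:0 :+ (:- :1) :* (A :* :1 :+ c :* :1) :+ (:- :1)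
                   :* :0)
              := :0 :+ (c :+ conjc :+ (:- :1) :* (conjA :* :1 :+ conjc :* :1)
                   :+ (:- :1) :* (A :- conjA)))
              refl c A (conj c) (conj A)))
        where
        m-real : Real m
        m-real = real-inverse nm≈1 (trans ((conj-1 c+ ε-skew) c* (conj-1 c- ε-skew))
          (solve 1 (λ ε → (:1 :- ε) :* (:1 :- (:- ε)) := (:1 :+ ε) :* (:1 :- ε)) refl ε))
        at : ∀ {t t′ s s′} → t * t′ ≈ 1# → conj t ≈ s → conj t′ ≈ s′ →
             conj A * s + conj c * s′ ≈ A * t + c * t′
        at tt′≈1 p p′ = trans (sym ((refl c* p) c+ (refl c* p′))) (H _ _ tt′≈1)
        e₁ = at (*-identityˡ 1#) conj-1 conj-1
        e₂ = at εε′≈1 ε-skew (skew-inverse εε′≈1 ε-skew)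
        e₃ = at {1# + ε} {(1# - ε) * m}
          (trans (sym (*-assoc _ _ _)) nm≈1) (conj-1 c+ ε-skew) ((conj-1 c- ε-skew) c* m-real)
        e₄ = at {1# - ε} {(1# + ε) * m}
          (trans (trans (sym (*-assoc _ _ _)) (*-congʳ (*-comm _ _))) nm≈1)
          (conj-1 c- ε-skew) ((conj-1 c+ ε-skew) c* m-real)
        -- The difference of `e₃` and `e₄` gives A + conj A = m (c + conj c), while `e₂` gives c +
        -- conj c = - ε² (A + conj A). Since m (1 - ε²) = 1, these are compatible only if both sums
        -- vanish.
        S≈0 : A + conj A ≈ 0#
        S≈0 = x*y≈0⇒y≈0 (x*y≉0 2≉0 ε≉0)
          (by ((- ((1# + ε) * (1# - ε))) ⊛ e₃
              ⊞ ((1# + ε) * (1# - ε)) ⊛ e₄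
              ⊞ (- (2# * ε * ε)) ⊛ e₂
              ⊞ (2# * ε * (c + (conj c))) ⊛ nm≈1
              ⊞ (- (2# * ε * (c + (conj c)))) ⊛ εε′≈1)
            (solve 7 (λ ε A conjA c m ε′ conjc →
                   :2 :* ε :* (A :+ conjA) :+ ((:- ((:1 :+ ε) :* (:1 :- ε)))
                     :* (A :* (:1 :+ ε) :+ c :* ((:1 :- ε) :* m)) :+ (:1 :+ ε)
                     :* (:1 :- ε) :* (A :* (:1 :- ε) :+ c :* ((:1 :+ ε) :* m))
                     :+ (:- (:2 :* ε :* ε)) :* (A :* ε :+ c :* ε′) :+ :2 :* ε :* (c
                     :+ conjc) :* :1 :+ (:- (:2 :* ε :* (c :+ conjc))) :* :1)
                := :0 :+ ((:- ((:1 :+ ε) :* (:1 :- ε))) :* (conjA :* (:1 :- ε)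
                     :+ conjc :* ((:1 :- (:- ε)) :* m)) :+ (:1 :+ ε) :* (:1 :- ε)
                     :* (conjA :* (:1 :- (:- ε)) :+ conjc :* ((:1 :- ε) :* m))
                     :+ (:- (:2 :* ε :* ε)) :* (conjA :* (:- ε) :+ conjc :* (:- ε′))
                     :+ :2 :* ε :* (c :+ conjc) :* ((:1 :+ ε) :* (:1 :- ε) :* m)
                     :+ (:- (:2 :* ε :* (c :+ conjc))) :* (ε :* ε′)))
                refl ε A (conj A) c m ε′ (conj c)))
        T≈0 : c + conj c ≈ 0#
        T≈0 = by ((- ε) ⊛ e₂ ⊞ (- (ε * ε)) ⊛ S≈0 ⊞ (- (c + (conj c))) ⊛ εε′≈1)
          (solve 6 (λ c conjc ε A ε′ conjA →
                 c :+ conjc :+ ((:- ε) :* (A :* ε :+ c :* ε′) :+ (:- (ε :* ε))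
                   :* :0 :+ (:- (c :+ conjc)) :* :1)
              := :0 :+ ((:- ε) :* (conjA :* (:- ε) :+ conjc :* (:- ε′)) :+ (:- (ε
                   :* ε)) :* (A :+ conjA) :+ (:- (c :+ conjc)) :* (ε :* ε′)))
              refl c (conj c) ε A ε′ (conj A))
        -- The sum of `e₃` and `e₄` gives A - conj A = - m (c - conj c), and `e₁` gives the same
        -- without the factor m, which differs from 1.
        U≈0 : A - conj A ≈ 0#
        U≈0 = x*y≈0⇒y≈0 (x*y≉0 2≉0 (x*y≉0 ε≉0 ε≉0))
          (by (((1# + ε) * (1# - ε)) ⊛ e₃
              ⊞ ((1# + ε) * (1# - ε)) ⊛ e₄
              ⊞ (- (2# * ((conj c) - c))) ⊛ nm≈1
              ⊞ (- 2#) ⊛ e₁)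
            (solve 6 (λ ε A conjA c m conjc →
                   :2 :* (ε :* ε) :* (A :- conjA) :+ ((:1 :+ ε) :* (:1 :- ε)
                     :* (A :* (:1 :+ ε) :+ c :* ((:1 :- ε) :* m)) :+ (:1 :+ ε)
                     :* (:1 :- ε) :* (A :* (:1 :- ε) :+ c :* ((:1 :+ ε) :* m))
                     :+ (:- (:2 :* (conjc :- c))) :* :1 :+ (:- :2) :* (A :* :1
                     :+ c :* :1))
                := :0 :+ ((:1 :+ ε) :* (:1 :- ε) :* (conjA :* (:1 :- ε) :+ conjc
                     :* ((:1 :- (:- ε)) :* m)) :+ (:1 :+ ε) :* (:1 :- ε) :* (conjA
                     :* (:1 :- (:- ε)) :+ conjc :* ((:1 :- ε) :* m)) :+ (:- (:2
                     :* (conjc :- c))) :* ((:1 :+ ε) :* (:1 :- ε) :* m) :+ (:- :2)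
                     :* (conjA :* :1 :+ conjc :* :1)))
                refl ε A (conj A) c m (conj c)))

      -- Comparing t with - t leaves the odd part B t + S conj t + c / t. Subtracting the real
      -- number conj S t + S conj t removes the conjugate of t and leaves the case of
      -- `linear-laurent-real`.
      laurent-real : ∀ P B S E c β →
        (∀ t t′ → t * t′ ≈ 1# → Real (P * (t * t) + B * t + S * conj t + E + c * t′ + β * (t * conj t))) → c ≈ 0#
      laurent-real P B S E c β H = linear-laurent-real (B - conj S) c odd-part
        where
        at : ∀ {t t′ s s′} → t * t′ ≈ 1# → conj t ≈ s → conj t′ ≈ s′ →
             conj P * (s * s) + conj B * s + conj S * t + conj E + conj c * s′ + conj β * (s * t)
             ≈ P * (t * t) + B * t + S * s + E + c * t′ + β * (t * s)
        at {t} {t′} {s} {s′} tt′≈1 p p′ = begin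
          conj P * (s * s) + conj B * s + conj S * t + conj E + conj c * s′ + conj β * (s * t)
            ≈⟨ (refl c* (p c* p)) c+ (refl c* p) c+ (refl c* conj-involutive t) c+ refl c+ (refl c* p′)
                 c+ (refl c* (p c* conj-involutive t)) ⟨
          conj (P * (t * t) + B * t + S * conj t + E + c * t′ + β * (t * conj t))   ≈⟨ H t t′ tt′≈1 ⟩
          P * (t * t) + B * t + S * conj t + E + c * t′ + β * (t * conj t)
            ≈⟨ +-cong (+-congʳ (+-congʳ (+-congˡ (*-congˡ p)))) (*-congˡ (*-congˡ p)) ⟩
          P * (t * t) + B * t + S * s + E + c * t′ + β * (t * s)   ∎
        odd-part : ∀ t t′ → t * t′ ≈ 1# → Real ((B - conj S) * t + c * t′)
        odd-part t t′ tt′≈1 = trans (((refl c- conj-involutive S) c* refl) c+ (refl c* refl)) (cancel-2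
          (by ((at tt′≈1 refl refl) ⊞ (- 1#) ⊛ (at neg (conj-neg t) (conj-neg t′)))
            (solve 16 (λ conjB S conjt conjc conjt′ P t B E c t′ β conjS conjP conjE conjβ →
                   :2 :* ((conjB :- S) :* conjt :+ conjc :* conjt′) :+ (P :* (t
                     :* t) :+ B :* t :+ S :* conjt :+ E :+ c :* t′ :+ β :* (t :* conjt)
                     :+ (:- :1) :* (P :* ((:- t) :* (:- t)) :+ B :* (:- t) :+ S
                     :* (:- conjt) :+ E :+ c :* (:- t′) :+ β :* ((:- t) :* (:- conjt))))
                := :2 :* ((B :- conjS) :* t :+ c :* t′) :+ (conjP :* (conjt :* conjt)
                     :+ conjB :* conjt :+ conjS :* t :+ conjE :+ conjc :* conjt′
                     :+ conjβ :* (conjt :* t) :+ (:- :1) :* (conjP :* ((:- conjt)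
                     :* (:- conjt)) :+ conjB :* (:- conjt) :+ conjS :* (:- t) :+ conjE
                     :+ conjc :* (:- conjt′) :+ conjβ :* ((:- conjt) :* (:- t)))))
                refl (conj B) S (conj t) (conj c) (conj t′) P t B E c t′ β (conj S) (conj P) (conj E) (conj β))))
          where
          neg : (- t) * (- t′) ≈ 1#
          neg = by tt′≈1 (solve 2 (λ t t′ → (:- t) :* (:- t′) :+ :1 := :1 :+ t :* t′) refl t t′)

    real-resp : ∀ {x y} → x ≈ y → Real x → Real y
    real-resp x≈y x-real = trans (conj-cong (sym x≈y)) (trans x-real x≈y)

    real-neg⁻¹ : ∀ {x} → Real (- x) → Real x
    real-neg⁻¹ {x} -x-real = by ((- 1#) ⊛ (trans (sym (conj-neg x)) -x-real))
      (solve 2 (λ conjx x →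
             conjx :+ (:- :1) :* (:- x)
          := x :+ (:- :1) :* (:- conjx))
          refl (conj x) x)

    real-half : ∀ {x} → Real (2# * x) → Real x
    real-half 2x-real = cancel-2 (trans (sym ((conj-1 c+ conj-1) c* refl)) 2x-real)

    module _ {ε} (ε≉0 : ε ≉ 0#) (ε-skew : Skew ε) where

      -- If -1 is not a square, every element is ± a square, so that every norm
      -- is a square; but the norm of ε is - ε².
      -1-square : IsSquare (- 1#)
      -1-square with square? (- 1#)
      ... | yes -1-sq = -1-sq
      ... | no  -1-nonsq with square-or-ν*square -1-nonsq ε | inverse ε≉0
      ...   | u , ±u²≈ε | ε′ , εε′≈1 = contradiction
        (u * conj u * ε′ ,
          (by ((ε′ * ε′) ⊛ (norm ±u²≈ε) ⊞ ((- (ε * ε′)) - 1#) ⊛ εε′≈1)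
            (solve 4 (λ u conju ε′ ε →
                   u :* conju :* ε′ :* (u :* conju :* ε′) :+ (ε′ :* ε′ :* (ε
                     :* (:- ε)) :+ ((:- (ε :* ε′)) :- :1) :* :1)
                := (:- :1) :+ (ε′ :* ε′ :* (u :* conju :* (u :* conju)) :+ ((:- (ε
                     :* ε′)) :- :1) :* (ε :* ε′)))
                refl u (conj u) ε′ ε)))
        -1-nonsq
        where
        norm : u * u ≈ ε ⊎ - 1# * (u * u) ≈ ε → u * conj u * (u * conj u) ≈ ε * - ε
        norm (inj₁ e) = trans (solve 2 (λ u conju →
               u :* conju :* (u :* conju)
            := u :* u :* (conju :* conju))
            refl u (conj u))
          (*-cong e (trans (sym (refl c* refl)) (trans (conj-cong e) ε-skew)))
        norm (inj₂ e) = trans (solve 2 (λ u conju →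
               u :* conju :* (u :* conju)
            := (:- :1) :* (u :* u) :* ((:- :1) :* (conju :* conju)))
            refl u (conj u))
          (*-cong e (trans (sym (cneg conj-1 c* (refl c* refl))) (trans (conj-cong e) ε-skew)))

      -- Completing the square in y turns a conic with y² coefficient `b` into s² = D x² + 2 M x +
      -- L, where 2 s / b is the difference of the two ordinates over x. It is refuted that every
      -- such s lies in b 𝔽_q.
      module NoRealRoots {b b′} (bb′≈1 : b * b′ ≈ 1#) (D M L : Carrier)
        (disc≉0 : M * M - D * L ≉ 0#)
        (H : ∀ x s → s * s ≈ D * (x * x) + 2# * M * x + L → Real (s * b′)) where

        κ : Carrier
        κ = M * M - D * L

        -- For D = 0 the equation can be solved for x whatever s is; s = b ε has the nonreal
        -- quotient ε.
        linear : D ≈ 0# → ⊥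
        linear D≈0 with inverse (x*y≉0 2≉0 M≉0)
          where
          abstract
            M≉0 : M ≉ 0#
            M≉0 M≈0 = disc≉0 (by (M ⊛ M≈0 ⊞ (- L) ⊛ D≈0)
              (solve 3 (λ M D L →
                     M :* M :- D :* L :+ (M :* :0 :+ (:- L) :* :0)
                  := :0 :+ (M :* M :+ (:- L) :* D))
                  refl M D L))
        ... | m , 2Mm≈1 = ε≉0 (real∧skew⇒0 ε≉0 ε-skew
          (real-resp (by (ε ⊛ bb′≈1)
            (solve 3 (λ b ε b′ → b :* ε :* b′ :+ ε :* :1 := ε :+ ε :* (b :* b′)) refl b ε b′))
            (H x s (by ((- (x * x)) ⊛ D≈0 ⊞ (- 1#) ⊛ 2Mx≈s²-L)
              (solve 5 (λ s x L D M →
                     s :* s :+ ((:- (x :* x)) :* :0 :+ (:- :1) :* (s :* s :- L))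
                  := D :* (x :* x) :+ :2 :* M :* x :+ L :+ ((:- (x :* x)) :* D
                       :+ (:- :1) :* (:2 :* M :* x)))
                  refl s x L D M))))
          ε-skew)
          where
          s = b * ε
          x = (s * s - L) * m
          2Mx≈s²-L : 2# * M * x ≈ s * s - L
          2Mx≈s²-L = by ((s * s - L) ⊛ 2Mm≈1)
            (solve 4 (λ M s L m →
                   :2 :* M :* ((s :* s :- L) :* m) :+ (s :* s :- L) :* :1
                := s :* s :- L :+ (s :* s :- L) :* (:2 :* M :* m))
                refl M s L m)

        module _ (D≉0 : D ≉ 0#) where

          -- Multiplying the equation by D and completing the square, with X = D x + M.
          H′ : ∀ X s → D * (s * s) ≈ X * X - κ → Real (s * b′)
          H′ X s e with inverse D≉0
          ... | D′ , DD′≈1 = H x s (*-cancelˡ-≉ D≉0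
            (by (e ⊞ (- (X + D * x + M)) ⊛ Dx≈X-M)
              (solve 6 (λ D s X M L x →
                     D :* (s :* s) :+ (X :* X :- (M :* M :- D :* L) :+ (:- (X
                       :+ D :* x :+ M)) :* (X :- M))
                  := D :* (D :* (x :* x) :+ :2 :* M :* x :+ L) :+ (D :* (s :* s)
                       :+ (:- (X :+ D :* x :+ M)) :* (D :* x)))
                  refl D s X M L x)))
            where
            x = (X - M) * D′
            Dx≈X-M : D * x ≈ X - M
            Dx≈X-M = by ((X - M) ⊛ DD′≈1)
              (solve 4 (λ D X M D′ →
                     D :* ((X :- M) :* D′) :+ (X :- M) :* :1
                  := X :- M :+ (X :- M) :* (D :* D′))
                  refl D X M D′)

          -- Now (X - k s) (X + k s) = κ. Taking X - k s = t gives s = (κ / t - t) / (2 k), and the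
          -- coefficient of 1 / t cannot vanish.
          square : ¬ IsSquare D
          square (k , kk≈D) with inverse (x*y≉0 2≉0 k≉0) | inverse 2≉0
            where
            k≉0 : k ≉ 0#
            k≉0 k≈0 = D≉0 (trans (sym kk≈D) (trans (*-congʳ k≈0) (zeroˡ k)))
          ... | k₂ , 2kk₂≈1 | w , 2w≈1 = x*y≉0 disc≉0 (x*y≉0 (x*y≈1⇒y≉0 2kk₂≈1) (x*y≈1⇒y≉0 bb′≈1))
            (linear-laurent-real ε≉0 ε-skew (- (k₂ * b′)) (κ * (k₂ * b′)) λ t t′ tt′≈1 →
              real-resp (solve 5 (λ κ t′ t k₂ b′ →
                     (κ :* t′ :- t) :* k₂ :* b′
                  := (:- (k₂ :* b′)) :* t :+ κ :* (k₂ :* b′) :* t′)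
                  refl κ t′ t k₂ b′)
                (H′ ((κ * t′ + t) * w) ((κ * t′ - t) * k₂)
                  (on-hyperbola tt′≈1
                    (by ((κ * t′ - t) ⊛ 2kk₂≈1)
                      (solve 5 (λ k κ t′ t k₂ →
                             :2 :* k :* ((κ :* t′ :- t) :* k₂) :+ (κ :* t′ :- t)
                               :* :1
                          := κ :* t′ :- t :+ (κ :* t′ :- t) :* (:2 :* k :* k₂))
                          refl k κ t′ t k₂))
                    (by ((κ * t′ + t) ⊛ 2w≈1)
                      (solve 4 (λ κ t′ t w →
                             :2 :* ((κ :* t′ :+ t) :* w) :+ (κ :* t′ :+ t) :* :1
                          := κ :* t′ :+ t :+ (κ :* t′ :+ t) :* (:2 :* w))
                          refl κ t′ t w)))))
            where
            on-hyperbola : ∀ {t t′ s X} → t * t′ ≈ 1# → 2# * k * s ≈ κ * t′ - t → 2# * X ≈ κ * t′ + t →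
                           D * (s * s) ≈ X * X - κ
            on-hyperbola {t} {t′} {s} {X} tt′≈1 hs hX = *-cancelˡ-≉ (x*y≉0 2≉0 2≉0)
              (by ((- (2# * 2# * (s * s))) ⊛ kk≈D
                  ⊞ (2# * k * s + κ * t′ - t) ⊛ hs
                  ⊞ (- (2# * X + κ * t′ + t)) ⊛ hX
                  ⊞ (- (2# * 2# * κ)) ⊛ tt′≈1)
                (solve 7 (λ D s k κ t′ t X →
                       :2 :* :2 :* (D :* (s :* s)) :+ ((:- (:2 :* :2 :* (s :* s)))
                         :* D :+ (:2 :* k :* s :+ κ :* t′ :- t) :* (κ :* t′ :- t)
                         :+ (:- (:2 :* X :+ κ :* t′ :+ t)) :* (κ :* t′ :+ t) :+ (:- (:2
                         :* :2 :* κ)) :* :1)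
                    := :2 :* :2 :* (X :* X :- κ) :+ ((:- (:2 :* :2 :* (s :* s)))
                         :* (k :* k) :+ (:2 :* k :* s :+ κ :* t′ :- t) :* (:2 :* k
                         :* s) :+ (:- (:2 :* X :+ κ :* t′ :+ t)) :* (:2 :* X) :+ (:- (:2
                         :* :2 :* κ)) :* (t :* t′)))
                    refl D s k κ t′ t X))

          module _ (D-nonsquare : ¬ IsSquare D) where

            -- The chord X = X₀ + t s through the point (X₀ , 0) meets the curve again at s = 2 X₀ /
            -- (D / t - t). The denominator is nonzero because D is not a square, and the inverse of
            -- s / b is real along with s / b; it is a Laurent polynomial in t.
            κ-nonsquare : ¬ IsSquare κ
            κ-nonsquare (X₀ , X₀²≈κ) with inverse (x*y≉0 2≉0 X₀≉0)
              where
              X₀≉0 : X₀ ≉ 0#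
              X₀≉0 X₀≈0 = disc≉0 (trans (sym X₀²≈κ) (trans (*-congʳ X₀≈0) (zeroˡ X₀)))
            ... | v , 2X₀v≈1 = x*y≉0 D≉0 (x*y≉0 v≉0 (x*y≈1⇒x≉0 bb′≈1))
              (linear-laurent-real ε≉0 ε-skew (- (v * b)) (D * (v * b)) λ t t′ tt′≈1 →
                real-resp (solve 5 (λ D t′ t v b →
                       (D :* t′ :- t) :* v :* b
                    := (:- (v :* b)) :* t :+ D :* (v :* b) :* t′)
                    refl D t′ t v b) (w-real tt′≈1))
              where
              v≉0 : v ≉ 0#
              v≉0 = x*y≈1⇒y≉0 2X₀v≈1
              w-real : ∀ {t t′} → t * t′ ≈ 1# → Real ((D * t′ - t) * v * b)
              w-real {t} {t′} tt′≈1 with inverse (x*y≉0 Dt′-t≉0 v≉0)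
                where
                abstract
                  Dt′-t≉0 : D * t′ - t ≉ 0#
                  Dt′-t≉0 e = D-nonsquare (t , (by ((- t) ⊛ e ⊞ D ⊛ tt′≈1)
                    (solve 3 (λ t D t′ →
                           t :* t :+ ((:- t) :* :0 :+ D :* :1)
                        := D :+ ((:- t) :* (D :* t′ :- t) :+ D :* (t :* t′)))
                        refl t D t′)))
              ... | s , ws≈1 = real-inverse
                (by ((b * b′) ⊛ ws≈1 ⊞ bb′≈1)
                  (solve 5 (λ s b′ w v b →
                         s :* b′ :* (w :* v :* b) :+ (b :* b′ :* :1 :+ :1)
                      := :1 :+ (b :* b′ :* (w :* v :* s) :+ b :* b′))
                      refl s b′ (D * t′ - t) v b))
                (H′ (X₀ + t * s) s
                  (by (s ⊛ slope ⊞ (- 1#) ⊛ X₀²≈κ)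
                    (solve 5 (λ D s X₀ t κ →
                           D :* (s :* s) :+ (s :* (:2 :* X₀ :* t) :+ (:- :1)
                             :* κ)
                        := (X₀ :+ t :* s) :* (X₀ :+ t :* s) :- κ :+ (s :* ((D
                             :- t :* t) :* s) :+ (:- :1) :* (X₀ :* X₀)))
                        refl D s X₀ t κ)))
                where
                ws≈2X₀ : (D * t′ - t) * s ≈ 2# * X₀
                ws≈2X₀ = by ((2# * X₀) ⊛ ws≈1 ⊞ (- ((D * t′ - t) * s)) ⊛ 2X₀v≈1)
                  (solve 4 (λ w s X₀ v →
                         w :* s :+ (:2 :* X₀ :* :1 :+ (:- (w :* s)) :* :1)
                      := :2 :* X₀ :+ (:2 :* X₀ :* (w :* v :* s) :+ (:- (w :* s))
                           :* (:2 :* X₀ :* v)))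
                      refl (D * t′ - t) s X₀ v)
                slope : (D - t * t) * s ≈ 2# * X₀ * t
                slope = by (t ⊛ ws≈2X₀ ⊞ (- (D * s)) ⊛ tt′≈1)
                  (solve 5 (λ D t s X₀ t′ →
                         (D :- t :* t) :* s :+ (t :* (:2 :* X₀) :+ (:- (D :* s))
                           :* :1)
                      := :2 :* X₀ :* t :+ (t :* ((D :* t′ :- t) :* s) :+ (:- (D
                           :* s)) :* (t :* t′)))
                      refl D t s X₀ t′)

            -- With i² = -1 the point X = 0, s = i t₀ lies on the curve. If r² - D u² = 1, then so
            -- does X = D s₀ u, s = s₀ r, whence r is real. This makes m² / D real for all m, which
            -- m = 1 and m = 1 + ε contradict.
            D*κ-nonsquare : ∀ t₀ → D * (t₀ * t₀) ≉ κ
            D*κ-nonsquare t₀ Dt₀²≈κ with -1-square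
            ... | i , ii≈-1 = x*y≉0 (x*y≉0 2≉0 2≉0) (x*y≉0 D≉0 ε≉0)
              (by ((- 1#) ⊛ (ratio (conj-1 c+ ε-skew))
                  ⊞ ((1# + ε) * (1# + ε)) ⊛ (ratio conj-1))
                (solve 3 (λ D ε conjD →
                       :2 :* :2 :* (D :* ε) :+ ((:- :1) :* (conjD :* ((:1 :+ ε)
                         :* (:1 :+ ε))) :+ (:1 :+ ε) :* (:1 :+ ε) :* (conjD :* (:1
                         :* :1)))
                    := :0 :+ ((:- :1) :* (D :* ((:1 :- ε) :* (:1 :- ε))) :+ (:1
                         :+ ε) :* (:1 :+ ε) :* (D :* (:1 :* :1))))
                    refl D ε (conj D)))
              where
              s₀ = i * t₀
              Ds₀²≈-κ : D * (s₀ * s₀) ≈ - κ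
              Ds₀²≈-κ = by ((D * (t₀ * t₀)) ⊛ ii≈-1 ⊞ (- 1#) ⊛ Dt₀²≈κ)
                (solve 4 (λ D i t₀ κ →
                       D :* (i :* t₀ :* (i :* t₀)) :+ (D :* (t₀ :* t₀) :* (:- :1)
                         :+ (:- :1) :* κ)
                    := (:- κ) :+ (D :* (t₀ :* t₀) :* (i :* i) :+ (:- :1) :* (D
                         :* (t₀ :* t₀))))
                    refl D i t₀ κ)
              s₀≉0 : s₀ ≉ 0#
              s₀≉0 s₀≈0 = disc≉0 (by (Ds₀²≈-κ ⊞ (- (D * s₀)) ⊛ s₀≈0)
                (solve 3 (λ κ D s₀ →
                       κ :+ ((:- κ) :+ (:- (D :* s₀)) :* :0)
                    := :0 :+ (D :* (s₀ :* s₀) :+ (:- (D :* s₀)) :* s₀))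
                    refl κ D s₀))
              s₀b′-real : Real (s₀ * b′)
              s₀b′-real = H′ 0# s₀ (by Ds₀²≈-κ
                (solve 3 (λ D s₀ κ →
                       D :* (s₀ :* s₀) :+ (:- κ)
                    := :0 :* :0 :- κ :+ D :* (s₀ :* s₀))
                    refl D s₀ κ))
              ratio : ∀ {m m̄} → conj m ≈ m̄ → D * (m̄ * m̄) ≈ conj D * (m * m)
              ratio {m} {m̄} m̄-def with inverse D-m²≉0
                where
                abstract
                  D-m²≉0 : D - m * m ≉ 0#
                  D-m²≉0 e = D-nonsquare (m , sym (x-y≈0⇒x≈y e))
              ... | e , [D-m²]e≈1 = cancel-2
                (by ((- (((conj D) + m̄ * m̄) * (D - m * m))) ⊛ conj-inverse
                    ⊞ ((D - m * m) * ((conj D) - m̄ * m̄)) ⊛ quotient-real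
                    ⊞ ((D + m * m) * ((conj D) - m̄ * m̄)) ⊛ [D-m²]e≈1)
                  (solve 6 (λ D m̄ conjD m e conje →
                         :2 :* (D :* (m̄ :* m̄)) :+ ((:- ((conjD :+ m̄ :* m̄)
                           :* (D :- m :* m))) :* :1 :+ (D :- m :* m) :* (conjD
                           :- m̄ :* m̄) :* ((D :+ m :* m) :* e) :+ (D :+ m :* m)
                           :* (conjD :- m̄ :* m̄) :* :1)
                      := :2 :* (conjD :* (m :* m)) :+ ((:- ((conjD :+ m̄ :* m̄)
                           :* (D :- m :* m))) :* ((conjD :- m̄ :* m̄) :* conje)
                           :+ (D :- m :* m) :* (conjD :- m̄ :* m̄) :* ((conjD :+ m̄
                           :* m̄) :* conje) :+ (D :+ m :* m) :* (conjD :- m̄ :* m̄)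
                           :* ((D :- m :* m) :* e)))
                      refl D m̄ (conj D) m e (conj e)))
                where
                conj-inverse : (conj D - m̄ * m̄) * conj e ≈ 1#
                conj-inverse = trans
                  (sym ((refl c- (m̄-def c* m̄-def)) c* refl))
                  (trans (conj-cong [D-m²]e≈1) conj-1)
                quotient-real : (conj D + m̄ * m̄) * conj e ≈ (D + m * m) * e
                quotient-real = *-cancelˡ-≉ (x*y≉0 s₀≉0 (x*y≈1⇒y≉0 bb′≈1))
                  (trans (sym (s₀b′-real c* ((refl c+ (m̄-def c* m̄-def)) c* refl)))
                  (real-resp (solve 3 (λ s₀ r b′ → s₀ :* r :* b′ := s₀ :* b′ :* r) refl s₀ r b′)
                    (H′ (D * s₀ * u) (s₀ * r)
                      (by ((D * s₀ * s₀) ⊛ r²-Du²≈1 ⊞ Ds₀²≈-κ)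
                        (solve 5 (λ D s₀ r κ u →
                               D :* (s₀ :* r :* (s₀ :* r)) :+ (D :* s₀ :* s₀
                                 :* :1 :+ (:- κ))
                            := D :* s₀ :* u :* (D :* s₀ :* u) :- κ :+ (D :* s₀
                                 :* s₀ :* (r :* r :- D :* (u :* u)) :+ D :* (s₀
                                 :* s₀)))
                            refl D s₀ r κ u)))))
                  where
                  -- The rational parametrisation of r² - D u² = 1, with `e` the inverse of D - m².
                  r = (D + m * m) * e
                  u = 2# * m * e
                  r²-Du²≈1 : r * r - D * (u * u) ≈ 1#
                  r²-Du²≈1 = by (((D - m * m) * e + 1#) ⊛ [D-m²]e≈1)
                    (solve 3 (λ D m e →
                           (D :+ m :* m) :* e :* ((D :+ m :* m) :* e) :- D :* (:2
                             :* m :* e :* (:2 :* m :* e)) :+ ((D :- m :* m) :* e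
                             :+ :1) :* :1
                        := :1 :+ ((D :- m :* m) :* e :+ :1) :* ((D :- m :* m)
                             :* e))
                        refl D m e)

        impossible : ⊥
        impossible with D ≟ 0#
        ... | yes D≈0 = linear D≈0
        ... | no  D≉0 with square? D
        ...   | yes D-square = square D≉0 D-square
        ...   | no  D-nonsquare with square-or-ν*square D-nonsquare κ
        ...     | t , inj₁ t²≈κ  = κ-nonsquare D≉0 D-nonsquare (t , t²≈κ)
        ...     | t , inj₂ Dt²≈κ = D*κ-nonsquare D≉0 D-nonsquare t Dt²≈κ

    -- Conics whose affine points lie in 𝒰 α β.

    module _ {ε} (ε≉0 : ε ≉ 0#) (ε-skew : Skew ε)
      (a b d f g h α β : Carrier)
      (det≉0 : a * (b * d - f * f) - h * (h * d - f * g) + g * (h * f - b * g) ≉ 0#)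
      (H : ∀ x y → x * (a * x + h * y + g) + y * (h * x + b * y + f) + (g * x + f * y + d) ≈ 0# →
           Real (y - α * (x * x) - β * (x * conj x)))
      where

      private
        -- Here the determinant reduces to - a f², so f ≠ 0 and y is a quadratic polynomial in x.
        parabola : b ≈ 0# → h ≈ 0# → Real β
        parabola b≈0 h≈0 with inverse (x*y≉0 2≉0 f≉0)
          where
          abstract
            f≉0 : f ≉ 0#
            f≉0 f≈0 = det≉0 (by ((a * d - g * g) ⊛ b≈0 ⊞ (g * f - h * d + f * g) ⊛ h≈0 ⊞ (- (a * f)) ⊛ f≈0)
              (solve 6 (λ a b d f h g →
                     a :* (b :* d :- f :* f) :- h :* (h :* d :- f :* g) :+ g
                       :* (h :* f :- b :* g) :+ ((a :* d :- g :* g) :* :0 :+ (g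
                       :* f :- h :* d :+ f :* g) :* :0 :+ (:- (a :* f)) :* :0)
                  := :0 :+ ((a :* d :- g :* g) :* b :+ (g :* f :- h :* d :+ f
                       :* g) :* h :+ (:- (a :* f)) :* f))
                  refl a b d f h g))
        ... | f′ , 2ff′≈1 = real-neg⁻¹ (quadratic-real ε≉0 ε-skew
          (- (a * f′) - α) (- (2# * g * f′)) (- (d * f′)) (- β)
          λ x → real-resp
            (solve 8 (λ a x g d f′ α β conjx →
                   (:- ((a :* (x :* x) :+ :2 :* g :* x :+ d) :* f′)) :- α :* (x
                     :* x) :- β :* (x :* conjx)
                := ((:- (a :* f′)) :- α) :* (x :* x) :+ (:- (:2 :* g :* f′))
                     :* x :+ (:- (d :* f′)) :+ (:- β) :* (x :* conjx))
                refl a x g d f′ α β (conj x))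
            (H x (y x) (on-conic x)))
          where
          y : Carrier → Carrier
          y x = - ((a * (x * x) + 2# * g * x + d) * f′)
          on-conic : ∀ x → x * (a * x + h * y x + g) + y x * (h * x + b * y x + f) + (g * x + f * y x + d) ≈ 0#
          on-conic x = by (((y x) * (y x)) ⊛ b≈0 ⊞ (2# * x * (y x)) ⊛ h≈0 ⊞ 2fy≈)
            (solve 8 (λ x a h yx g b f d →
                   x :* (a :* x :+ h :* yx :+ g) :+ yx :* (h :* x :+ b :* yx
                     :+ f) :+ (g :* x :+ f :* yx :+ d) :+ (yx :* yx :* :0 :+ :2
                     :* x :* yx :* :0 :+ (:- (a :* (x :* x) :+ :2 :* g :* x :+ d)))
                := :0 :+ (yx :* yx :* b :+ :2 :* x :* yx :* h :+ :2 :* f :* yx))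
                refl x a h (y x) g b f d)
            where
            2fy≈ : 2# * f * y x ≈ - (a * (x * x) + 2# * g * x + d)
            2fy≈ = by ((- (a * (x * x) + 2# * g * x + d)) ⊛ 2ff′≈1)
              (solve 6 (λ f a x g d f′ →
                     :2 :* f :* (:- ((a :* (x :* x) :+ :2 :* g :* x :+ d) :* f′))
                       :+ (:- (a :* (x :* x) :+ :2 :* g :* x :+ d)) :* :1
                  := (:- (a :* (x :* x) :+ :2 :* g :* x :+ d)) :+ (:- (a :* (x
                       :* x) :+ :2 :* g :* x :+ d)) :* (:2 :* f :* f′))
                  refl f a x g d f′)

        -- The conic is a hyperbola with asymptote x = x₀; the change of variable
        -- x = x₀ + t makes y a Laurent polynomial in t.
        hyperbola : b ≈ 0# → h ≉ 0# → ⊥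
        hyperbola b≈0 h≉0 with inverse (x*y≉0 2≉0 h≉0)
        ... | k , 2hk≈1 = det≉0
          (by ((a * d - g * g) ⊛ b≈0
              ⊞ (- (h * h)) ⊛ κ≈0
              ⊞ (- (a * (f - h * x₀) - 2# * g * h)) ⊛ hx₀+f≈0)
            (solve 7 (λ a b d f h g x₀ →
                   a :* (b :* d :- f :* f) :- h :* (h :* d :- f :* g) :+ g :* (h
                     :* f :- b :* g) :+ ((a :* d :- g :* g) :* :0 :+ (:- (h :* h))
                     :* :0 :+ (:- (a :* (f :- h :* x₀) :- :2 :* g :* h)) :* :0)
                := :0 :+ ((a :* d :- g :* g) :* b :+ (:- (h :* h)) :* (a :* x₀
                     :* x₀ :+ :2 :* g :* x₀ :+ d) :+ (:- (a :* (f :- h :* x₀) :- :2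
                     :* g :* h)) :* (h :* x₀ :+ f)))
                refl a b d f h g x₀))
          where
          x₀ = - (2# * f * k)
          -- The value of the conic's equation on the line x = x₀, where the terms in y cancel. It
          -- is the coefficient of the pole, and if it is 0 the line splits off and the conic
          -- degenerates.
          κ  = a * x₀ * x₀ + 2# * g * x₀ + d
          abstract
            hx₀+f≈0 : h * x₀ + f ≈ 0#
            hx₀+f≈0 = by ((- f) ⊛ 2hk≈1)
              (solve 3 (λ h f k →
                     h :* (:- (:2 :* f :* k)) :+ f :+ (:- f) :* :1
                  := :0 :+ (:- f) :* (:2 :* h :* k))
                  refl h f k)
          y : Carrier → Carrier → Carrier
          y t t′ = - (k * (a * t + (2# * a * x₀ + 2# * g) + κ * t′))
          2hy≈ : ∀ t t′ → 2# * h * y t t′ ≈ - (a * t + (2# * a * x₀ + 2# * g) + κ * t′)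
          2hy≈ t t′ = by ((- (a * t + (2# * a * x₀ + 2# * g) + κ * t′)) ⊛ 2hk≈1)
            (solve 8 (λ h k a t x₀ g κ t′ →
                   :2 :* h :* (:- (k :* (a :* t :+ (:2 :* a :* x₀ :+ :2 :* g)
                     :+ κ :* t′))) :+ (:- (a :* t :+ (:2 :* a :* x₀ :+ :2 :* g)
                     :+ κ :* t′)) :* :1
                := (:- (a :* t :+ (:2 :* a :* x₀ :+ :2 :* g) :+ κ :* t′)) :+ (:- (a
                     :* t :+ (:2 :* a :* x₀ :+ :2 :* g) :+ κ :* t′)) :* (:2 :* h
                     :* k))
                refl h k a t x₀ g κ t′)
          on-conic : ∀ {t t′ y} → t * t′ ≈ 1# → 2# * h * y ≈ - (a * t + (2# * a * x₀ + 2# * g) + κ * t′) →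
            (x₀ + t) * (a * (x₀ + t) + h * y + g) + y * (h * (x₀ + t) + b * y + f) + (g * (x₀ + t) + f * y + d) ≈ 0#
          on-conic {t} {t′} {y} tt′≈1 2hy≈ =
            by ((y * y) ⊛ b≈0
                ⊞ (2# * y) ⊛ hx₀+f≈0
                ⊞ t ⊛ 2hy≈
                ⊞ (- κ) ⊛ tt′≈1
                -- The solver treats κ as an atom; this `refl` supplies its definition.
                ⊞ (- 1#) ⊛ refl)
              (solve 11 (λ x₀ t a h y g b f d κ t′ →
                     (x₀ :+ t) :* (a :* (x₀ :+ t) :+ h :* y :+ g) :+ y :* (h
                       :* (x₀ :+ t) :+ b :* y :+ f) :+ (g :* (x₀ :+ t) :+ f :* y
                       :+ d) :+ (y :* y :* :0 :+ :2 :* y :* :0 :+ t :* (:- (a :* t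
                       :+ (:2 :* a :* x₀ :+ :2 :* g) :+ κ :* t′)) :+ (:- κ) :* :1
                       :+ (:- :1) :* (a :* x₀ :* x₀ :+ :2 :* g :* x₀ :+ d))
                  := :0 :+ (y :* y :* b :+ :2 :* y :* (h :* x₀ :+ f) :+ t :* (:2
                       :* h :* y) :+ (:- κ) :* (t :* t′) :+ (:- :1) :* κ))
                  refl x₀ t a h y g b f d κ t′)
          κ≈0 : κ ≈ 0#
          κ≈0 = x*y≈0⇒y≈0 (x*y≈1⇒y≉0 2hk≈1) (trans
            (solve 2 (λ k κ → k :* κ := :- (:- (k :* κ))) refl k κ)
            (trans (-‿cong (laurent-real ε≉0 ε-skew (- α) (- (k * a) - 2# * α * x₀ - β * conj x₀) (- (β * x₀))
              (- (k * (2# * a * x₀ + 2# * g)) - α * (x₀ * x₀) - β * (x₀ * conj x₀)) (- (k * κ)) (- β)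
              λ t t′ tt′≈1 → real-resp
                (trans (+-congˡ (-‿cong (*-congˡ (*-congˡ (conj-+ x₀ t)))))
                (solve 11 (λ k a t x₀ g κ t′ α β conjx₀ conjt →
                       (:- (k :* (a :* t :+ (:2 :* a :* x₀ :+ :2 :* g) :+ κ :* t′)))
                         :- α :* ((x₀ :+ t) :* (x₀ :+ t)) :- β :* ((x₀ :+ t) :* (conjx₀
                         :+ conjt))
                    := (:- α) :* (t :* t) :+ ((:- (k :* a)) :- :2 :* α :* x₀
                         :- β :* conjx₀) :* t :+ (:- (β :* x₀)) :* conjt :+ ((:- (k
                         :* (:2 :* a :* x₀ :+ :2 :* g))) :- α :* (x₀ :* x₀) :- β
                         :* (x₀ :* conjx₀)) :+ (:- (k :* κ)) :* t′ :+ (:- β) :* (t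
                         :* conjt))
                    refl k a t x₀ g κ t′ α β (conj x₀) (conj t)))
                (H (x₀ + t) (y t t′) (on-conic tt′≈1 (2hy≈ t t′)))))
              -0#≈0#))

        -- The equation is solved for y by a square root s of its discriminant in y. The quantity M²
        -- - D L of `NoRealRoots` is then - b times the determinant of the conic, hence nonzero.
        central : b ≉ 0# → ⊥
        central b≉0 with inverse b≉0
        ... | b′ , bb′≈1 = NoRealRoots.impossible ε≉0 ε-skew bb′≈1
          (h * h - a * b) (h * f - b * g) (f * f - b * d) disc≉0 roots-real
          where
          disc≉0 : (h * f - b * g) * (h * f - b * g) - (h * h - a * b) * (f * f - b * d) ≉ 0#
          disc≉0 e = det≉0 (x*y≈0⇒y≈0 b≉0
            (by ((- 1#) ⊛ e)
              (solve 6 (λ b a d f h g →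
                     b :* (a :* (b :* d :- f :* f) :- h :* (h :* d :- f :* g)
                       :+ g :* (h :* f :- b :* g)) :+ (:- :1) :* :0
                  := :0 :+ (:- :1) :* ((h :* f :- b :* g) :* (h :* f :- b :* g)
                       :- (h :* h :- a :* b) :* (f :* f :- b :* d)))
                  refl b a d f h g)))
          Δ : Carrier → Carrier
          Δ x = (h * h - a * b) * (x * x) + 2# * (h * f - b * g) * x + (f * f - b * d)
          point-real : ∀ {x s} → s * s ≈ Δ x → Real ((s - h * x - f) * b′ - α * (x * x) - β * (x * conj x))
          point-real {x} {s} s²≈Δ = H x y (x*y≈0⇒y≈0 b≉0
            (by ((b * y + h * x + f + s) ⊛ by≈ ⊞ s²≈Δ)
              (solve 9 (λ b x a h y g f d s →
                     b :* (x :* (a :* x :+ h :* y :+ g) :+ y :* (h :* x :+ b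
                       :* y :+ f) :+ (g :* x :+ f :* y :+ d)) :+ ((b :* y :+ h
                       :* x :+ f :+ s) :* (s :- h :* x :- f) :+ ((h :* h :- a :* b)
                       :* (x :* x) :+ :2 :* (h :* f :- b :* g) :* x :+ (f :* f
                       :- b :* d)))
                  := :0 :+ ((b :* y :+ h :* x :+ f :+ s) :* (b :* y) :+ s :* s))
                  refl b x a h y g f d s)))
            where
            y = (s - h * x - f) * b′
            by≈ : b * y ≈ s - h * x - f
            by≈ = by ((s - h * x - f) ⊛ bb′≈1)
              (solve 6 (λ b s h x f b′ →
                     b :* ((s :- h :* x :- f) :* b′) :+ (s :- h :* x :- f) :* :1
                  := s :- h :* x :- f :+ (s :- h :* x :- f) :* (b :* b′))
                  refl b s h x f b′)
          -- The two points of the conic with abscissa x have a real difference.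
          roots-real : ∀ x s → s * s ≈ Δ x → Real (s * b′)
          roots-real x s s²≈Δ = real-half (real-resp
            (solve 8 (λ s h x f b′ α β conjx →
                   (s :- h :* x :- f) :* b′ :- α :* (x :* x) :- β :* (x :* conjx)
                     :- (((:- s) :- h :* x :- f) :* b′ :- α :* (x :* x) :- β :* (x
                     :* conjx))
                := :2 :* (s :* b′))
                refl s h x f b′ α β (conj x))
            (point-real s²≈Δ c- point-real (trans (solve 1 (λ s → (:- s) :* (:- s) := s :* s) refl s) s²≈Δ)))

      -- b = 0 says that the conic passes through (0,1,0), and then h = 0 that ℓ∞ is its tangent
      -- there.
      conic⇒real : Real β
      conic⇒real with b ≟ 0# | h ≟ 0#
      ... | no b≉0  | _       = contradiction (central b≉0) λ ()
      ... | yes b≈0 | yes h≈0 = parabola b≈0 h≈0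
      ... | yes b≈0 | no h≉0  = contradiction (hyperbola b≈0 h≉0) λ ()

    -- Over 𝔽_q, u ↦ Im (α u²) is a binary quadratic form up to a fixed skew factor; the condition
    -- says that it has no nontrivial zero.
    Anisotropic : Carrier → Set _
    Anisotropic α = ∀ u → Real (α * (u * u)) → u ≈ 0#

    -- A real value of α u² would make 4 α conj α the square of 2 α u² / (u conj u).
    admissible⇒anisotropic : ∀ {α β} → Real β →
      ¬ (∃[ s ] Real s × s * s ≈ (conj β - β) * (conj β - β) + (1# + 1# + 1# + 1#) * (α * conj α)) →
      Anisotropic α
    admissible⇒anisotropic {α} {β} β-real nonsquare u k-real with u ≟ 0#
    ... | yes u≈0 = u≈0
    ... | no  u≉0 with inverse u≉0
    ...   | v , uv≈1 = contradiction (s , s-real , s²≈) nonsquare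
      where
      ū = conj u
      v̄ = conj v
      s = 2# * (α * (u * u)) * (v * v̄)
      s-real : Real s
      s-real = trans ((conj-1 c+ conj-1) c* k-real c* (refl c* conj-involutive v)) (*-congˡ (*-comm v̄ v))
      s²≈ : s * s ≈ (conj β - β) * (conj β - β) + (1# + 1# + 1# + 1#) * (α * conj α)
      s²≈ = by ((- ((conj β) - β)) ⊛ β-real
          ⊞ (- (2# * 2# * (α * (u * u)) * (v * v̄) * (v * v̄))) ⊛ (trans (sym (refl c* (refl c* refl))) k-real)
          ⊞ (2# * 2# * α * (conj α) * (u * v + 1#) * (ū * v̄) * (ū * v̄)) ⊛ uv≈1
          ⊞ (2# * 2# * α * (conj α) * (ū * v̄ + 1#)) ⊛ (trans (sym (refl c* refl)) (trans (conj-cong uv≈1) conj-1)))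
        (solve 8 (λ α u v v̄ conjβ β conjα ū →
               :2 :* (α :* (u :* u)) :* (v :* v̄) :* (:2 :* (α :* (u :* u)) :* (v
                 :* v̄)) :+ ((:- (conjβ :- β)) :* β :+ (:- (:2 :* :2 :* (α :* (u
                 :* u)) :* (v :* v̄) :* (v :* v̄))) :* (α :* (u :* u)) :+ :2 :* :2
                 :* α :* conjα :* (u :* v :+ :1) :* (ū :* v̄) :* (ū :* v̄) :* :1
                 :+ :2 :* :2 :* α :* conjα :* (ū :* v̄ :+ :1) :* :1)
            := (conjβ :- β) :* (conjβ :- β) :+ (:1 :+ :1 :+ :1 :+ :1) :* (α :* conjα)
                 :+ ((:- (conjβ :- β)) :* conjβ :+ (:- (:2 :* :2 :* (α :* (u :* u))
                 :* (v :* v̄) :* (v :* v̄))) :* (conjα :* (ū :* ū)) :+ :2 :* :2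
                 :* α :* conjα :* (u :* v :+ :1) :* (ū :* v̄) :* (ū :* v̄) :* (u
                 :* v) :+ :2 :* :2 :* α :* conjα :* (ū :* v̄ :+ :1) :* (ū :* v̄)))
            refl α u v v̄ (conj β) β (conj α) ū)

    module _ {α} (α-anisotropic : Anisotropic α) where

      α≉0 : α ≉ 0#
      α≉0 α≈0 = 1≉0 (α-anisotropic 1# (real-resp (sym (trans (*-congʳ α≈0) (zeroˡ _))) conj-0))

      private
        ε = α - conj α

        ε-skew : Skew ε
        ε-skew = x-conj[x]-skew α

        abstract
          ε≉0 : ε ≉ 0#
          ε≉0 e = 1≉0 (α-anisotropic 1# (real-resp
            (solve 1 (λ α → α := α :* (:1 :* :1)) refl α)
            (sym (x-y≈0⇒x≈y e))))

      -- For c ≉ 0 a real multiple u of ε / c makes c u - α u² real.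
      no-real-values⇒0 : ∀ c → (∀ u → Real (c * u - α * (u * u)) → u ≈ 0#) → c ≈ 0#
      no-real-values⇒0 c H with c ≟ 0#
      ... | yes c≈0 = c≈0
      ... | no  c≉0 with inverse c≉0
      ...   | c′ , cc′≈1 with inverse N≉0
        where
        v = ε * c′
        abstract
          N≉0 : α * (v * v) - conj (α * (v * v)) ≉ 0#
          N≉0 e = x*y≉0 ε≉0 (x*y≈1⇒y≉0 cc′≈1) (α-anisotropic v (sym (x-y≈0⇒x≈y e)))
      ...     | N′ , NN′≈1 = contradiction (H (l * v) real)
        (x*y≉0 (x*y≉0 (x*y≉0 2≉0 ε≉0) (x*y≈1⇒y≉0 NN′≈1)) (x*y≉0 ε≉0 (x*y≈1⇒y≉0 cc′≈1)))
        where
        v = ε * c′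
        k = α * (v * v)
        -- As c v = ε, the imaginary part of c u - α u² at u = l v with l real is l (2 ε - l Im k);
        -- this l annihilates it.
        l = 2# * ε * N′
        l-real : Real l
        l-real = trans ((conj-1 c+ conj-1) c* ε-skew c* skew-inverse NN′≈1 (x-conj[x]-skew k))
          (solve 2 (λ ε N′ → :2 :* (:- ε) :* (:- N′) := :2 :* ε :* N′) refl ε N′)
        cv≈ε : c * v ≈ ε
        cv≈ε = by (ε ⊛ cc′≈1)
          (solve 3 (λ c ε c′ → c :* (ε :* c′) :+ ε :* :1 := ε :+ ε :* (c :* c′)) refl c ε c′)
        real : Real (c * (l * v) - α * (l * v * (l * v)))
        real = real-resp
          (by ((- l) ⊛ cv≈ε)
            (solve 5 (λ l ε α v c →
                   l :* ε :- l :* l :* (α :* (v :* v)) :+ (:- l) :* ε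
                := c :* (l :* v) :- α :* (l :* v :* (l :* v)) :+ (:- l) :* (c
                     :* v))
                refl l ε α v c))
          (trans ((l-real c* ε-skew) c- (l-real c* l-real c* refl))
            (by (l ⊛ lN≈2ε)
              (solve 4 (λ l ε conjk k →
                     l :* (:- ε) :- l :* l :* conjk :+ l :* (:2 :* ε)
                  := l :* ε :- l :* l :* k :+ l :* (l :* (k :- conjk)))
                  refl l ε (conj k) k)))
          where
          lN≈2ε : l * (k - conj k) ≈ 2# * ε
          lN≈2ε = by ((2# * ε) ⊛ NN′≈1)
            (solve 4 (λ ε N′ k conjk →
                   :2 :* ε :* N′ :* (k :- conjk) :+ :2 :* ε :* :1
                := :2 :* ε :+ :2 :* ε :* ((k :- conjk) :* N′))
                refl ε N′ k (conj k))

      module _ (a b : Carrier) where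

        -- The condition that the line of slope 2αt through (t , s) passes through (a , b), solved
        -- for s.
        OnParabola : Carrier → Carrier → Set ℓ₁
        OnParabola t s = s ≈ b - 2# * α * t * a + 2# * α * t * t

        -- The difference of the two incidences is divisible by t - t′, and the quotient depends on
        -- t and t′ only through their sum.
        chord : ∀ {A B C t s t′ s′} → OnParabola t s → OnParabola t′ s′ →
                A * t + B * s + C * 1# ≈ 0# → A * t′ + B * s′ + C * 1# ≈ 0# → t ≉ t′ →
                A - 2# * α * a * B + 2# * α * B * (t + t′) ≈ 0#
        chord {A} {B} {C} {t} {s} {t′} {s′} s≈ s′≈ e e′ t≉t′ = x*y≈0⇒y≈0 (λ z → t≉t′ (x-y≈0⇒x≈y z))
          (by (e ⊞ (- 1#) ⊛ e′ ⊞ (- B) ⊛ s≈ ⊞ B ⊛ s′≈)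
            (solve 10 (λ t t′ A α a B b s C s′ →
                   (t :- t′) :* (A :- :2 :* α :* a :* B :+ :2 :* α :* B :* (t
                     :+ t′)) :+ (:0 :+ (:- :1) :* :0 :+ (:- B) :* (b :- :2 :* α
                     :* t :* a :+ :2 :* α :* t :* t) :+ B :* (b :- :2 :* α :* t′
                     :* a :+ :2 :* α :* t′ :* t′))
                := :0 :+ (A :* t :+ B :* s :+ C :* :1 :+ (:- :1) :* (A :* t′
                     :+ B :* s′ :+ C :* :1) :+ (:- B) :* s :+ B :* s′))
                refl t t′ A α a B b s C s′))

        -- Comparing the chords from t₁ to t₂ and to t₃ leaves 2α (t₂ - t₃) B = 0; then A and C
        -- vanish as well, so no genuine line meets three points.
        parabola-arc : ∀ {A B C t₁ s₁ t₂ s₂ t₃ s₃} →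
          OnParabola t₁ s₁ → OnParabola t₂ s₂ → OnParabola t₃ s₃ →
          A * t₁ + B * s₁ + C * 1# ≈ 0# → A * t₂ + B * s₂ + C * 1# ≈ 0# → A * t₃ + B * s₃ + C * 1# ≈ 0# →
          t₁ ≉ t₂ → t₁ ≉ t₃ → t₂ ≉ t₃ → A ≈ 0# × B ≈ 0# × C ≈ 0#
        parabola-arc {A} {B} {C} {t₁} {s₁} {t₂} {s₂} {t₃} {s₃} p₁ p₂ p₃ e₁ e₂ e₃ t₁≉t₂ t₁≉t₃ t₂≉t₃ =
          A≈0 , B≈0 , C≈0
          where
          c₁₂ = chord p₁ p₂ e₁ e₂ t₁≉t₂
          c₁₃ = chord p₁ p₃ e₁ e₃ t₁≉t₃
          B≈0 : B ≈ 0#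
          B≈0 = x*y≈0⇒y≈0 (x*y≉0 (x*y≉0 2≉0 α≉0) (λ z → t₂≉t₃ (x-y≈0⇒x≈y z)))
            (by (c₁₂ ⊞ (- 1#) ⊛ c₁₃)
              (solve 7 (λ α t₂ t₃ B A a t₁ →
                     :2 :* α :* (t₂ :- t₃) :* B :+ (:0 :+ (:- :1) :* :0)
                  := :0 :+ (A :- :2 :* α :* a :* B :+ :2 :* α :* B :* (t₁ :+ t₂)
                       :+ (:- :1) :* (A :- :2 :* α :* a :* B :+ :2 :* α :* B :* (t₁
                       :+ t₃))))
                  refl α t₂ t₃ B A a t₁))
          A≈0 : A ≈ 0#
          A≈0 = by (c₁₂ ⊞ (2# * α * a - 2# * α * (t₁ + t₂)) ⊛ B≈0)
            (solve 6 (λ A α a t₁ t₂ B →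
                   A :+ (:0 :+ (:2 :* α :* a :- :2 :* α :* (t₁ :+ t₂)) :* :0)
                := :0 :+ (A :- :2 :* α :* a :* B :+ :2 :* α :* B :* (t₁ :+ t₂)
                     :+ (:2 :* α :* a :- :2 :* α :* (t₁ :+ t₂)) :* B))
                refl A α a t₁ t₂ B)
          C≈0 : C ≈ 0#
          C≈0 = by (e₁ ⊞ (- t₁) ⊛ A≈0 ⊞ (- s₁) ⊛ B≈0)
            (solve 5 (λ C t₁ s₁ A B →
                   C :+ (:0 :+ (:- t₁) :* :0 :+ (:- s₁) :* :0)
                := :0 :+ (A :* t₁ :+ B :* s₁ :+ C :* :1 :+ (:- t₁) :* A :+ (:- s₁)
                     :* B))
                refl C t₁ s₁ A B)

  -- The fundamental theorem of affine geometry.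

  module AffinePlane (2≉0 : 2# ≉ 0#) where

    AffinePoint : Set c
    AffinePoint = Carrier × Carrier

    infix 4 _≋_

    _≋_ : AffinePoint → AffinePoint → Set ℓ₁
    (x , y) ≋ (u , v) = x ≈ u × y ≈ v

    Collinear : (_ _ _ : AffinePoint) → Set ℓ₁
    Collinear (x₁ , y₁) (x₂ , y₂) (x₃ , y₃) = (x₂ - x₁) * (y₃ - y₁) - (x₃ - x₁) * (y₂ - y₁) ≈ 0#

    collinear-resp : ∀ {p₁ p₂ p₃ r₁ r₂ r₃} → p₁ ≋ r₁ → p₂ ≋ r₂ → p₃ ≋ r₃ →
                     Collinear p₁ p₂ p₃ → Collinear r₁ r₂ r₃
    collinear-resp (x₁ , y₁) (x₂ , y₂) (x₃ , y₃) =
      trans (sym (+-cong (*-cong (x₂ ⊝ x₁) (y₃ ⊝ y₁)) (-‿cong (*-cong (x₃ ⊝ x₁) (y₂ ⊝ y₁)))))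
      where
      _⊝_ : ∀ {a b d e} → a ≈ b → d ≈ e → a - d ≈ b - e
      p ⊝ q = +-cong p (-‿cong q)

    record IsCollineation (F : AffinePoint → AffinePoint) : Set (c ⊔ ℓ₁) where
      field
        cong            : ∀ {p r} → p ≋ r → F p ≋ F r
        surjective      : ∀ r → ∃[ p ] F p ≋ r
        collinear       : ∀ {p₁ p₂ p₃} → Collinear p₁ p₂ p₃ → Collinear (F p₁) (F p₂) (F p₃)
        collinear⁻¹     : ∀ {p₁ p₂ p₃} → Collinear (F p₁) (F p₂) (F p₃) → Collinear p₁ p₂ p₃

    O X Y : AffinePoint
    O = 0# , 0#
    X = 1# , 0#
    Y = 0# , 1#

    record FixesFrame (G : AffinePoint → AffinePoint) : Set (c ⊔ ℓ₁) where
      field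
        isCollineation : IsCollineation G
        fix-O          : G O ≋ O
        fix-X          : G X ≋ X
        fix-Y          : G Y ≋ Y
      open IsCollineation isCollineation public

    ≋-sym : ∀ {p r} → p ≋ r → r ≋ p
    ≋-sym (e₁ , e₂) = sym e₁ , sym e₂

    ≋-trans : ∀ {p r s} → p ≋ r → r ≋ s → p ≋ s
    ≋-trans (e₁ , e₂) (f₁ , f₂) = trans e₁ f₁ , trans e₂ f₂

    ≋-refl : ∀ {p} → p ≋ p
    ≋-refl = refl , refl

    -- Lets the horizontal direction be treated by the argument for the vertical one.
    swap-fixesFrame : ∀ {G} → FixesFrame G → FixesFrame (swap ∘ G ∘ swap)
    swap-fixesFrame fixes = record
      { isCollineation = record
        { cong        = swap ∘ cong ∘ swap
        ; surjective  = λ r → let p , Gp≋ = surjective (swap r) in swap p , swap Gp≋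
        ; collinear   = λ {p₁} {p₂} {p₃} →
            collinear-swap ∘ collinear {swap p₁} {swap p₂} {swap p₃} ∘ collinear-swap {p₁} {p₂} {p₃}
        ; collinear⁻¹ = λ {p₁} {p₂} {p₃} →
            collinear-swap {swap p₁} {swap p₂} {swap p₃} ∘ collinear⁻¹ {swap p₁} {swap p₂} {swap p₃} ∘ collinear-swap
        }
      ; fix-O = swap fix-O
      ; fix-X = swap fix-Y
      ; fix-Y = swap fix-X
      }
      where
      open FixesFrame fixes
      collinear-swap : ∀ {p₁ p₂ p₃} → Collinear p₁ p₂ p₃ → Collinear (swap p₁) (swap p₂) (swap p₃)
      collinear-swap {x₁ , y₁} {x₂ , y₂} {x₃ , y₃} e =
        by ((- 1#) ⊛ e)
          (solve 6 (λ y₂ y₁ x₃ x₁ y₃ x₂ →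
                 (y₂ :- y₁) :* (x₃ :- x₁) :- (y₃ :- y₁) :* (x₂ :- x₁) :+ (:- :1)
                   :* :0
              := :0 :+ (:- :1) :* ((x₂ :- x₁) :* (y₃ :- y₁) :- (x₃ :- x₁) :* (y₂
                   :- y₁)))
              refl y₂ y₁ x₃ x₁ y₃ x₂)

    on-x-axis : ∀ {x y} → Collinear O X (x , y) → y ≈ 0#
    on-x-axis {x} {y} e = by e
      (solve 2 (λ y x →
             y :+ :0
          := :0 :+ ((:1 :- :0) :* (y :- :0) :- (x :- :0) :* (:0 :- :0)))
          refl y x)

    x-axis : ∀ x → Collinear O X (x , 0#)
    x-axis x = solve 1 (λ x → (:1 :- :0) :* (:0 :- :0) :- (x :- :0) :* (:0 :- :0) := :0) refl x

    on-y-axis : ∀ {x y} → Collinear O Y (x , y) → x ≈ 0#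
    on-y-axis {x} {y} e = by ((- 1#) ⊛ e)
      (solve 2 (λ x y →
             x :+ (:- :1) :* :0
          := :0 :+ (:- :1) :* ((:0 :- :0) :* (y :- :0) :- (x :- :0) :* (:1 :- :0)))
          refl x y)

    y-axis : ∀ y → Collinear O Y (0# , y)
    y-axis y = solve 1 (λ y → (:0 :- :0) :* (y :- :0) :- (:0 :- :0) :* (:1 :- :0) := :0) refl y

    on-vertical : ∀ {x y y′} → Collinear (0# , y) (x , 0#) (x , y′) → x * y′ ≈ 0#
    on-vertical {x} {y} {y′} e = by e
      (solve 3 (λ x y′ y →
             x :* y′ :+ :0
          := :0 :+ ((x :- :0) :* (y′ :- y) :- (x :- :0) :* (:0 :- y)))
          refl x y′ y)

    module Vertical {G} (fixes : FixesFrame G) where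
      open FixesFrame fixes

      G-x-axis : ∀ x → proj₂ (G (x , 0#)) ≈ 0#
      G-x-axis x = on-x-axis (collinear-resp fix-O fix-X ≋-refl (collinear (x-axis x)))

      G-y-axis : ∀ y → proj₁ (G (0# , y)) ≈ 0#
      G-y-axis y = on-y-axis (collinear-resp fix-O fix-Y ≋-refl (collinear (y-axis y)))

      -- Otherwise the line through the images of (x , 0) and (x , y) would meet the image of
      -- the y-axis, although the two points lie on a parallel to the y-axis.
      vertical : ∀ x y → proj₁ (G (x , y)) ≈ proj₁ (G (x , 0#))
      vertical x y with x ≟ 0# | y ≟ 0#
      ... | _       | yes y≈0 = proj₁ (cong (refl , y≈0))
      ... | yes x≈0 | no  _   = trans (trans (proj₁ (cong (x≈0 , refl))) (G-y-axis y))
                                  (sym (trans (proj₁ (cong (x≈0 , refl))) (G-y-axis 0#)))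
      ... | no  x≉0 | no  y≉0 with proj₁ (G (x , y)) ≟ proj₁ (G (x , 0#))
      ...   | yes eq  = eq
      ...   | no  neq = contradiction (on-vertical parallel) (x*y≉0 x≉0 y≉0)
        where
        s = proj₁ (G (x , 0#))
        g₁ = proj₁ (G (x , y))
        g₂ = proj₂ (G (x , y))
        abstract
          i : ∃[ i ] (g₁ - s) * i ≈ 1#
          i = inverse λ e → neq (x-y≈0⇒x≈y e)
        -- The ordinate at which the line through (s , 0) and (g₁ , g₂) crosses the y-axis.
        t = - (s * g₂ * proj₁ i)
        meets : Collinear (0# , t) (s , 0#) (g₁ , g₂)
        meets = by ((- (s * g₂)) ⊛ (proj₂ i))
          (solve 4 (λ s g₂ proj₁i g₁ →
                 (s :- :0) :* (g₂ :- (:- (s :* g₂ :* proj₁i))) :- (g₁ :- :0)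
                   :* (:0 :- (:- (s :* g₂ :* proj₁i))) :+ (:- (s :* g₂)) :* :1
              := :0 :+ (:- (s :* g₂)) :* ((g₁ :- s) :* proj₁i))
              refl s g₂ (proj₁ i) g₁)
        p = proj₁ (surjective (0# , t))
        Gp≋ = proj₂ (surjective (0# , t))
        p-on-y-axis : proj₁ p ≈ 0#
        p-on-y-axis = on-y-axis (collinear⁻¹ {O} {Y} {p}
          (collinear-resp (≋-sym fix-O) (≋-sym fix-Y) (≋-sym Gp≋) (y-axis t)))
        parallel : Collinear (0# , proj₂ p) (x , 0#) (x , y)
        parallel = collinear-resp (p-on-y-axis , refl) ≋-refl ≋-refl
          (collinear⁻¹ {p} {x , 0#} {x , y} (collinear-resp (≋-sym Gp≋) (refl , sym (G-x-axis x)) ≋-refl meets))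

    module FundamentalTheorem {G} (fixes : FixesFrame G) where
      open FixesFrame fixes
      private
        module V = Vertical fixes
        module H = Vertical (swap-fixesFrame fixes)

      σ : Carrier → Carrier
      σ x = proj₁ (G (x , 0#))

      σ-cong : ∀ {x y} → x ≈ y → σ x ≈ σ y
      σ-cong x≈y = proj₁ (cong (x≈y , refl))

      σ-0 : σ 0# ≈ 0#
      σ-0 = proj₁ fix-O

      σ-1 : σ 1# ≈ 1#
      σ-1 = proj₁ fix-X

      private
        τ : Carrier → Carrier
        τ y = proj₂ (G (0# , y))

        σ,τ : ∀ x y → G (x , y) ≋ (σ x , τ y)
        σ,τ x y = V.vertical x y , H.vertical y x

        diagonal : ∀ x → Collinear O (1# , 1#) (x , x)
        diagonal x = solve 1 (λ x → (:1 :- :0) :* (x :- :0) :- (x :- :0) :* (:1 :- :0) := :0) refl x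

        on-diagonal : ∀ {x y} → Collinear O (1# , 1#) (x , y) → y ≈ x
        on-diagonal {x} {y} e = by e
          (solve 2 (λ y x →
                 y :+ :0
              := x :+ ((:1 :- :0) :* (y :- :0) :- (x :- :0) :* (:1 :- :0)))
              refl y x)

        -- The diagonal is preserved, since (0,0) and (1,1) are fixed.
        τ≈σ : ∀ x → τ x ≈ σ x
        τ≈σ x = on-diagonal (collinear-resp fix-O (≋-trans (σ,τ 1# 1#) (σ-1 , proj₂ fix-Y)) (σ,τ x x)
          (collinear (diagonal x)))

      semilinear : ∀ x y → G (x , y) ≋ (σ x , σ y)
      semilinear x y = ≋-trans (σ,τ x y) (refl , τ≈σ y)

      private
        collinear-σ : ∀ {x₁ y₁ x₂ y₂ x₃ y₃} → Collinear (x₁ , y₁) (x₂ , y₂) (x₃ , y₃) →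
                      Collinear (σ x₁ , σ y₁) (σ x₂ , σ y₂) (σ x₃ , σ y₃)
        collinear-σ = collinear-resp (semilinear _ _) (semilinear _ _) (semilinear _ _) ∘ collinear

        collinear-σ⁻¹ : ∀ {x₁ y₁ x₂ y₂ x₃ y₃} → Collinear (σ x₁ , σ y₁) (σ x₂ , σ y₂) (σ x₃ , σ y₃) →
                        Collinear (x₁ , y₁) (x₂ , y₂) (x₃ , y₃)
        collinear-σ⁻¹ = collinear⁻¹ ∘
          collinear-resp (≋-sym (semilinear _ _)) (≋-sym (semilinear _ _)) (≋-sym (semilinear _ _))

      -- Multiplication is read off from the line through the origin and (1 , y), which carries (x ,
      -- x y).
      σ-* : ∀ x y → σ (x * y) ≈ σ x * σ y
      σ-* x y = on-line (collinear-resp (σ-0 , σ-0) (σ-1 , refl) ≋-refl (collinear-σ line))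
        where
        line : Collinear (0# , 0#) (1# , y) (x , x * y)
        line = solve 2 (λ x y → (:1 :- :0) :* (x :* y :- :0) :- (x :- :0) :* (y :- :0) := :0) refl x y
        on-line : ∀ {x y z} → Collinear (0# , 0#) (1# , y) (x , z) → z ≈ x * y
        on-line {x} {y} {z} e = by e
          (solve 3 (λ z x y →
                 z :+ :0
              := x :* y :+ ((:1 :- :0) :* (z :- :0) :- (x :- :0) :* (y :- :0)))
              refl z x y)

      -- If σ x = σ y, the images of (y , 0), (y , 1) and (x , 0) lie on a vertical line, so the
      -- points themselves are collinear.
      σ-injective : ∀ {x y} → σ x ≈ σ y → x ≈ y
      σ-injective {x} {y} σx≈σy = on-line (collinear-σ⁻¹ {y} {0#} {y} {1#} {x} {0#} line)
        where
        line : Collinear (σ y , σ 0#) (σ y , σ 1#) (σ x , σ 0#)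
        line = by ((- ((σ 1#) - (σ 0#))) ⊛ σx≈σy)
          (solve 4 (λ σy σ0# σx σ1# →
                 (σy :- σy) :* (σ0# :- σ0#) :- (σx :- σy) :* (σ1# :- σ0#) :+ (:- (σ1#
                   :- σ0#)) :* σy
              := :0 :+ (:- (σ1# :- σ0#)) :* σx)
              refl (σ y) (σ 0#) (σ x) (σ 1#))
        on-line : Collinear (y , 0#) (y , 1#) (x , 0#) → x ≈ y
        on-line e = by ((- 1#) ⊛ e)
          (solve 2 (λ x y →
                 x :+ (:- :1) :* :0
              := y :+ (:- :1) :* ((y :- y) :* (:0 :- :0) :- (x :- y) :* (:1 :- :0)))
              refl x y)

      σ-surjective : ∀ y → ∃[ x ] σ x ≈ y
      σ-surjective = injective⇒surjective σ σ-cong σ-injective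

      σ-≉0 : ∀ {x} → x ≉ 0# → σ x ≉ 0#
      σ-≉0 x≉0 σx≈0 = x≉0 (σ-injective (trans σx≈0 (sym σ-0)))

      -- Additivity is not yet at hand, so the sign comes from multiplicativity: σ (-1) is a square
      -- root of 1, and injectivity with 2 ≠ 0 excludes 1.
      σ-neg : ∀ x → σ (- x) ≈ - σ x
      σ-neg x = begin
        σ (- x)           ≈⟨ σ-cong (solve 1 (λ x → :- x := (:- :1) :* x) refl x) ⟩
        σ (- 1# * x)      ≈⟨ σ-* (- 1#) x ⟩
        σ (- 1#) * σ x    ≈⟨ *-congʳ σ-minus-1 ⟩
        - 1# * σ x        ≈⟨ (solve 1 (λ σx → (:- :1) :* σx := :- σx) refl (σ x)) ⟩
        - σ x             ∎
        where
        σ-minus-1 : σ (- 1#) ≈ - 1#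
        σ-minus-1 with x²≈y²⇒x≈±y σ-1²≈1
          where
          abstract
            σ-1²≈1 : σ (- 1#) * σ (- 1#) ≈ 1# * 1#
            σ-1²≈1 = trans (sym (σ-* (- 1#) (- 1#)))
              (trans (σ-cong (solve 0 ((:- :1) :* (:- :1) := :1) refl))
              (trans σ-1 (sym (*-identityˡ 1#))))
        ... | inj₂ σ-1≈-1 = σ-1≈-1
        ... | inj₁ σ-1≈1  = contradiction
          (by ((- 1#) ⊛ (σ-injective (trans σ-1≈1 (sym σ-1))))
            (solve 0 (:1 :+ :1 :+ (:- :1) :* :1 := :0 :+ (:- :1) :* (:- :1)) refl)) 2≉0

      -- The points (0 , b), (b , 0) and (x , b - x) are collinear.
      σ-sub : ∀ {b} → b ≉ 0# → ∀ x → σ (b - x) ≈ σ b - σ x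
      σ-sub {b} b≉0 x = on-line (σ-≉0 b≉0) (collinear-resp (σ-0 , refl) (refl , σ-0) ≋-refl (collinear-σ line))
        where
        line : Collinear (0# , b) (b , 0#) (x , b - x)
        line = solve 2 (λ b x → (b :- :0) :* (b :- x :- b) :- (x :- :0) :* (:0 :- b) := :0) refl b x
        on-line : ∀ {b x y} → b ≉ 0# → Collinear (0# , b) (b , 0#) (x , y) → y ≈ b - x
        on-line {b} {x} {y} b≉0 e = *-cancelˡ-≉ b≉0 (by e
          (solve 3 (λ b y x →
                 b :* y :+ :0
              := b :* (b :- x) :+ ((b :- :0) :* (y :- b) :- (x :- :0) :* (:0
                   :- b)))
              refl b y x))

      -- A sum is a difference x - (- y), covered by `σ-sub` when x ≠ 0; for x = 0 the line used
      -- there degenerates.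
      σ-+ : ∀ x y → σ (x + y) ≈ σ x + σ y
      σ-+ x y with x ≟ 0#
      ... | no x≉0 = begin
        σ (x + y)         ≈⟨ σ-cong (solve 2 (λ x y → x :+ y := x :- (:- y)) refl x y) ⟩
        σ (x - (- y))     ≈⟨ σ-sub x≉0 (- y) ⟩
        σ x - σ (- y)     ≈⟨ +-congˡ (-‿cong (σ-neg y)) ⟩
        σ x - (- σ y)     ≈⟨ (solve 2 (λ σx σy → σx :- (:- σy) := σx :+ σy) refl (σ x) (σ y)) ⟩
        σ x + σ y         ∎
      ... | yes x≈0 = begin
        σ (x + y)     ≈⟨ σ-cong (trans (+-congʳ x≈0) (+-identityˡ y)) ⟩
        σ y           ≈⟨ +-identityˡ _ ⟨
        0# + σ y      ≈⟨ +-congʳ (trans (σ-cong x≈0) σ-0) ⟨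
        σ x + σ y     ∎

    module AffineMap {u₁ u₂ w₁ w₂ E : Carrier} (v₁ v₂ : Carrier) (δE≈1 : (u₁ * w₂ - u₂ * w₁) * E ≈ 1#) where

      -- The second map is Cramer's rule, `E` being the inverse of the determinant.
      apply unapply : AffinePoint → AffinePoint
      apply   (x , y) = v₁ + u₁ * x + w₁ * y , v₂ + u₂ * x + w₂ * y
      unapply (x , y) = ((x - v₁) * w₂ - (y - v₂) * w₁) * E , (u₁ * (y - v₂) - u₂ * (x - v₁)) * E

      apply-cong : ∀ {p r} → p ≋ r → apply p ≋ apply r
      apply-cong (x≈ , y≈) =
        +-cong (+-congˡ (*-congˡ x≈)) (*-congˡ y≈) ,
        +-cong (+-congˡ (*-congˡ x≈)) (*-congˡ y≈)

      unapply-cong : ∀ {p r} → p ≋ r → unapply p ≋ unapply r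
      unapply-cong (x≈ , y≈) =
        *-congʳ (+-cong (*-congʳ (+-congʳ x≈)) (-‿cong (*-congʳ (+-congʳ y≈)))) ,
        *-congʳ (+-cong (*-congˡ (+-congʳ y≈)) (-‿cong (*-congˡ (+-congʳ x≈))))

      apply-unapply : ∀ p → apply (unapply p) ≋ p
      apply-unapply (x , y) =
        by ((x - v₁) ⊛ δE≈1)
          (solve 9 (λ v₁ u₁ x w₂ y v₂ w₁ E u₂ →
                 v₁ :+ u₁ :* (((x :- v₁) :* w₂ :- (y :- v₂) :* w₁) :* E) :+ w₁
                   :* ((u₁ :* (y :- v₂) :- u₂ :* (x :- v₁)) :* E) :+ (x :- v₁)
                   :* :1
              := x :+ (x :- v₁) :* ((u₁ :* w₂ :- u₂ :* w₁) :* E))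
              refl v₁ u₁ x w₂ y v₂ w₁ E u₂) ,
        (by ((y - v₂) ⊛ δE≈1)
          (solve 9 (λ v₂ u₂ x v₁ w₂ y w₁ E u₁ →
                 v₂ :+ u₂ :* (((x :- v₁) :* w₂ :- (y :- v₂) :* w₁) :* E) :+ w₂
                   :* ((u₁ :* (y :- v₂) :- u₂ :* (x :- v₁)) :* E) :+ (y :- v₂)
                   :* :1
              := y :+ (y :- v₂) :* ((u₁ :* w₂ :- u₂ :* w₁) :* E))
              refl v₂ u₂ x v₁ w₂ y w₁ E u₁))

      unapply-apply : ∀ p → unapply (apply p) ≋ p
      unapply-apply (x , y) =
        by (x ⊛ δE≈1)
          (solve 9 (λ v₁ u₁ x w₁ y w₂ v₂ u₂ E →
                 ((v₁ :+ u₁ :* x :+ w₁ :* y :- v₁) :* w₂ :- (v₂ :+ u₂ :* x :+ w₂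
                   :* y :- v₂) :* w₁) :* E :+ x :* :1
              := x :+ x :* ((u₁ :* w₂ :- u₂ :* w₁) :* E))
              refl v₁ u₁ x w₁ y w₂ v₂ u₂ E) ,
        (by (y ⊛ δE≈1)
          (solve 9 (λ u₁ v₂ u₂ x w₂ y v₁ w₁ E →
                 (u₁ :* (v₂ :+ u₂ :* x :+ w₂ :* y :- v₂) :- u₂ :* (v₁ :+ u₁ :* x
                   :+ w₁ :* y :- v₁)) :* E :+ y :* :1
              := y :+ y :* ((u₁ :* w₂ :- u₂ :* w₁) :* E))
              refl u₁ v₂ u₂ x w₂ y v₁ w₁ E))

      private
        det : AffinePoint → AffinePoint → AffinePoint → Carrier
        det (x₁ , y₁) (x₂ , y₂) (x₃ , y₃) = (x₂ - x₁) * (y₃ - y₁) - (x₃ - x₁) * (y₂ - y₁)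

        det-apply : ∀ p r s → det (apply p) (apply r) (apply s) ≈ (u₁ * w₂ - u₂ * w₁) * det p r s
        det-apply (x₁ , y₁) (x₂ , y₂) (x₃ , y₃) =
          solve 12 (λ v₁ u₁ x₂ w₁ y₂ x₁ y₁ v₂ u₂ x₃ w₂ y₃ →
                 (v₁ :+ u₁ :* x₂ :+ w₁ :* y₂ :- (v₁ :+ u₁ :* x₁ :+ w₁ :* y₁))
                   :* (v₂ :+ u₂ :* x₃ :+ w₂ :* y₃ :- (v₂ :+ u₂ :* x₁ :+ w₂ :* y₁))
                   :- (v₁ :+ u₁ :* x₃ :+ w₁ :* y₃ :- (v₁ :+ u₁ :* x₁ :+ w₁ :* y₁))
                   :* (v₂ :+ u₂ :* x₂ :+ w₂ :* y₂ :- (v₂ :+ u₂ :* x₁ :+ w₂ :* y₁))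
              := (u₁ :* w₂ :- u₂ :* w₁) :* ((x₂ :- x₁) :* (y₃ :- y₁) :- (x₃ :- x₁)
                   :* (y₂ :- y₁)))
              refl v₁ u₁ x₂ w₁ y₂ x₁ y₁ v₂ u₂ x₃ w₂ y₃

      apply-collinear : ∀ {p r s} → Collinear p r s → Collinear (apply p) (apply r) (apply s)
      apply-collinear {p} {r} {s} e = trans (det-apply p r s) (trans (*-congˡ e) (zeroʳ _))

      apply-collinear⁻¹ : ∀ {p r s} → Collinear (apply p) (apply r) (apply s) → Collinear p r s
      apply-collinear⁻¹ {p} {r} {s} e = x*y≈0⇒y≈0 (x*y≈1⇒x≉0 δE≈1) (trans (sym (det-apply p r s)) e)

      unapply-collinear : ∀ {p r s} → Collinear p r s → Collinear (unapply p) (unapply r) (unapply s)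
      unapply-collinear = apply-collinear⁻¹ ∘
        collinear-resp (≋-sym (apply-unapply _)) (≋-sym (apply-unapply _)) (≋-sym (apply-unapply _))

      unapply-collinear⁻¹ : ∀ {p r s} → Collinear (unapply p) (unapply r) (unapply s) → Collinear p r s
      unapply-collinear⁻¹ =
        collinear-resp (apply-unapply _) (apply-unapply _) (apply-unapply _) ∘ apply-collinear

    record IsSemilinear (F : AffinePoint → AffinePoint) : Set (c ⊔ ℓ₁) where
      field
        σ            : Carrier → Carrier
        σ-cong       : ∀ {x y} → x ≈ y → σ x ≈ σ y
        σ-+          : ∀ x y → σ (x + y) ≈ σ x + σ y
        σ-*          : ∀ x y → σ (x * y) ≈ σ x * σ y
        σ-neg        : ∀ x → σ (- x) ≈ - σ x
        σ-0          : σ 0# ≈ 0#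
        σ-surjective : ∀ y → ∃[ x ] σ x ≈ y
        u₁ u₂ w₁ w₂ v₁ v₂ : Carrier
        independent  : u₁ * w₂ - u₂ * w₁ ≉ 0#
        semilinear   : ∀ x y → F (x , y) ≋ (v₁ + u₁ * σ x + w₁ * σ y , v₂ + u₂ * σ x + w₂ * σ y)

    -- The affine map that agrees with `F` on O, X, Y is invertible, since the images of these three
    -- points are not collinear. Undoing it after `F` leaves a collineation fixing the frame, which
    -- is the same σ in both coordinates.
    collineation⇒semilinear : ∀ {F} → IsCollineation F → IsSemilinear F
    collineation⇒semilinear {F} isCollineation = record
      { FT
      ; independent = δ≉0
      ; semilinear  = λ x y → ≋-trans (≋-sym (A.apply-unapply (F (x , y)))) (A.apply-cong (FT.semilinear x y))
      }
      where
      open IsCollineation isCollineation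
      v₁ = proj₁ (F O)
      v₂ = proj₂ (F O)
      u₁ = proj₁ (F X) - v₁
      u₂ = proj₂ (F X) - v₂
      w₁ = proj₁ (F Y) - v₁
      w₂ = proj₂ (F Y) - v₂
      δ≉0 : u₁ * w₂ - u₂ * w₁ ≉ 0#
      δ≉0 e = 1≉0 (on-x-axis (collinear⁻¹ {O} {X} {Y} (trans
        (solve 4 (λ u₁ w₂ w₁ u₂ → u₁ :* w₂ :- w₁ :* u₂ := u₁ :* w₂ :- u₂ :* w₁) refl u₁ w₂ w₁ u₂)
        e)))
      module A = AffineMap {u₁} {u₂} {w₁} {w₂} v₁ v₂ (proj₂ (inverse δ≉0))

      frame : ∀ p → F p ≋ A.apply p → A.unapply (F p) ≋ p
      frame p Fp≋ = ≋-trans (A.unapply-cong Fp≋) (A.unapply-apply p)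

      fixes : FixesFrame (A.unapply ∘ F)
      fixes = record
        { isCollineation = record
          { cong        = A.unapply-cong ∘ cong
          ; surjective  = λ r → let p , Fp≋ = surjective (A.apply r) in
              p , ≋-trans (A.unapply-cong Fp≋) (A.unapply-apply r)
          ; collinear   = A.unapply-collinear ∘ collinear
          ; collinear⁻¹ = collinear⁻¹ ∘ A.unapply-collinear⁻¹
          }
        ; fix-O = frame O (at-O _ _ _ , at-O _ _ _)
        ; fix-X = frame X (at-X _ _ _ , at-X _ _ _)
        ; fix-Y = frame Y (at-Y _ _ _ , at-Y _ _ _)
        }
        where
        at-O : ∀ v u w → v ≈ v + u * 0# + w * 0#
        at-O v u w = solve 3 (λ v u w → v := v :+ u :* :0 :+ w :* :0) refl v u w
        at-X : ∀ x v w → x ≈ v + (x - v) * 1# + w * 0#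
        at-X x v w = solve 3 (λ x v w → x := v :+ (x :- v) :* :1 :+ w :* :0) refl x v w
        at-Y : ∀ y v u → y ≈ v + u * 0# + (y - v) * 1#
        at-Y y v u = solve 3 (λ y v u → y := v :+ u :* :0 :+ (y :- v) :* :1) refl y v u

      module FT = FundamentalTheorem fixes

    -- The quadratic form with symmetric matrix (a h g; h b f; g f d), evaluated at (x , y , 1).
    record Conic : Set c where
      field
        a b d f g h : Carrier

      det : Carrier
      det = a * (b * d - f * f) - h * (h * d - f * g) + g * (h * f - b * g)

      eval : AffinePoint → Carrier
      eval (x , y) = x * (a * x + h * y + g) + y * (h * x + b * y + f) + (g * x + f * y + d)

      eval-cong : ∀ {p r} → p ≋ r → eval p ≈ eval r
      eval-cong (x≈ , y≈) =
        +-cong (+-cong (*-cong x≈ (+-congʳ (+-cong (*-congˡ x≈) (*-congˡ y≈))))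
                       (*-cong y≈ (+-congʳ (+-cong (*-congˡ x≈) (*-congˡ y≈)))))
               (+-congʳ (+-cong (*-congˡ x≈) (*-congˡ y≈)))

    open Conic using (det; eval; eval-cong)

    -- Pulling a conic back along a semilinear map.

    module _ (C : Conic) where
      open Conic C hiding (det; eval; eval-cong)

      translate : Carrier → Carrier → Conic
      translate v₁ v₂ = record
        { a = a ; b = b ; h = h
        ; g = a * v₁ + h * v₂ + g
        ; f = h * v₁ + b * v₂ + f
        ; d = eval C (v₁ , v₂)
        }

      eval-translate : ∀ v₁ v₂ x y → eval (translate v₁ v₂) (x , y) ≈ eval C (v₁ + x , v₂ + y)
      eval-translate v₁ v₂ x y =
        solve 10 (λ x a h y v₁ v₂ g b f d →
               x :* (a :* x :+ h :* y :+ (a :* v₁ :+ h :* v₂ :+ g)) :+ y :* (h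
                 :* x :+ b :* y :+ (h :* v₁ :+ b :* v₂ :+ f)) :+ ((a :* v₁ :+ h
                 :* v₂ :+ g) :* x :+ (h :* v₁ :+ b :* v₂ :+ f) :* y :+ (v₁ :* (a
                 :* v₁ :+ h :* v₂ :+ g) :+ v₂ :* (h :* v₁ :+ b :* v₂ :+ f) :+ (g
                 :* v₁ :+ f :* v₂ :+ d)))
            := (v₁ :+ x) :* (a :* (v₁ :+ x) :+ h :* (v₂ :+ y) :+ g) :+ (v₂ :+ y)
                 :* (h :* (v₁ :+ x) :+ b :* (v₂ :+ y) :+ f) :+ (g :* (v₁ :+ x)
                 :+ f :* (v₂ :+ y) :+ d))
            refl x a h y v₁ v₂ g b f d

      det-translate : ∀ v₁ v₂ → det (translate v₁ v₂) ≈ det C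
      det-translate v₁ v₂ =
        solve 8 (λ a b v₁ h v₂ g f d →
               a :* (b :* (v₁ :* (a :* v₁ :+ h :* v₂ :+ g) :+ v₂ :* (h :* v₁
                 :+ b :* v₂ :+ f) :+ (g :* v₁ :+ f :* v₂ :+ d)) :- (h :* v₁ :+ b
                 :* v₂ :+ f) :* (h :* v₁ :+ b :* v₂ :+ f)) :- h :* (h :* (v₁ :* (a
                 :* v₁ :+ h :* v₂ :+ g) :+ v₂ :* (h :* v₁ :+ b :* v₂ :+ f) :+ (g
                 :* v₁ :+ f :* v₂ :+ d)) :- (h :* v₁ :+ b :* v₂ :+ f) :* (a :* v₁
                 :+ h :* v₂ :+ g)) :+ (a :* v₁ :+ h :* v₂ :+ g) :* (h :* (h :* v₁
                 :+ b :* v₂ :+ f) :- b :* (a :* v₁ :+ h :* v₂ :+ g))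
            := a :* (b :* d :- f :* f) :- h :* (h :* d :- f :* g) :+ g :* (h
                 :* f :- b :* g))
            refl a b v₁ h v₂ g f d

      substitute : (u₁ u₂ w₁ w₂ : Carrier) → Conic
      substitute u₁ u₂ w₁ w₂ = record
        { a = u₁ * (a * u₁ + h * u₂) + u₂ * (h * u₁ + b * u₂)
        ; h = w₁ * (a * u₁ + h * u₂) + w₂ * (h * u₁ + b * u₂)
        ; b = w₁ * (a * w₁ + h * w₂) + w₂ * (h * w₁ + b * w₂)
        ; g = g * u₁ + f * u₂
        ; f = g * w₁ + f * w₂
        ; d = d
        }

      eval-substitute : ∀ u₁ u₂ w₁ w₂ x y →
        eval (substitute u₁ u₂ w₁ w₂) (x , y) ≈ eval C (u₁ * x + w₁ * y , u₂ * x + w₂ * y)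
      eval-substitute u₁ u₂ w₁ w₂ x y =
        solve 12 (λ x u₁ a h u₂ b w₁ w₂ y g f d →
               x :* ((u₁ :* (a :* u₁ :+ h :* u₂) :+ u₂ :* (h :* u₁ :+ b :* u₂))
                 :* x :+ (w₁ :* (a :* u₁ :+ h :* u₂) :+ w₂ :* (h :* u₁ :+ b :* u₂))
                 :* y :+ (g :* u₁ :+ f :* u₂)) :+ y :* ((w₁ :* (a :* u₁ :+ h :* u₂)
                 :+ w₂ :* (h :* u₁ :+ b :* u₂)) :* x :+ (w₁ :* (a :* w₁ :+ h :* w₂)
                 :+ w₂ :* (h :* w₁ :+ b :* w₂)) :* y :+ (g :* w₁ :+ f :* w₂)) :+ ((g
                 :* u₁ :+ f :* u₂) :* x :+ (g :* w₁ :+ f :* w₂) :* y :+ d)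
            := (u₁ :* x :+ w₁ :* y) :* (a :* (u₁ :* x :+ w₁ :* y) :+ h :* (u₂
                 :* x :+ w₂ :* y) :+ g) :+ (u₂ :* x :+ w₂ :* y) :* (h :* (u₁ :* x
                 :+ w₁ :* y) :+ b :* (u₂ :* x :+ w₂ :* y) :+ f) :+ (g :* (u₁ :* x
                 :+ w₁ :* y) :+ f :* (u₂ :* x :+ w₂ :* y) :+ d))
            refl x u₁ a h u₂ b w₁ w₂ y g f d

      det-substitute : ∀ u₁ u₂ w₁ w₂ →
        det (substitute u₁ u₂ w₁ w₂) ≈ (u₁ * w₂ - u₂ * w₁) * (u₁ * w₂ - u₂ * w₁) * det C
      det-substitute u₁ u₂ w₁ w₂ =
        solve 10 (λ u₁ a h u₂ b w₁ w₂ d g f →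
               (u₁ :* (a :* u₁ :+ h :* u₂) :+ u₂ :* (h :* u₁ :+ b :* u₂)) :* ((w₁
                 :* (a :* w₁ :+ h :* w₂) :+ w₂ :* (h :* w₁ :+ b :* w₂)) :* d :- (g
                 :* w₁ :+ f :* w₂) :* (g :* w₁ :+ f :* w₂)) :- (w₁ :* (a :* u₁
                 :+ h :* u₂) :+ w₂ :* (h :* u₁ :+ b :* u₂)) :* ((w₁ :* (a :* u₁
                 :+ h :* u₂) :+ w₂ :* (h :* u₁ :+ b :* u₂)) :* d :- (g :* w₁ :+ f
                 :* w₂) :* (g :* u₁ :+ f :* u₂)) :+ (g :* u₁ :+ f :* u₂) :* ((w₁
                 :* (a :* u₁ :+ h :* u₂) :+ w₂ :* (h :* u₁ :+ b :* u₂)) :* (g :* w₁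
                 :+ f :* w₂) :- (w₁ :* (a :* w₁ :+ h :* w₂) :+ w₂ :* (h :* w₁ :+ b
                 :* w₂)) :* (g :* u₁ :+ f :* u₂))
            := (u₁ :* w₂ :- u₂ :* w₁) :* (u₁ :* w₂ :- u₂ :* w₁) :* (a :* (b :* d
                 :- f :* f) :- h :* (h :* d :- f :* g) :+ g :* (h :* f :- b :* g)))
            refl u₁ a h u₂ b w₁ w₂ d g f

    module _ {F} (semilinear : IsSemilinear F) where
      open IsSemilinear semilinear renaming (semilinear to F≋)

      private
        infixl 6 _s+_
        infixl 7 _s*_
        _s+_ : ∀ {x y x′ y′} → σ x ≈ x′ → σ y ≈ y′ → σ (x + y) ≈ x′ + y′
        p s+ q = trans (σ-+ _ _) (+-cong p q)
        _s*_ : ∀ {x y x′ y′} → σ x ≈ x′ → σ y ≈ y′ → σ (x * y) ≈ x′ * y′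
        p s* q = trans (σ-* _ _) (*-cong p q)
        sneg : ∀ {x x′} → σ x ≈ x′ → σ (- x) ≈ - x′
        sneg p = trans (σ-neg _) (-‿cong p)

      -- The field automorphism is moved from the coordinates to the coefficients, each replaced by
      -- a preimage under σ.
      preimage : ∀ C → ∃[ C′ ] σ (det C′) ≈ det C × (∀ x y → σ (eval C′ (x , y)) ≈ eval C (σ x , σ y))
      preimage C = C′ , σ-det , σ-eval
        where
        open Conic C hiding (det; eval; eval-cong)
        C′ : Conic
        C′ = record
          { a = proj₁ (σ-surjective a) ; b = proj₁ (σ-surjective b) ; d = proj₁ (σ-surjective d)
          ; f = proj₁ (σ-surjective f) ; g = proj₁ (σ-surjective g) ; h = proj₁ (σ-surjective h)
          }
        a′ = proj₂ (σ-surjective a)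
        b′ = proj₂ (σ-surjective b)
        d′ = proj₂ (σ-surjective d)
        f′ = proj₂ (σ-surjective f)
        g′ = proj₂ (σ-surjective g)
        h′ = proj₂ (σ-surjective h)
        σ-det : σ (det C′) ≈ det C
        σ-det = a′ s* (b′ s* d′ s+ sneg (f′ s* f′))
          s+ sneg (h′ s* (h′ s* d′ s+ sneg (f′ s* g′)))
          s+ g′ s* (h′ s* f′ s+ sneg (b′ s* g′))
        σ-eval : ∀ x y → σ (eval C′ (x , y)) ≈ eval C (σ x , σ y)
        σ-eval x y = refl s* (a′ s* refl s+ h′ s* refl s+ g′)
          s+ refl s* (h′ s* refl s+ b′ s* refl s+ f′)
          s+ (g′ s* refl s+ f′ s* refl s+ d′)

      -- Translation keeps the determinant and the linear substitution multiplies it by a nonzero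
      -- square; σ⁻¹ on the coefficients keeps it nonzero.
      pullback : ∀ C → det C ≉ 0# → ∃[ C′ ] det C′ ≉ 0# × (∀ p → eval C′ p ≈ 0# → eval C (F p) ≈ 0#)
      pullback C det≉0 =
        let C′ , σ-det , σ-eval = preimage (substitute (translate C v₁ v₂) u₁ u₂ w₁ w₂)
        in C′
         , (λ e → x*y≉0 (x*y≉0 independent independent) det≉0
             (trans (*-congˡ (sym (det-translate C v₁ v₂)))
             (trans (sym (det-substitute (translate C v₁ v₂) u₁ u₂ w₁ w₂))
             (trans (sym σ-det) (trans (σ-cong e) σ-0)))))
         , λ (x , y) e →
             trans (eval-cong C (≋-trans (F≋ x y) (+-assoc _ _ _ , +-assoc _ _ _)))
             (trans (sym (eval-translate C v₁ v₂ _ _))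
             (trans (sym (eval-substitute (translate C v₁ v₂) u₁ u₂ w₁ w₂ _ _))
             (trans (sym (σ-eval x y)) (trans (σ-cong e) σ-0))))

-- The field of order q² and the unital in its plane.

module Unital {c ℓ₁ ℓ₂} (q : ℕ) (prime-power : IsPrimePower q) (odd : ¬ (2 ∣ q))
  (K : HeytingField c ℓ₁ ℓ₂) (order : HasOrder K (q ℕ.^ 2)) where

  open HeytingField K using (_#_)
  open FiniteField K (q ℕ.^ 2) order
  open CommutativeRing commutativeRing hiding (zero)
  open IntegerSolver commutativeRing
  open import Algebra.Properties.CommutativeSemiring.Exp commutativeSemiring
  open import Algebra.Properties.Semiring.Mult semiring using () renaming (_×_ to _·_)
  open import Relation.Binary.Reasoning.Setoid setoid

  private
    q²≡p^ : ∀ p h → q ≡ p ℕ.^ suc h → q ℕ.^ 2 ≡ p ℕ.^ (suc h ℕ.* 2)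
    q²≡p^ p h q≡p^ = ≡.trans (≡.cong (ℕ._^ 2) q≡p^) (ℕ.^-*-assoc p (suc h) 2)

  conj : Carrier → Carrier
  conj x = x ^ q

  conj-cong : ∀ {x y} → x ≈ y → conj x ≈ conj y
  conj-cong = ^-congˡ q

  -- With q = p^(h+1) this is the Frobenius map iterated h + 1 times; the order of the field is
  -- p^(2(h+1)).
  conj-+ : ∀ x y → conj (x + y) ≈ conj x + conj y
  conj-+ x y = frobenius prime-power
    where
    frobenius : IsPrimePower q → conj (x + y) ≈ conj x + conj y
    frobenius (zero , _ , 0-prime , _)      = contradiction 0-prime ¬prime[0]
    frobenius (suc p , h , p-prime , q≡p^)    = ≡.subst (λ m → (x + y) ^ m ≈ x ^ m + y ^ m) (≡.sym q≡p^)
      (Frobenius.[x+y]^q≈x^q+y^q p-prime (suc h ℕ.* 2) (q²≡p^ (suc p) h q≡p^) (suc h) x y)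

  conj-* : ∀ x y → conj (x * y) ≈ conj x * conj y
  conj-* x y = ^-distrib-* x y q

  conj-involutive : ∀ x → conj (conj x) ≈ x
  conj-involutive x = begin
    (x ^ q) ^ q       ≈⟨ ^-assocʳ x q q ⟩
    x ^ (q ℕ.* q)     ≡⟨ ≡.cong (λ m → x ^ (q ℕ.* m)) (ℕ.*-identityʳ q) ⟨
    x ^ (q ℕ.^ 2)     ≈⟨ x^n≈x x ⟩
    x                 ∎
    where
    instance
      q²≢0 : ℕ.NonZero (q ℕ.^ 2)
      q²≢0 = ℕ.m^n≢0 q 2 {{ℕ.≢-nonZero λ q≡0 → odd (divides 0 q≡0)}}

  -- The characteristic p divides q, so q · 1 = 0; if 2 were 0 then q · 1 = 1.
  2≉0 : 1# + 1# ≉ 0#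
  2≉0 2≈0 = 1≉0 (trans (sym q·1≈1) (q·1≈0 prime-power))
    where
    q·1≈0 : IsPrimePower q → q · 1# ≈ 0#
    q·1≈0 (p , h , _ , q≡p^) = Characteristic.p∣m⇒m·x≈0 p (suc h ℕ.* 2) (q²≡p^ p h q≡p^) 1#
      (≡.subst (p ∣_) (≡.sym q≡p^) (m∣m*n (p ℕ.^ h)))
    even·1≈0 : ∀ m → (m ℕ.* 2) · 1# ≈ 0#
    even·1≈0 zero    = refl
    even·1≈0 (suc m) = trans (sym (+-assoc _ _ _)) (trans (+-cong 2≈0 (even·1≈0 m)) (+-identityˡ 0#))
    q·1≈1 : q · 1# ≈ 1#
    q·1≈1 with q % 2 | m≡m%n+[m/n]*n q 2 | m%n<n q 2
    ... | 0 | q≡ | _ = contradiction (divides (q / 2) q≡) odd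
    ... | 1 | q≡ | _ = trans (reflexive (≡.cong (_· 1#) q≡))
      (trans (+-congˡ (even·1≈0 (q / 2))) (+-identityʳ 1#))
    ... | suc (suc _) | _ | ℕ.s≤s (ℕ.s≤s ())

  open Conjugation conj conj-cong conj-+ conj-* conj-involutive 2≉0 public
  open AffinePlane 2≉0
  open Plane K q hiding (1#0)
  open Coords
  private module ∼ = Setoid coordsSetoid

  -- Homogeneous and affine coordinates; collineations on the affine plane.

  I-resp-point : ∀ {P R} l → P ∼ R → R I l → P I l
  I-resp-point {P} {R} l (k , _ , ex , ey , ez) i =
    by ((x l) ⊛ ex ⊞ (y l) ⊛ ey ⊞ (z l) ⊛ ez ⊞ k ⊛ i)
      (solve 10 (λ xl xP yl yP zl zP k xR yR zR →
             xl :* xP :+ yl :* yP :+ zl :* zP :+ (xl :* (k :* xR) :+ yl :* (k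
               :* yR) :+ zl :* (k :* zR) :+ k :* :0)
          := :0 :+ (xl :* xP :+ yl :* yP :+ zl :* zP :+ k :* (xl :* xR :+ yl
               :* yR :+ zl :* zR)))
          refl (x l) (x P) (y l) (y P) (z l) (z P) k (x R) (y R) (z R))

  I-sym : ∀ P l → P I l → l I P
  I-sym P l = trans (+-cong (+-cong (*-comm _ _) (*-comm _ _)) (*-comm _ _))

  I-resp-line : ∀ P {l m} → l ∼ m → P I m → P I l
  I-resp-line P {l} {m} l∼m i = I-sym l P (I-resp-point {l} {m} P l∼m (I-sym P m i))

  P∞-I : ∀ l → P∞ I l → y l ≈ 0#
  P∞-I l i = by i
    (solve 3 (λ yl xl zl →
           yl :+ :0
        := :0 :+ (xl :* :0 :+ yl :* :1 :+ zl :* :0))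
        refl (y l) (x l) (z l))

  affine-≁-P∞ : ∀ {a b} → ¬ (affine a b ∼ P∞)
  affine-≁-P∞ (k , _ , _ , _ , 1≈k0) = 1≉0 (trans 1≈k0 (zeroʳ k))

  affine-cong : ∀ {a b a′ b′} → a ≈ a′ → b ≈ b′ → affine a b ∼ affine a′ b′
  affine-cong a≈ b≈ = 1# , ≉⇒# 1≉0 ,
    trans a≈ (sym (*-identityˡ _)) , trans b≈ (sym (*-identityˡ _)) , sym (*-identityˡ _)

  affine-injective : ∀ {a b a′ b′} → affine a b ∼ affine a′ b′ → (a , b) ≋ (a′ , b′)
  affine-injective {a} {b} {a′} {b′} (k , _ , ex , ey , ez) =
    by (ex ⊞ (- a′) ⊛ ez)
      (solve 3 (λ a k a′ →
             a :+ (k :* a′ :+ (:- a′) :* (k :* :1))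
          := a′ :+ (a :+ (:- a′) :* :1))
          refl a k a′) ,
    (by (ey ⊞ (- b′) ⊛ ez)
      (solve 3 (λ b k b′ →
             b :+ (k :* b′ :+ (:- b′) :* (k :* :1))
          := b′ :+ (b :+ (:- b′) :* :1))
          refl b k b′))

  I-ℓ∞⇒z≈0 : ∀ {P} → P I ℓ∞ → z P ≈ 0#
  I-ℓ∞⇒z≈0 {P} i = by i
    (solve 3 (λ zP xP yP →
           zP :+ :0
        := :0 :+ (:0 :* xP :+ :0 :* yP :+ :1 :* zP))
        refl (z P) (x P) (y P))

  z≈0⇒I-ℓ∞ : ∀ {P} → z P ≈ 0# → P I ℓ∞
  z≈0⇒I-ℓ∞ {P} e = by e
    (solve 3 (λ xP yP zP →
           :0 :* xP :+ :0 :* yP :+ :1 :* zP :+ :0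
        := :0 :+ zP)
        refl (x P) (y P) (z P))

  affine-not-I-ℓ∞ : ∀ a b → ¬ (affine a b I ℓ∞)
  affine-not-I-ℓ∞ a b i = 1≉0 (I-ℓ∞⇒z≈0 {affine a b} i)

  -- Affine coordinates of a point, with the junk value (0 , 0) on ℓ∞.
  coords : Point → AffinePoint
  coords P with z P ≟ 0#
  ... | yes _   = 0# , 0#
  ... | no  z≉0 = x P * proj₁ (inverse z≉0) , y P * proj₁ (inverse z≉0)

  affine-coords : ∀ {P} → ¬ (P I ℓ∞) → P ∼ affine (proj₁ (coords P)) (proj₂ (coords P))
  affine-coords {P} P∉ℓ∞ with z P ≟ 0#
  ... | yes z≈0 = contradiction (z≈0⇒I-ℓ∞ {P} z≈0) P∉ℓ∞
  ... | no  z≉0 with inverse z≉0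
  ...   | i , zi≈1 = z P , ≉⇒# z≉0 , scale (x P) , scale (y P) , sym (*-identityʳ _)
    where
    scale : ∀ a → a ≈ z P * (a * i)
    scale a = by ((- a) ⊛ zi≈1)
      (solve 3 (λ a zP i →
             a :+ (:- a) :* :1
          := zP :* (a :* i) :+ (:- a) :* (zP :* i))
          refl a (z P) i)

  -- Eliminating between the three incidences shows that each coordinate of `l` times the
  -- determinant is 0, and one of the coordinates is nonzero.
  collinear-affine : ∀ l {a₁ b₁ a₂ b₂ a₃ b₃} → affine a₁ b₁ I l → affine a₂ b₂ I l → affine a₃ b₃ I l →
                     Collinear (a₁ , b₁) (a₂ , b₂) (a₃ , b₃)
  collinear-affine l {a₁} {b₁} {a₂} {b₂} {a₃} {b₃} i₁ i₂ i₃ = case (nonzero l)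
    where
    D = (a₂ - a₁) * (b₃ - b₁) - (a₃ - a₁) * (b₂ - b₁)
    xD≈0 : x l * D ≈ 0#
    xD≈0 = by ((b₃ - b₁) ⊛ i₂ ⊞ (b₂ - b₃) ⊛ i₁ ⊞ (b₁ - b₂) ⊛ i₃)
      (solve 9 (λ xl a₂ a₁ b₃ b₁ a₃ b₂ yl zl →
             xl :* ((a₂ :- a₁) :* (b₃ :- b₁) :- (a₃ :- a₁) :* (b₂ :- b₁)) :+ ((b₃
               :- b₁) :* :0 :+ (b₂ :- b₃) :* :0 :+ (b₁ :- b₂) :* :0)
          := :0 :+ ((b₃ :- b₁) :* (xl :* a₂ :+ yl :* b₂ :+ zl :* :1) :+ (b₂ :- b₃)
               :* (xl :* a₁ :+ yl :* b₁ :+ zl :* :1) :+ (b₁ :- b₂) :* (xl :* a₃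
               :+ yl :* b₃ :+ zl :* :1)))
          refl (x l) a₂ a₁ b₃ b₁ a₃ b₂ (y l) (z l))
    yD≈0 : y l * D ≈ 0#
    yD≈0 = by ((a₁ - a₃) ⊛ i₂ ⊞ (a₃ - a₂) ⊛ i₁ ⊞ (a₂ - a₁) ⊛ i₃)
      (solve 9 (λ yl a₂ a₁ b₃ b₁ a₃ b₂ xl zl →
             yl :* ((a₂ :- a₁) :* (b₃ :- b₁) :- (a₃ :- a₁) :* (b₂ :- b₁)) :+ ((a₁
               :- a₃) :* :0 :+ (a₃ :- a₂) :* :0 :+ (a₂ :- a₁) :* :0)
          := :0 :+ ((a₁ :- a₃) :* (xl :* a₂ :+ yl :* b₂ :+ zl :* :1) :+ (a₃ :- a₂)
               :* (xl :* a₁ :+ yl :* b₁ :+ zl :* :1) :+ (a₂ :- a₁) :* (xl :* a₃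
               :+ yl :* b₃ :+ zl :* :1)))
          refl (y l) a₂ a₁ b₃ b₁ a₃ b₂ (x l) (z l))
    zD≈0 : z l * D ≈ 0#
    zD≈0 = by (D ⊛ i₁ ⊞ (- a₁) ⊛ xD≈0 ⊞ (- b₁) ⊛ yD≈0)
      (solve 6 (λ zl D a₁ b₁ xl yl →
             zl :* D :+ (D :* :0 :+ (:- a₁) :* :0 :+ (:- b₁) :* :0)
          := :0 :+ (D :* (xl :* a₁ :+ yl :* b₁ :+ zl :* :1) :+ (:- a₁) :* (xl
               :* D) :+ (:- b₁) :* (yl :* D)))
          refl (z l) D a₁ b₁ (x l) (y l))
    case : (x l # 0#) ⊎ (y l # 0#) ⊎ (z l # 0#) → D ≈ 0#
    case (inj₁ x#0)        = x*y≈0⇒y≈0 (#⇒≉ x#0) xD≈0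
    case (inj₂ (inj₁ y#0)) = x*y≈0⇒y≈0 (#⇒≉ y#0) yD≈0
    case (inj₂ (inj₂ z#0)) = x*y≈0⇒y≈0 (#⇒≉ z#0) zD≈0

  -- The coordinates of the line are the cross product of the two points.
  join : ∀ {a₁ b₁ a₂ b₂} → a₁ ≉ a₂ ⊎ b₁ ≉ b₂ →
    ∃[ l ] affine a₁ b₁ I l × affine a₂ b₂ I l ×
      (∀ {a₃ b₃} → Collinear (a₁ , b₁) (a₂ , b₂) (a₃ , b₃) → affine a₃ b₃ I l)
  join {a₁} {b₁} {a₂} {b₂} distinct = l ,
    (solve 4 (λ b₁ b₂ a₁ a₂ →
           (b₁ :- b₂) :* a₁ :+ (a₂ :- a₁) :* b₁ :+ (a₁ :* b₂ :- a₂ :* b₁) :* :1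
        := :0)
        refl b₁ b₂ a₁ a₂) ,
    (solve 4 (λ b₁ b₂ a₂ a₁ →
           (b₁ :- b₂) :* a₂ :+ (a₂ :- a₁) :* b₂ :+ (a₁ :* b₂ :- a₂ :* b₁) :* :1
        := :0)
        refl b₁ b₂ a₂ a₁) ,
    λ {a₃} {b₃} e → (by e
      (solve 6 (λ b₁ b₂ a₃ a₂ a₁ b₃ →
             (b₁ :- b₂) :* a₃ :+ (a₂ :- a₁) :* b₃ :+ (a₁ :* b₂ :- a₂ :* b₁) :* :1
               :+ :0
          := :0 :+ ((a₂ :- a₁) :* (b₃ :- b₁) :- (a₃ :- a₁) :* (b₂ :- b₁)))
          refl b₁ b₂ a₃ a₂ a₁ b₃))
    where
    nonzero-l : a₁ ≉ a₂ ⊎ b₁ ≉ b₂ → b₁ - b₂ # 0# ⊎ a₂ - a₁ # 0# ⊎ a₁ * b₂ - a₂ * b₁ # 0#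
    nonzero-l (inj₁ a≉) = inj₂ (inj₁ (≉⇒# λ e → a≉ (sym (x-y≈0⇒x≈y e))))
    nonzero-l (inj₂ b≉) = inj₁ (≉⇒# λ e → b≉ (x-y≈0⇒x≈y e))
    l : Line
    l = ⟨ b₁ - b₂ , a₂ - a₁ , a₁ * b₂ - a₂ * b₁ ⟩[ nonzero-l distinct ]

  inverse-collineation : Collineation → Collineation
  inverse-collineation φ = record
    { onPoints  = Symmetry.inverse onPoints
    ; onLines   = Symmetry.inverse onLines
    ; incidence = λ P l → mk⇔
        (λ i → Equivalence.from (incidence _ _)
          (I-resp-point {point (P′ P)} {P} (line (l′ l)) (Inverse.strictlyInverseˡ onPoints P)
            (I-resp-line P {line (l′ l)} {l} (Inverse.strictlyInverseˡ onLines l) i)))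
        (λ i → I-resp-point {P} {point (P′ P)} l (∼.sym {point (P′ P)} {P} (Inverse.strictlyInverseˡ onPoints P))
          (I-resp-line (point (P′ P)) {l} {line (l′ l)} (∼.sym {line (l′ l)} {l} (Inverse.strictlyInverseˡ onLines l))
            (Equivalence.to (incidence _ _) i)))
    }
    where
    open Collineation φ
    P′ = Inverse.from onPoints
    l′ = Inverse.from onLines

  module Affine (φ : Collineation) (φℓ∞∼ℓ∞ : Collineation.line φ ℓ∞ ∼ ℓ∞) where
    open Collineation φ

    point-cong : ∀ {P R} → P ∼ R → point P ∼ point R
    point-cong {P} {R} = Inverse.to-cong onPoints {P} {R}

    point-I : ∀ {P l} → P I l → point P I line l
    point-I {P} {l} = Equivalence.to (incidence P l)

    point-I⁻¹ : ∀ {P l} → point P I line l → P I l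
    point-I⁻¹ {P} {l} = Equivalence.from (incidence P l)

    point-∉ℓ∞ : ∀ {P} → ¬ (P I ℓ∞) → ¬ (point P I ℓ∞)
    point-∉ℓ∞ {P} P∉ℓ∞ i = P∉ℓ∞ (point-I⁻¹ {P} {ℓ∞} (I-resp-line (point P) {line ℓ∞} {ℓ∞} φℓ∞∼ℓ∞ i))

    -- Since ℓ∞ is fixed, images of affine points are affine and the junk value of `coords` is never
    -- taken.
    map : AffinePoint → AffinePoint
    map (a , b) = coords (point (affine a b))

    point-affine : ∀ a b → point (affine a b) ∼ affine (proj₁ (map (a , b))) (proj₂ (map (a , b)))
    point-affine a b = affine-coords {point (affine a b)} (point-∉ℓ∞ {affine a b} (affine-not-I-ℓ∞ a b))

    map-unique : ∀ {a b a′ b′} → point (affine a b) ∼ affine a′ b′ → map (a , b) ≋ (a′ , b′)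
    map-unique {a} {b} {a′} {b′} e = affine-injective
      (∼.trans {m} {point (affine a b)} {affine a′ b′} (∼.sym {point (affine a b)} {m} (point-affine a b)) e)
      where m = affine (proj₁ (map (a , b))) (proj₂ (map (a , b)))

    map-cong : ∀ {p r} → p ≋ r → map p ≋ map r
    map-cong {a , b} {a′ , b′} (a≈ , b≈) = map-unique
      (∼.trans {point (affine a b)} {point (affine a′ b′)} {affine (proj₁ (map (a′ , b′))) (proj₂ (map (a′ , b′)))}
        (point-cong {affine a b} {affine a′ b′} (affine-cong a≈ b≈)) (point-affine a′ b′))

    map-I : ∀ {a b} l → affine a b I l → affine (proj₁ (map (a , b))) (proj₂ (map (a , b))) I line l
    map-I {a} {b} l i = I-resp-point {m} {point (affine a b)} (line l)
      (∼.sym {point (affine a b)} {m} (point-affine a b)) (point-I {affine a b} {l} i)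
      where m = affine (proj₁ (map (a , b))) (proj₂ (map (a , b)))

    private
      map-collinear-distinct : ∀ {a₁ b₁ a₂ b₂ p₃} → a₁ ≉ a₂ ⊎ b₁ ≉ b₂ → Collinear (a₁ , b₁) (a₂ , b₂) p₃ →
                               Collinear (map (a₁ , b₁)) (map (a₂ , b₂)) (map p₃)
      map-collinear-distinct distinct e =
        let l , i₁ , i₂ , i₃ = join distinct
        in collinear-affine (line l) (map-I l i₁) (map-I l i₂) (map-I l (i₃ e))

      collinear-degenerate : ∀ {p₁ p₂ p₃} → p₁ ≋ p₂ → Collinear p₁ p₂ p₃
      collinear-degenerate {x₁ , y₁} {x₂ , y₂} {x₃ , y₃} (x≈ , y≈) =
        by ((- (y₃ - y₁)) ⊛ x≈ ⊞ (x₃ - x₁) ⊛ y≈)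
          (solve 6 (λ x₂ x₁ y₃ y₁ x₃ y₂ →
                 (x₂ :- x₁) :* (y₃ :- y₁) :- (x₃ :- x₁) :* (y₂ :- y₁) :+ ((:- (y₃
                   :- y₁)) :* x₂ :+ (x₃ :- x₁) :* y₂)
              := :0 :+ ((:- (y₃ :- y₁)) :* x₁ :+ (x₃ :- x₁) :* y₁))
              refl x₂ x₁ y₃ y₁ x₃ y₂)

    -- A line to transport exists by `join` when the first two points differ; otherwise the
    -- determinant vanishes because their images agree.
    map-collinear : ∀ {p₁ p₂ p₃} → Collinear p₁ p₂ p₃ → Collinear (map p₁) (map p₂) (map p₃)
    map-collinear {a₁ , b₁} {a₂ , b₂} {p₃} e = cases (a₁ ≟ a₂) (b₁ ≟ b₂)
      where
      cases : Dec (a₁ ≈ a₂) → Dec (b₁ ≈ b₂) → Collinear (map (a₁ , b₁)) (map (a₂ , b₂)) (map p₃)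
      cases (yes a≈) (yes b≈) = collinear-degenerate (map-cong (a≈ , b≈))
      cases (no  a≉) _        = map-collinear-distinct (inj₁ a≉) e
      cases (yes _)  (no b≉)  = map-collinear-distinct (inj₂ b≉) e

  map-inverse : ∀ φ ψ φ∞ ψ∞ → (∀ P → Collineation.point φ (Collineation.point ψ P) ∼ P) →
                ∀ p → Affine.map φ φ∞ (Affine.map ψ ψ∞ p) ≋ p
  map-inverse φ ψ φ∞ ψ∞ φψ∼ (a , b) = Φ.map-unique
    (∼.trans {Φ.point (affine a′ b′)} {Φ.point (Ψ.point (affine a b))} {affine a b}
      (Φ.point-cong {affine a′ b′} {Ψ.point (affine a b)}
        (∼.sym {Ψ.point (affine a b)} {affine a′ b′} (Ψ.point-affine a b)))
      (φψ∼ (affine a b)))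
    where
    module Φ where
      open Affine φ φ∞ public
      open Collineation φ public
    module Ψ where
      open Affine ψ ψ∞ public
      open Collineation ψ public
    a′ = proj₁ (Ψ.map (a , b))
    b′ = proj₂ (Ψ.map (a , b))

  inverse-ℓ∞ : ∀ φ → Collineation.line φ ℓ∞ ∼ ℓ∞ → Collineation.line (inverse-collineation φ) ℓ∞ ∼ ℓ∞
  inverse-ℓ∞ φ φ∞ = ∼.trans {from ℓ∞} {from (line ℓ∞)} {ℓ∞}
    (Inverse.from-cong onLines {ℓ∞} {line ℓ∞} (∼.sym {line ℓ∞} {ℓ∞} φ∞)) (Inverse.strictlyInverseʳ onLines ℓ∞)
    where
    open Collineation φ
    from = Inverse.from onLines

  map-isCollineation : ∀ φ φ∞ → IsCollineation (Affine.map φ φ∞)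
  map-isCollineation φ φ∞ = record
    { cong        = map-cong
    ; surjective  = λ r → Ψ.map r , φψ r
    ; collinear   = map-collinear
    ; collinear⁻¹ = λ {p₁} {p₂} {p₃} e →
        collinear-resp (ψφ p₁) (ψφ p₂) (ψφ p₃) (Ψ.map-collinear {map p₁} {map p₂} {map p₃} e)
    }
    where
    ψ = inverse-collineation φ
    ψ∞ = inverse-ℓ∞ φ φ∞
    open Affine φ φ∞
    module Ψ = Affine ψ ψ∞
    open Collineation φ using (onPoints)
    φψ = map-inverse φ ψ φ∞ ψ∞ (Inverse.strictlyInverseˡ onPoints)
    ψφ = map-inverse ψ φ ψ∞ φ∞ (Inverse.strictlyInverseʳ onPoints)

  module _ (α β : Carrier) where

    𝒰-resp : ∀ {P R} → P ∼ R → R ∈ 𝒰 α β → P ∈ 𝒰 α β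
    𝒰-resp {P} {R} P∼R (inj₁ (t , r , r∈Fq , R∼)) = inj₁ (t , r , r∈Fq , ∼.trans {P} {R} {affine t _} P∼R R∼)
    𝒰-resp {P} {R} P∼R (inj₂ R∼P∞)                = inj₂ (∼.trans {P} {R} {P∞} P∼R R∼P∞)

    -- The expression is the parameter r of the point; `t ^ suc q` unfolds to `t * conj t`.
    affine∈𝒰⇒real : ∀ {x y} → affine x y ∈ 𝒰 α β → Real (y - α * (x * x) - β * (x * conj x))
    affine∈𝒰⇒real {x} {y} (inj₂ e) = contradiction e affine-≁-P∞
    affine∈𝒰⇒real {x} {y} (inj₁ (t , r , r-real , e)) = real-resp r≈ r-real
      where
      xy≈ = affine-injective e
      r≈ : r ≈ y - α * (x * x) - β * (x * conj x)
      r≈ = by ((- 1#) ⊛ (proj₂ xy≈)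
          ⊞ (α * (x + t) + β * (conj x)) ⊛ (proj₁ xy≈)
          ⊞ (β * t) ⊛ (conj-cong (proj₁ xy≈)))
        (solve 8 (λ r α t β conjt x conjx y →
               r :+ ((:- :1) :* (α :* (t :* t) :+ β :* (t :* conjt) :+ r) :+ (α
                 :* (x :+ t) :+ β :* conjx) :* t :+ β :* t :* conjt)
            := y :- α :* (x :* x) :- β :* (x :* conjx) :+ ((:- :1) :* y :+ (α
                 :* (x :+ t) :+ β :* conjx) :* x :+ β :* t :* conjx))
            refl r α t β (conj t) x (conj x) y)

    real⇒affine∈𝒰 : ∀ {x y} → Real (y - α * (x * x) - β * (x * conj x)) → affine x y ∈ 𝒰 α β
    real⇒affine∈𝒰 {x} {y} r-real = inj₁ (x , _ , r-real , affine-cong refl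
      (solve 5 (λ y α x β conjx →
             y
          := α :* (x :* x) :+ β :* (x :* conjx) :+ (y :- α :* (x :* x) :- β :* (x
               :* conjx)))
          refl y α x β (conj x)))

  -- Tangents and pedals of 𝒰 α β for real β.

  module _ {α β} (β-real : Real β) (α-anisotropic : Anisotropic α) where

    -- Let m be the slope of the tangent at (t , s). As β is real, norms times β are real, so (t + u
    -- , s + m u) is in the unital as soon as (m - 2αt) u - α u² is real. Tangency allows only u =
    -- 0, and `no-real-values⇒0` gives m = 2αt.
    tangent⇒parabola : ∀ {a b l P} → affine a b I l → MeetsOnlyAt (𝒰 α β) l P →
                       ∃[ t ] ∃[ s ] (P ∼ affine t s × OnParabola α-anisotropic a b t s)
    tangent⇒parabola {a} {b} {l} {P} Q∈l (P∈𝒰 , P∈l , unique) = point P∈𝒰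
      where
      -- Otherwise l would meet the unital in P∞ and in an affine point.
      B≉0 : y l ≉ 0#
      B≉0 B≈0 = affine-≁-P∞ (∼.trans {A} {P} {P∞} (unique A (real⇒affine∈𝒰 α β A-real) A∈l)
        (∼.sym {P∞} {P} (unique P∞ (inj₂ (∼.refl {P∞})) P∞∈l)))
        where
        -- The point of the unital with parameter r = 0 on the vertical line through (a , b).
        A = affine a (α * (a * a) + β * (a * conj a) + 0#)
        A-real : Real (α * (a * a) + β * (a * conj a) + 0# - α * (a * a) - β * (a * conj a))
        A-real = real-resp (solve 4 (λ α a β conja →
               :0
            := α :* (a :* a) :+ β :* (a :* conja) :+ :0 :- α :* (a :* a) :- β
                 :* (a :* conja))
            refl α a β (conj a)) conj-0
        P∞∈l : P∞ I l
        P∞∈l = by B≈0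
          (solve 3 (λ xl yl zl →
                 xl :* :0 :+ yl :* :1 :+ zl :* :0 :+ :0
              := :0 :+ yl)
              refl (x l) (y l) (z l))
        A∈l : A I l
        A∈l = by (Q∈l ⊞ (α * (a * a) + β * (a * (conj a)) + 0# - b) ⊛ B≈0)
          (solve 8 (λ xl a yl α β conja zl b →
                 xl :* a :+ yl :* (α :* (a :* a) :+ β :* (a :* conja) :+ :0)
                   :+ zl :* :1 :+ (:0 :+ (α :* (a :* a) :+ β :* (a :* conja) :+ :0
                   :- b) :* :0)
              := :0 :+ (xl :* a :+ yl :* b :+ zl :* :1 :+ (α :* (a :* a) :+ β
                   :* (a :* conja) :+ :0 :- b) :* yl))
              refl (x l) a (y l) α β (conj a) (z l) b)

      point : P ∈ 𝒰 α β → ∃[ t ] ∃[ s ] (P ∼ affine t s × OnParabola α-anisotropic a b t s)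
      point (inj₂ P∼P∞) = contradiction (P∞-I l (I-resp-point {P∞} {P} l (∼.sym {P} {P∞} P∼P∞) P∈l)) B≉0
      point (inj₁ (t , r , r-real , P∼)) = t , s , P∼ , on-parabola
        where
        s = α * (t * t) + β * (t * conj t) + r
        i = inverse B≉0
        m = - (x l * proj₁ i)
        Bm≈-A : y l * m ≈ - x l
        Bm≈-A = by ((- (x l)) ⊛ (proj₂ i))
          (solve 3 (λ yl xl proj₁i →
                 yl :* (:- (xl :* proj₁i)) :+ (:- xl) :* :1
              := (:- xl) :+ (:- xl) :* (yl :* proj₁i))
              refl (y l) (x l) (proj₁ i))
        At+Bs+C≈0 : x l * t + y l * s + z l * 1# ≈ 0#
        At+Bs+C≈0 = I-resp-point {affine t s} {P} l (∼.sym {P} {affine t s} P∼) P∈l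
        direction : ∀ u → Real ((m - 2# * α * t) * u - α * (u * u)) → u ≈ 0#
        direction u u-real =
          by (proj₁ (affine-injective (∼.trans {R} {P} {affine t s} (unique R (real⇒affine∈𝒰 α β R-real) R∈l) P∼)))
            (solve 2 (λ u t → u :+ t := :0 :+ (t :+ u)) refl u t)
          where
          R = affine (t + u) (s + m * u)
          norm-real : ∀ v → Real (β * (v * conj v))
          norm-real v = trans (β-real c* (refl c* conj-involutive v)) (*-congˡ (*-comm _ _))
          R-real : Real (s + m * u - α * ((t + u) * (t + u)) - β * ((t + u) * conj (t + u)))
          R-real = real-resp
            (solve 8 (λ r m α t u β conjt conjt+u →
                   r :+ ((m :- :2 :* α :* t) :* u :- α :* (u :* u)) :+ β :* (t
                     :* conjt) :- β :* ((t :+ u) :* conjt+u)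
                := α :* (t :* t) :+ β :* (t :* conjt) :+ r :+ m :* u :- α :* ((t
                     :+ u) :* (t :+ u)) :- β :* ((t :+ u) :* conjt+u))
                refl r m α t u β (conj t) (conj (t + u)))
            (r-real c+ u-real c+ norm-real t c- norm-real (t + u))
          R∈l : R I l
          R∈l = by (At+Bs+C≈0 ⊞ u ⊛ Bm≈-A)
            (solve 7 (λ xl t u yl s m zl →
                   xl :* (t :+ u) :+ yl :* (s :+ m :* u) :+ zl :* :1 :+ (:0 :+ u
                     :* (:- xl))
                := :0 :+ (xl :* t :+ yl :* s :+ zl :* :1 :+ u :* (yl :* m)))
                refl (x l) t u (y l) s m (z l))
        m≈2αt : m - 2# * α * t ≈ 0#
        m≈2αt = no-real-values⇒0 α-anisotropic (m - 2# * α * t) direction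
        on-parabola : s ≈ b - 2# * α * t * a + 2# * α * t * t
        on-parabola = *-cancelˡ-≉ B≉0
          (by (At+Bs+C≈0 ⊞ (- 1#) ⊛ Q∈l ⊞ (a - t) ⊛ Bm≈-A ⊞ ((y l) * (t - a)) ⊛ m≈2αt)
            (solve 9 (λ yl s a t xl b α zl m →
                   yl :* s :+ (:0 :+ (:- :1) :* :0 :+ (a :- t) :* (:- xl) :+ yl
                     :* (t :- a) :* :0)
                := yl :* (b :- :2 :* α :* t :* a :+ :2 :* α :* t :* t) :+ (xl
                     :* t :+ yl :* s :+ zl :* :1 :+ (:- :1) :* (xl :* a :+ yl :* b
                     :+ zl :* :1) :+ (a :- t) :* (yl :* m) :+ yl :* (t :- a) :* (m
                     :- :2 :* α :* t)))
                refl (y l) s a t (x l) b α (z l) m))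

    pedal-arc : ∀ {Q} → ¬ (Q I ℓ∞) → IsArc (pedal (𝒰 α β) Q)
    pedal-arc {Q} Q∉ℓ∞ l P₁ P₂ P₃ (l₁ , Q∈l₁ , touch₁) (l₂ , Q∈l₂ , touch₂) (l₃ , Q∈l₃ , touch₃) P₁∈l P₂∈l P₃∈l =
      conclude
        (tangent⇒parabola {a} {b} {l₁} {P₁} (Q′ l₁ Q∈l₁) touch₁)
        (tangent⇒parabola {a} {b} {l₂} {P₂} (Q′ l₂ Q∈l₂) touch₂)
        (tangent⇒parabola {a} {b} {l₃} {P₃} (Q′ l₃ Q∈l₃) touch₃)

      where
      a = proj₁ (coords Q)
      b = proj₂ (coords Q)
      Q′ : ∀ m → Q I m → affine a b I m
      Q′ m = I-resp-point {affine a b} {Q} m (∼.sym {Q} {affine a b} (affine-coords {Q} Q∉ℓ∞))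

      ParabolaPoint : Point → Set _
      ParabolaPoint P = ∃[ t ] ∃[ s ] (P ∼ affine t s × OnParabola α-anisotropic a b t s)

      same-abscissa : ∀ {P R t s t′ s′} → P ∼ affine t s → R ∼ affine t′ s′ →
        OnParabola α-anisotropic a b t s → OnParabola α-anisotropic a b t′ s′ → t ≈ t′ → P ∼ R
      same-abscissa {P} {R} {t} {s} {t′} {s′} P∼ R∼ p p′ t≈t′ = ∼.trans {P} {affine t s} {R} P∼
        (∼.trans {affine t s} {affine t′ s′} {R} (affine-cong t≈t′ s≈s′) (∼.sym {R} {affine t′ s′} R∼))
        where
        s≈s′ : s ≈ s′
        s≈s′ = by (p ⊞ (- 1#) ⊛ p′ ⊞ (2# * α * (t + t′ - a)) ⊛ t≈t′)
          (solve 7 (λ s b α t a t′ s′ →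
                 s :+ (b :- :2 :* α :* t :* a :+ :2 :* α :* t :* t :+ (:- :1)
                   :* (b :- :2 :* α :* t′ :* a :+ :2 :* α :* t′ :* t′) :+ :2 :* α
                   :* (t :+ t′ :- a) :* t′)
              := s′ :+ (s :+ (:- :1) :* s′ :+ :2 :* α :* (t :+ t′ :- a) :* t))
              refl s b α t a t′ s′)

      nonzero-line : ¬ (x l ≈ 0# × y l ≈ 0# × z l ≈ 0#)
      nonzero-line (x≈0 , y≈0 , z≈0) with nonzero l
      ... | inj₁ x#0        = #⇒≉ x#0 x≈0
      ... | inj₂ (inj₁ y#0) = #⇒≉ y#0 y≈0
      ... | inj₂ (inj₂ z#0) = #⇒≉ z#0 z≈0

      on-l : ∀ {P t s} → P ∼ affine t s → P I l → affine t s I l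
      on-l {P} {t} {s} P∼ = I-resp-point {affine t s} {P} l (∼.sym {P} {affine t s} P∼)

      conclude : ParabolaPoint P₁ → ParabolaPoint P₂ → ParabolaPoint P₃ → P₁ ∼ P₂ ⊎ P₁ ∼ P₃ ⊎ P₂ ∼ P₃
      conclude (t₁ , s₁ , P₁∼ , p₁) (t₂ , s₂ , P₂∼ , p₂) (t₃ , s₃ , P₃∼ , p₃) =
        cases (t₁ ≟ t₂) (t₁ ≟ t₃) (t₂ ≟ t₃)
        where
        cases : Dec (t₁ ≈ t₂) → Dec (t₁ ≈ t₃) → Dec (t₂ ≈ t₃) → P₁ ∼ P₂ ⊎ P₁ ∼ P₃ ⊎ P₂ ∼ P₃
        cases (yes e) _       _       = inj₁ (same-abscissa {P₁} {P₂} P₁∼ P₂∼ p₁ p₂ e)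
        cases (no _)  (yes e) _       = inj₂ (inj₁ (same-abscissa {P₁} {P₃} P₁∼ P₃∼ p₁ p₃ e))
        cases (no _)  (no _)  (yes e) = inj₂ (inj₂ (same-abscissa {P₂} {P₃} P₂∼ P₃∼ p₂ p₃ e))
        cases (no n₁₂) (no n₁₃) (no n₂₃) = contradiction
          (parabola-arc α-anisotropic a b p₁ p₂ p₃
            (on-l {P₁} P₁∼ P₁∈l) (on-l {P₂} P₂∼ P₂∈l) (on-l {P₃} P₃∼ P₃∈l) n₁₂ n₁₃ n₂₃)
          nonzero-line

  -- Transport along the collineation.

  module _ {u} {U : Pred Point u} {α β} (φ : Collineation) (φ∞ : Collineation.line φ ℓ∞ ∼ ℓ∞)
    (U≐φ𝒰 : ∀ P → P ∈ U ⇔ (∃[ R ] (R ∈ 𝒰 α β × Collineation.point φ R ∼ P))) where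

    open Collineation φ
    open Affine φ φ∞
    private
      ψ  = inverse-collineation φ
      ψ∞ = inverse-ℓ∞ φ φ∞
      open Collineation ψ using () renaming (point to point⁻¹; line to line⁻¹)
      module Ψ = Affine ψ ψ∞

      point-point⁻¹ : ∀ P → point (point⁻¹ P) ∼ P
      point-point⁻¹ = Inverse.strictlyInverseˡ onPoints

      transpose : ∀ {P R} → point R ∼ P → R ∼ point⁻¹ P
      transpose {P} {R} e = ∼.trans {R} {point⁻¹ (point R)} {point⁻¹ P}
        (∼.sym {point⁻¹ (point R)} {R} (Inverse.strictlyInverseʳ onPoints R)) (Ψ.point-cong {point R} {P} e)

      point⁻¹-injective : ∀ {P R} → point⁻¹ P ∼ point⁻¹ R → P ∼ R
      point⁻¹-injective {P} {R} e = ∼.trans {P} {point (point⁻¹ P)} {R}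
        (∼.sym {point (point⁻¹ P)} {P} (point-point⁻¹ P))
        (∼.trans {point (point⁻¹ P)} {point (point⁻¹ R)} {R} (point-cong {point⁻¹ P} {point⁻¹ R} e) (point-point⁻¹ R))

    U⇒𝒰 : ∀ {P} → P ∈ U → point⁻¹ P ∈ 𝒰 α β
    U⇒𝒰 {P} P∈U =
      let R , R∈𝒰 , e = Equivalence.to (U≐φ𝒰 P) P∈U
      in 𝒰-resp α β {point⁻¹ P} {R} (∼.sym {R} {point⁻¹ P} (transpose {P} {R} e)) R∈𝒰

    𝒰⇒U : ∀ {R} → R ∈ 𝒰 α β → point R ∈ U
    𝒰⇒U {R} R∈𝒰 = Equivalence.from (U≐φ𝒰 (point R)) (R , R∈𝒰 , ∼.refl {point R})

    conic⊆U⇒β-real : ∀ C → NondegenerateConic.points C ⊆ U → Real β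
    conic⊆U⇒β-real C C⊆U with conj β ≟ β
    ... | yes β-real = β-real
    -- Arguing by contradiction provides the nonzero skew element that `conic⇒real` works with,
    -- namely β - conj β.
    ... | no  β≉     = contradiction β-real β≉
      where
      module N = NondegenerateConic C
      C₀ : Conic
      C₀ = record { a = N.a ; b = N.b ; d = N.d ; f = N.f ; g = N.g ; h = N.h }
      abstract
        pulled : ∃[ C′ ] Conic.det C′ ≉ 0# × (∀ p → Conic.eval C′ p ≈ 0# → Conic.eval C₀ (map p) ≈ 0#)
        pulled = pullback (collineation⇒semilinear (map-isCollineation φ φ∞)) C₀ (#⇒≉ N.nondegenerate)
      module C′ = Conic (proj₁ pulled)
      on-C : ∀ x y → Conic.eval C₀ (x , y) ≈ 0# → affine x y ∈ N.points
      on-C x y e = by e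
        (solve 8 (λ x Na Nh y Ng Nb Nf Nd →
               x :* (Na :* x :+ Nh :* y :+ Ng :* :1) :+ y :* (Nh :* x :+ Nb :* y
                 :+ Nf :* :1) :+ :1 :* (Ng :* x :+ Nf :* y :+ Nd :* :1) :+ :0
            := :0 :+ (x :* (Na :* x :+ Nh :* y :+ Ng) :+ y :* (Nh :* x :+ Nb
                 :* y :+ Nf) :+ (Ng :* x :+ Nf :* y :+ Nd)))
            refl x N.a N.h y N.g N.b N.f N.d)
      real : ∀ x y → Conic.eval (proj₁ pulled) (x , y) ≈ 0# → Real (y - α * (x * x) - β * (x * conj x))
      real x y e = affine∈𝒰⇒real α β (𝒰-resp α β {affine x y} {point⁻¹ P}
        (transpose {P} {affine x y} (point-affine x y))
        (U⇒𝒰 {P} (C⊆U {P} (on-C _ _ (proj₂ (proj₂ pulled) (x , y) e)))))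
        where P = affine (proj₁ (map (x , y))) (proj₂ (map (x , y)))
      β-real : Real β
      β-real = conic⇒real (λ e → β≉ (sym (x-y≈0⇒x≈y e))) (x-conj[x]-skew β)
        C′.a C′.b C′.d C′.f C′.g C′.h α β (proj₁ (proj₂ pulled)) real

    -- Tangency is expressed by membership and incidence alone, and the inverse collineation
    -- respects both.
    point⁻¹-pedal : ∀ {Q P} → P ∈ pedal U Q → point⁻¹ P ∈ pedal (𝒰 α β) (point⁻¹ Q)
    point⁻¹-pedal {Q} {P} (l , Q∈l , P∈U , P∈l , unique) =
      line⁻¹ l , Ψ.point-I {Q} {l} Q∈l , U⇒𝒰 {P} P∈U , Ψ.point-I {P} {l} P∈l , unique′
      where
      unique′ : ∀ R → R ∈ 𝒰 α β → R I line⁻¹ l → R ∼ point⁻¹ P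
      unique′ R R∈𝒰 R∈l = transpose {P} {R} (unique (point R) (𝒰⇒U {R} R∈𝒰)
        (I-resp-line (point R) {l} {line (line⁻¹ l)} (∼.sym {line (line⁻¹ l)} {l} (Inverse.strictlyInverseˡ onLines l))
          (point-I {R} {line⁻¹ l} R∈l)))

    pedal-arc-image : ∀ {Q} → ¬ (Q I ℓ∞) → (∀ {Q} → ¬ (Q I ℓ∞) → IsArc (pedal (𝒰 α β) Q)) → IsArc (pedal U Q)
    pedal-arc-image {Q} Q∉ℓ∞ arc l P₁ P₂ P₃ p₁ p₂ p₃ P₁∈l P₂∈l P₃∈l =
      Sum.map (point⁻¹-injective {P₁} {P₂}) (Sum.map (point⁻¹-injective {P₁} {P₃}) (point⁻¹-injective {P₂} {P₃}))
        (arc {point⁻¹ Q} (Ψ.point-∉ℓ∞ {Q} Q∉ℓ∞) (line⁻¹ l) (point⁻¹ P₁) (point⁻¹ P₂) (point⁻¹ P₃)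
          (point⁻¹-pedal {Q} {P₁} p₁) (point⁻¹-pedal {Q} {P₂} p₂) (point⁻¹-pedal {Q} {P₃} p₃)
          (Ψ.point-I {P₁} {l} P₁∈l) (Ψ.point-I {P₂} {l} P₂∈l) (Ψ.point-I {P₃} {l} P₃∈l))

  conicBM⇒pedal-arc : ∀ {u} (U : Pred Point u) → IsConicBM U →
    (Q : Point) → ¬ (Q ∈ U) → ¬ (Q I ℓ∞) → IsArc (pedal U Q)
  conicBM⇒pedal-arc U ((α , β , (_ , nonsquare) , φ , φ∞ , U≐φ𝒰) , C , C⊆U) Q _ Q∉ℓ∞ =
    pedal-arc-image φ φ∞ U≐φ𝒰 {Q} Q∉ℓ∞
      (λ {Q} → pedal-arc β-real (admissible⇒anisotropic β-real nonsquare) {Q})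
    where
    β-real = conic⊆U⇒β-real φ φ∞ U≐φ𝒰 C C⊆U

open import Data.Nat.Base using (_^_)

theorem2p9 : {c ℓ₁ ℓ₂ u : Level} (q : ℕ) → IsPrimePower q → ¬ (2 ∣ q) →
    (K : HeytingField c ℓ₁ ℓ₂) → HasOrder K (q ^ 2) →
    let open Plane K q in
    (U : Pred Point u) → IsConicBM U →
    (Q : Point) → ¬ (Q ∈ U) → ¬ (Q I ℓ∞) →
    IsArc (pedal U Q)
theorem2p9 q prime-power odd K order = Unital.conicBM⇒pedal-arc q prime-power odd K order
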